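{- For every integer $n\ge 0$, \[ \eta_{4}(25n+24)\equiv 0 \pmod{5}\qquad\text{and}\qquad \eta_{6}(49n+47)\equiv 0 \pmod{7}. \]
   Context: The rank of a partition is its largest part minus its number of parts. For integers $m$ and $n\ge 1$, $N(m,n)$ denotes the number of partitions of $n$ with rank $m$. For an integer $x$ and $k\ge 0$, $\binom{x}{k}=x(x-1)\cdots(x-k+1)/k!$ (the polynomial binomial coefficient, so $x$ may be negative). For $k\ge 1$ and $n\ge 1$ the symmetrized $k$-th rank moment is \[ \eta_{k}(n)=\sum_{m=-\infty}^{\infty}\binom{m+\lfloor \frac{k-1}{2}\rfloor}{k}N(m,n). \] In particular $\eta_4(n)=\sum_m\binom{m+1}{4}N(m,n)$ and $\eta_6(n)=\sum_m\binom{m+2}{6}N(m,n)$. -}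

module Defs where

open import Data.Nat as ℕ using (ℕ; zero; suc; _≤ᵇ_; _∸_)
open import Data.Nat.Base using (_!)
open import Data.Nat.Properties using (_!≢0)
open import Data.Integer as ℤ using (ℤ; +_; -[1+_]; _-_; _*_; _+_; _/ℕ_)
open import Data.List using (List; []; _∷_; length; map; concatMap; filterᵇ; sum; upTo; head)
open import Data.List using (foldr)
open import Data.Maybe using (Maybe; just; nothing)
open import Data.Bool using (Bool)

-- Partitions of n with all parts ≤ m, written as weakly decreasing lists of
-- positive parts (largest part first).  Defined by recursion on the fuel n.
partsBounded : (fuel n m : ℕ) → List (List ℕ)
partsBounded fuel zero m = [] ∷ []
partsBounded zero (suc n) m = []
partsBounded (suc fuel) (suc n) m =
  concatMap (λ j → map (λ p → suc j ∷ p) (partsBounded fuel (suc n ∸ suc j) (suc j)))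
            (filterᵇ (λ j → (suc j ℕ.≤ᵇ m) Data.Bool.∧ (suc j ℕ.≤ᵇ suc n)) (upTo (suc n)))

partitions : ℕ → List (List ℕ)
partitions n = partsBounded n n n

largest : List ℕ → ℕ
largest [] = 0
largest (x ∷ _) = x

rank : List ℕ → ℤ
rank p = + largest p - + length p

N : ℤ → ℕ → ℕ
N m n = length (filterᵇ (λ p → ⌊ rank p ℤ.≟ m ⌋) (partitions n))
  where open import Relation.Nullary.Decidable using (⌊_⌋)

falling : ℤ → ℕ → ℤ
falling x zero = + 1
falling x (suc k) = falling x k * (x - + k)

-- polynomial binomial coefficient (x choose k) = falling x k / k!  (exact division)
binomℤ : ℤ → ℕ → ℤ
binomℤ x k = _/ℕ_ (falling x k) (k !) {{k !≢0}}

rangeℤ : ℕ → List ℤ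
rangeℤ b = map (λ i → + i - + b) (upTo (suc (b ℕ.+ b)))

-- η_k(n) = Σ_m binom(m + ⌊(k-1)/2⌋, k) N(m,n).
-- Since N(m,n) = 0 for |m| ≥ n (rank of a partition of n lies in [1-n, n-1]),
-- the infinite sum equals the finite sum over m ∈ [-n, n].
η : ℕ → ℕ → ℤ
η k n = foldr _+_ (+ 0)
  (map (λ m → binomℤ (m + + ((k ∸ 1) ℕ./ 2)) k * + N m n) (rangeℤ n))

-- Write y = z + z⁻¹ - 2.  Dyson's adjoint relates the partitions of n with rank at least m - 2 to those
-- of n - m + 1 with rank at most m; weighted by m (m + 1) + 6 n it becomes a functional equation which,
-- multiplied by the cube of the theta function J, forces J³ G to be a monomial in z.  This is the
-- rank-crank identity, and its coefficients of y, y³ and y⁴ express the symmetrized rank moments through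
-- P = Σ p(n) qⁿ and the theta series Θ l = Σ (-1)ᵏ c(k,l) q^{k(k+1)/2}; the coefficient of y is Jacobi's
-- identity P³ Θ 0 = 1.  The congruences then follow from residues of exponents: modulo 5 the fourth
-- moment is P⁵ times a combination of products of lacunary series; modulo 7 the logarithmic derivative of
-- P is a polynomial in one series, and the sixth moment is, up to terms with no exponent ≡ 5 (mod 7), a
-- derivative plus a product of series whose exponents avoid 47 (mod 49).
module Submission where

open import Defs
open import Algebra.Bundles using (CommutativeRing)
open import Data.Bool using (Bool; true; false; if_then_else_; _∧_; T)
open import Data.Empty using (⊥; ⊥-elim)
open import Data.Fin using (zero; suc)
open import Data.Integer as ℤ using (ℤ; +_; -[1+_]; _+_; _*_; _-_; -_; 0ℤ; 1ℤ)
import Data.Integer.Divisibility as ℤᵤ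
open import Data.Integer.Divisibility.Signed using (_∣_; divides; _∣?_; ∣⇒∣ᵤ)
open import Data.Integer.DivMod using (a≡a%ℕn+[a/ℕn]*n)
import Data.Integer.Properties as ℤₚ
open import Data.Integer.Tactic.RingSolver using (solve-∀)
open import Data.List using (List; []; _∷_; _++_; map; foldr; concatMap; filterᵇ; upTo; applyUpTo; length; cartesianProductWith)
open import Data.List.Membership.Propositional using (_∈_)
open import Data.List.Membership.Propositional.Properties using (∈-cartesianProductWith⁺; ∈-map⁺)
import Data.List.Relation.Unary.All as All
open import Data.List.Relation.Unary.Any using (here)
open import Data.Maybe using (Maybe; just; nothing)
open import Data.Nat as ℕ using (ℕ; zero; suc; z≤n; s≤s; _!)
open import Data.List.Membership.DecPropositional ℕ._≟_ using (_∈?_)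
import Data.Nat.Divisibility as ℕ∣
open import Data.Nat.DivMod using (_%_; _/_; %-distribˡ-+; m≡m%n+[m/n]*n; m%n<n; m*n%n≡0; [m+kn]%n≡m%n; m%n*o≡m*o%[n*o]; m∣n⇒o%n%m≡o%m)
open import Data.Nat.Induction using (<-rec)
open import Data.Nat.Properties using (_!≢0)
import Data.Nat.Properties as ℕₚ
open import Data.Product using (∃; _×_; _,_; proj₁; proj₂)
open import Data.Sum using (_⊎_; inj₁; inj₂)
open import Data.Vec using (Vec; []; _∷_; lookup)
open import Function using (_∘_)
open import Relation.Binary.PropositionalEquality using (_≡_; _≢_; refl; sym; trans; cong; cong₂; subst; subst₂; module ≡-Reasoning)
open import Relation.Nullary using (yes; no; Dec)
open import Relation.Nullary.Decidable using (⌊_⌋; True; toWitness; False; toWitnessFalse; _⊎-dec_)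

-- Formal power series

-- For the generating function F of the weighted counts in z and q, Dyson's relation reads F(zq)/q +
-- z³F(z) = source. The weight removes the exceptional monomials at the price of a source quadratic
-- in m, that is, a pole of order three at z = 1. The theta function j vanishes at z = 1 and
-- satisfies j(zq) = -j(z)/z, so three factors of it cancel both the pole and the z³. Powers of y
-- are used because multiplication by j/(1 - z), which is symmetric in z and 1/z, becomes a product
-- of power series in y. On the rank side the coefficient of y^l mixes the moments of index l and l
-- - 1; the former enters with 20 = 4·5 for l = 3 and 42 = 6·7 for l = 4, which fixes the pairing of
-- y³ with 5 and y⁴ with 7. The obstacle modulo 7 is that terms of degree three and four survive
-- without a factor P⁷. They are polynomials in the logarithmic derivative of P, essentially E₂, and
-- its derivative. Modulo 7 the Eisenstein series satisfy E₆ = 1 and E₂ = E₄², so everything lies in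
-- one variable E₄; what cannot be integrated there is a multiple of P times the discriminant.

Series : Set
Series = ℕ → ℤ

tail : Series → Series
tail x n = x (suc n)

infixl 7 _∙_ _·_
infixl 6 _⊕_
infix 8 ⊖_

_⊕_ _∙_ : Series → Series → Series
(x ⊕ y) n = x n + y n
(x ∙ y) zero = x 0 * y 0
(x ∙ y) (suc n) = x 0 * y (suc n) + (tail x ∙ y) n

⊖_ : Series → Series
(⊖ x) n = - x n

_·_ : ℤ → Series → Series
(c · x) n = c * x n

const : ℤ → Series
const c zero = c
const c (suc n) = 0ℤ

𝟘 𝟙 : Series
𝟘 = const 0ℤ
𝟙 = const 1ℤ

δ : Series → Series
δ x n = + n * x n

∙-congˡ-≡ : ∀ {x x′ : Series} (y : Series) → (∀ n → x n ≡ x′ n) → ∀ n → (x ∙ y) n ≡ (x′ ∙ y) n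
∙-congˡ-≡ y e zero = cong (_* y 0) (e 0)
∙-congˡ-≡ y e (suc n) = cong₂ _+_ (cong (_* y (suc n)) (e 0)) (∙-congˡ-≡ y (λ k → e (suc k)) n)

·-∙ : ∀ c x y n → ((c · x) ∙ y) n ≡ c * (x ∙ y) n
·-∙ c x y zero = ℤₚ.*-assoc c (x 0) (y 0)
·-∙ c x y (suc n) = trans (cong (_+_ (c * x 0 * y (suc n))) (·-∙ c (tail x) y n)) (identity c (x 0) (y (suc n)) ((tail x ∙ y) n))
  where
  identity : ∀ c a b t → c * a * b + c * t ≡ c * (a * b + t)
  identity = solve-∀

∙-distribʳ-⊕ : ∀ z x y n → ((x ⊕ y) ∙ z) n ≡ (x ∙ z) n + (y ∙ z) n
∙-distribʳ-⊕ z x y zero = ℤₚ.*-distribʳ-+ (z 0) (x 0) (y 0)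
∙-distribʳ-⊕ z x y (suc n) = trans (cong (_+_ ((x 0 + y 0) * z (suc n))) (∙-distribʳ-⊕ z (tail x) (tail y) n)) (identity (x 0) (y 0) (z (suc n)) ((tail x ∙ z) n) ((tail y ∙ z) n))
  where
  identity : ∀ a b c s t → (a + b) * c + (s + t) ≡ a * c + s + (b * c + t)
  identity = solve-∀

-- The product recurses on the left factor; peeling the right factor instead is what commutativity
-- needs.
∙-suc : ∀ x y n → (x ∙ y) (suc n) ≡ (x ∙ tail y) n + x (suc n) * y 0
∙-suc x y zero = refl
∙-suc x y (suc n) = trans (cong (_+_ (x 0 * y (suc (suc n)))) (∙-suc (tail x) y n)) (sym (ℤₚ.+-assoc (x 0 * y (suc (suc n))) ((tail x ∙ tail y) n) (x (suc (suc n)) * y 0)))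

∙-comm : ∀ x y n → (x ∙ y) n ≡ (y ∙ x) n
∙-comm x y zero = ℤₚ.*-comm (x 0) (y 0)
∙-comm x y (suc n) = begin
  x 0 * y (suc n) + (tail x ∙ y) n ≡⟨ cong₂ _+_ (ℤₚ.*-comm (x 0) _) (∙-comm (tail x) y n) ⟩
  y (suc n) * x 0 + (y ∙ tail x) n ≡⟨ ℤₚ.+-comm _ ((y ∙ tail x) n) ⟩
  (y ∙ tail x) n + y (suc n) * x 0 ≡⟨ sym (∙-suc y x n) ⟩
  (y ∙ x) (suc n) ∎
  where open ≡-Reasoning

∙-assoc : ∀ x y z n → ((x ∙ y) ∙ z) n ≡ (x ∙ (y ∙ z)) n
∙-assoc x y z zero = ℤₚ.*-assoc (x 0) (y 0) (z 0)
∙-assoc x y z (suc n) = begin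
  x 0 * y 0 * z (suc n) + ((x 0 · tail y ⊕ tail x ∙ y) ∙ z) n
    ≡⟨ cong (_+_ (x 0 * y 0 * z (suc n))) (∙-distribʳ-⊕ z (x 0 · tail y) (tail x ∙ y) n) ⟩
  x 0 * y 0 * z (suc n) + (((x 0 · tail y) ∙ z) n + ((tail x ∙ y) ∙ z) n)
    ≡⟨ cong (_+_ (x 0 * y 0 * z (suc n))) (cong₂ _+_ (·-∙ (x 0) (tail y) z n) (∙-assoc (tail x) y z n)) ⟩
  x 0 * y 0 * z (suc n) + (x 0 * (tail y ∙ z) n + (tail x ∙ (y ∙ z)) n)
    ≡⟨ identity (x 0) (y 0) (z (suc n)) ((tail y ∙ z) n) _ ⟩
  x 0 * (y 0 * z (suc n) + (tail y ∙ z) n) + (tail x ∙ (y ∙ z)) n ∎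
  where
  open ≡-Reasoning
  identity : ∀ a b c s t → a * b * c + (a * s + t) ≡ a * (b * c + s) + t
  identity = solve-∀

𝟘-∙ : ∀ x n → ((λ _ → 0ℤ) ∙ x) n ≡ 0ℤ
𝟘-∙ x zero = refl
𝟘-∙ x (suc n) = trans (ℤₚ.+-identityˡ _) (𝟘-∙ x n)

const-∙ : ∀ c x n → (const c ∙ x) n ≡ c * x n
const-∙ c x zero = refl
const-∙ c x (suc n) = trans (cong (_+_ (c * x (suc n))) (𝟘-∙ x n)) (ℤₚ.+-identityʳ _)

𝟘≡0 : ∀ n → 𝟘 n ≡ 0ℤ
𝟘≡0 zero = refl
𝟘≡0 (suc n) = refl

δ-∙ : ∀ x y n → δ (x ∙ y) n ≡ (δ x ∙ y) n + (x ∙ δ y) n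
δ-∙ x y zero = identity (x 0) (y 0)
  where
  identity : ∀ a b → 0ℤ ≡ 0ℤ + a * 0ℤ
  identity = solve-∀
δ-∙ x y (suc n) = begin
  + suc n * (x 0 * y (suc n) + (tail x ∙ y) n)
    ≡⟨ cong (_* (x 0 * y (suc n) + (tail x ∙ y) n)) (ℤₚ.pos-+ 1 n) ⟩
  (1ℤ + + n) * (x 0 * y (suc n) + (tail x ∙ y) n)
    ≡⟨ identity (+ n) (x 0) (y (suc n)) ((tail x ∙ y) n) ⟩
  (tail x ∙ y) n + + n * (tail x ∙ y) n + x 0 * ((1ℤ + + n) * y (suc n))
    ≡⟨ cong₂ _+_ (cong (_+_ ((tail x ∙ y) n)) (δ-∙ (tail x) y n)) (cong (λ c → x 0 * (c * y (suc n))) (sym (ℤₚ.pos-+ 1 n))) ⟩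
  (tail x ∙ y) n + ((δ (tail x) ∙ y) n + (tail x ∙ δ y) n) + x 0 * δ y (suc n)
    ≡⟨ regroup ((tail x ∙ y) n) ((δ (tail x) ∙ y) n) ((tail x ∙ δ y) n) (x 0 * δ y (suc n)) ⟩
  (tail x ∙ y) n + (δ (tail x) ∙ y) n + (x 0 * δ y (suc n) + (tail x ∙ δ y) n)
    ≡⟨ cong (_+ (x ∙ δ y) (suc n)) (sym (∙-distribʳ-⊕ y (tail x) (δ (tail x)) n)) ⟩
  ((tail x ⊕ δ (tail x)) ∙ y) n + (x ∙ δ y) (suc n)
    ≡⟨ cong (_+ (x ∙ δ y) (suc n)) (∙-congˡ-≡ y (λ k → sym (tail-δ k)) n) ⟩
  (tail (δ x) ∙ y) n + (x ∙ δ y) (suc n)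
    ≡⟨ cong (_+ (x ∙ δ y) (suc n)) (sym (ℤₚ.+-identityˡ ((tail (δ x) ∙ y) n))) ⟩
  (δ x ∙ y) (suc n) + (x ∙ δ y) (suc n) ∎
  where
  open ≡-Reasoning
  identity : ∀ n a b t → (1ℤ + n) * (a * b + t) ≡ t + n * t + a * ((1ℤ + n) * b)
  identity = solve-∀
  regroup : ∀ a b c d → a + (b + c) + d ≡ a + b + (d + c)
  regroup = solve-∀
  tail-δ : ∀ k → tail (δ x) k ≡ tail x k + δ (tail x) k
  tail-δ k = trans (cong (_* x (suc k)) (ℤₚ.pos-+ 1 k)) (distrib (+ k) (x (suc k)))
    where
    distrib : ∀ k a → (1ℤ + k) * a ≡ a + k * a
    distrib = solve-∀

-- The modulus p = 0 gives equality of series.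
module Mod (p : ℤ) where

  infix 4 _≋_ _≈_

  -- The quotient is kept as data, so a numerical congruence is certified by `by k refl` and a
  -- divisibility can be read off at the end.
  record _≋_ (a b : ℤ) : Set where
    constructor by
    field
      quotient : ℤ
      equality : a ≡ b + quotient * p

  record _≈_ (x y : Series) : Set where
    constructor coefficients
    field
      at : ∀ n → x n ≋ y n

  open _≈_ public

  ≋-reflexive : ∀ {a b} → a ≡ b → a ≋ b
  ≋-reflexive {a} refl = by 0ℤ (sym (ℤₚ.+-identityʳ a))

  ≋-refl : ∀ {a} → a ≋ a
  ≋-refl = ≋-reflexive refl

  ≋-sym : ∀ {a b} → a ≋ b → b ≋ a
  ≋-sym {a} {b} (by k refl) = by (- k) (identity b k p)
    where
    identity : ∀ b k p → b ≡ b + k * p + - k * p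
    identity = solve-∀

  ≋-trans : ∀ {a b c} → a ≋ b → b ≋ c → a ≋ c
  ≋-trans {c = c} (by k refl) (by l refl) = by (l + k) (identity c k l p)
    where
    identity : ∀ c k l p → c + l * p + k * p ≡ c + (l + k) * p
    identity = solve-∀

  ≋-+ : ∀ {a b c d} → a ≋ b → c ≋ d → a + c ≋ b + d
  ≋-+ {b = b} {d = d} (by k refl) (by l refl) = by (k + l) (identity b d k l p)
    where
    identity : ∀ b d k l p → b + k * p + (d + l * p) ≡ b + d + (k + l) * p
    identity = solve-∀

  ≋-* : ∀ {a b c d} → a ≋ b → c ≋ d → a * c ≋ b * d
  ≋-* {b = b} {d = d} (by k refl) (by l refl) = by (k * d + b * l + k * p * l) (identity b d k l p)
    where
    identity : ∀ b d k l p → (b + k * p) * (d + l * p) ≡ b * d + (k * d + b * l + k * p * l) * p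
    identity = solve-∀

  ≋-neg : ∀ {a b} → a ≋ b → - a ≋ - b
  ≋-neg {b = b} (by k refl) = by (- k) (identity b k p)
    where
    identity : ∀ b k p → - (b + k * p) ≡ - b + - k * p
    identity = solve-∀

  ∣⇒≋0 : ∀ {a} → p ∣ a → a ≋ 0ℤ
  ∣⇒≋0 (divides k e) = by k (trans e (sym (ℤₚ.+-identityˡ _)))

  ≋0⇒∣ : ∀ {a} → a ≋ 0ℤ → p ∣ a
  ≋0⇒∣ (by k e) = divides k (trans e (ℤₚ.+-identityˡ _))

  ≈-reflexive : ∀ {x y} → (∀ n → x n ≡ y n) → x ≈ y
  ≈-reflexive e = coefficients (λ n → ≋-reflexive (e n))

  ∙-cong-at : ∀ {x x′ y y′} → x ≈ x′ → y ≈ y′ → ∀ n → (x ∙ y) n ≋ (x′ ∙ y′) n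
  ∙-cong-at e f zero = ≋-* (at e 0) (at f 0)
  ∙-cong-at e f (suc n) = ≋-+ (≋-* (at e 0) (at f (suc n))) (∙-cong-at (coefficients (λ k → at e (suc k))) f n)

  ring : CommutativeRing _ _
  ring = record
    { Carrier = Series ; _≈_ = _≈_ ; _+_ = _⊕_ ; _*_ = _∙_ ; -_ = ⊖_ ; 0# = 𝟘 ; 1# = 𝟙
    ; isCommutativeRing = record
      { isRing = record
        { +-isAbelianGroup = record
          { isGroup = record
            { isMonoid = record
              { isSemigroup = record
                { isMagma = record
                  { isEquivalence = record
                    { refl = coefficients (λ _ → ≋-refl)
                    ; sym = λ e → coefficients (λ n → ≋-sym (at e n))
                    ; trans = λ e f → coefficients (λ n → ≋-trans (at e n) (at f n)) }
                  ; ∙-cong = λ e f → coefficients (λ n → ≋-+ (at e n) (at f n)) }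
                ; assoc = λ x y z → ≈-reflexive (λ n → ℤₚ.+-assoc (x n) (y n) (z n)) }
              ; identity = (λ x → ≈-reflexive (λ n → trans (cong (_+ x n) (𝟘≡0 n)) (ℤₚ.+-identityˡ (x n))))
                         , (λ x → ≈-reflexive (λ n → trans (cong (_+_ (x n)) (𝟘≡0 n)) (ℤₚ.+-identityʳ (x n)))) }
            ; inverse = (λ x → ≈-reflexive (λ n → trans (ℤₚ.+-inverseˡ (x n)) (sym (𝟘≡0 n))))
                      , (λ x → ≈-reflexive (λ n → trans (ℤₚ.+-inverseʳ (x n)) (sym (𝟘≡0 n))))
            ; ⁻¹-cong = λ e → coefficients (λ n → ≋-neg (at e n)) }
          ; comm = λ x y → ≈-reflexive (λ n → ℤₚ.+-comm (x n) (y n)) }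
        ; *-cong = λ e f → coefficients (∙-cong-at e f)
        ; *-assoc = λ x y z → ≈-reflexive (∙-assoc x y z)
        ; *-identity = (λ x → ≈-reflexive (𝟙-∙ x))
                     , (λ x → ≈-reflexive (λ n → trans (∙-comm x 𝟙 n) (𝟙-∙ x n)))
        ; distrib = (λ x y z → ≈-reflexive (λ n → trans (∙-comm x (y ⊕ z) n) (trans (∙-distribʳ-⊕ x y z n) (cong₂ _+_ (∙-comm y x n) (∙-comm z x n)))))
                  , (λ x y z → ≈-reflexive (∙-distribʳ-⊕ x y z)) }
      ; *-comm = λ x y → ≈-reflexive (∙-comm x y) } }
    where
    𝟙-∙ : ∀ x n → (𝟙 ∙ x) n ≡ x n
    𝟙-∙ x n = trans (const-∙ 1ℤ x n) (ℤₚ.*-identityˡ (x n))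

  open CommutativeRing ring public using (setoid)
    renaming (refl to ≈-refl; sym to ≈-sym; trans to ≈-trans; +-cong to ⊕-cong; *-cong to ∙-cong; -‿cong to ⊖-cong; *-identityˡ to ∙-identityˡ)

  open import Algebra.Solver.Ring.AlmostCommutativeRing using (fromCommutativeRing; _-Raw-AlmostCommutative⟶_)

  constants : CommutativeRing.rawRing ℤₚ.+-*-commutativeRing -Raw-AlmostCommutative⟶ fromCommutativeRing ring
  constants = record
    { ⟦_⟧ = const
    ; +-homo = λ a b → ≈-reflexive λ { zero → refl ; (suc n) → refl }
    ; *-homo = λ a b → ≈-reflexive λ { zero → refl ; (suc n) → sym (trans (const-∙ a (const b) (suc n)) (ℤₚ.*-zeroʳ a)) }
    ; -‿homo = λ a → ≈-reflexive λ { zero → refl ; (suc n) → refl }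
    ; 0-homo = ≈-refl
    ; 1-homo = ≈-refl }

  const-cong : ∀ {a b} → a ≋ b → const a ≈ const b
  const-cong e = coefficients λ { zero → e ; (suc n) → ≋-refl }

  decide-≡ : ∀ a b → Maybe (const a ≈ const b)
  decide-≡ a b with a ℤ.≟ b
  ... | yes refl = just ≈-refl
  ... | no _ = nothing

  module Solver where
    open import Algebra.Solver.Ring _ (fromCommutativeRing ring) constants decide-≡ public
      using (solve; _:=_; _:+_; _:*_; :-_; con; Polynomial)

  -- Coefficients are reduced modulo p after every operation.
  module CharSolver (k : ℕ) (p≡ : p ≡ + suc k) where

    reduce : ℤ → ℤ
    reduce a = + (a ℤ.%ℕ suc k)

    reduce-≋ : ∀ a → const (reduce a) ≈ const a
    reduce-≋ a = ≈-sym (const-cong (by (a ℤ./ℕ suc k) (trans (a≡a%ℕn+[a/ℕn]*n a (suc k)) (cong (λ m → reduce a + a ℤ./ℕ suc k * m) (sym p≡)))))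

    open _-Raw-AlmostCommutative⟶_ constants

    reduced-constants : record
      { Carrier = ℤ ; _≈_ = _≡_ ; _+_ = λ a b → reduce (a + b) ; _*_ = λ a b → reduce (a * b)
      ; -_ = λ a → reduce (- a) ; 0# = 0ℤ ; 1# = 1ℤ } -Raw-AlmostCommutative⟶ fromCommutativeRing ring
    reduced-constants = record
      { ⟦_⟧ = const
      ; +-homo = λ a b → ≈-trans (reduce-≋ (a + b)) (+-homo a b)
      ; *-homo = λ a b → ≈-trans (reduce-≋ (a * b)) (*-homo a b)
      ; -‿homo = λ a → ≈-trans (reduce-≋ (- a)) (-‿homo a)
      ; 0-homo = ≈-refl
      ; 1-homo = ≈-refl }

    decide-reduced : ∀ a b → Maybe (const a ≈ const b)
    decide-reduced a b with reduce a ℤ.≟ reduce b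
    ... | yes e = just (≈-trans (≈-sym (reduce-≋ a)) (≈-trans (≈-reflexive (λ n → cong (λ c → const c n) e)) (reduce-≋ b)))
    ... | no _ = nothing

    open import Algebra.Solver.Ring _ (fromCommutativeRing ring) reduced-constants decide-reduced public
      using (solve; prove; _:=_; _:+_; _:*_; _:-_; :-_; _:^_; con; var; op; [+]; [*]; ⟦_⟧; Polynomial; Env)

-- Derivations

module Calculus (k : ℕ) where

  open Mod (+ suc k)
  open CharSolver k refl
  open import Relation.Binary.Reasoning.Setoid setoid

  δ-cong : ∀ {x y} → x ≈ y → δ x ≈ δ y
  δ-cong e = coefficients (λ n → ≋-* (≋-refl {+ n}) (at e n))

  δ-⊕ : ∀ x y → δ (x ⊕ y) ≈ δ x ⊕ δ y
  δ-⊕ x y = ≈-reflexive (λ n → ℤₚ.*-distribˡ-+ (+ n) (x n) (y n))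

  δ-⊖ : ∀ x → δ (⊖ x) ≈ ⊖ δ x
  δ-⊖ x = ≈-reflexive (λ n → sym (ℤₚ.neg-distribʳ-* (+ n) (x n)))

  δ-const : ∀ c → δ (const c) ≈ 𝟘
  δ-const c = ≈-reflexive λ { zero → refl ; (suc n) → ℤₚ.*-zeroʳ (+ suc n) }

  leibniz : ∀ x y → δ (x ∙ y) ≈ δ x ∙ y ⊕ x ∙ δ y
  leibniz x y = ≈-reflexive (δ-∙ x y)

  -- The operator q d/dq - a. It kills the exponents congruent to a, so composing one operator for
  -- each residue of a support annihilates the series.
  θ : ℤ → Series → Series
  θ a x = δ x ⊕ const (- a) ∙ x

  θ-cong : ∀ a {x y} → x ≈ y → θ a x ≈ θ a y
  θ-cong a e = ⊕-cong (δ-cong e) (∙-cong (≈-refl {const (- a)}) e)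

  θ-coefficient : ∀ a x n → θ a x n ≡ (+ n - a) * x n
  θ-coefficient a x n = trans (cong (_+_ (+ n * x n)) (const-∙ (- a) x n)) (sym (ℤₚ.*-distribʳ-+ (x n) (+ n) (- a)))

  -- Leibniz' rule on solver syntax, with `s` listing the derivatives of the variables. A
  -- differential identity between series thereby reduces to a polynomial identity that the solver
  -- decides.
  differentiate : ∀ {m} → Vec (Polynomial m) m → Polynomial m → Polynomial m
  differentiate s (op [+] a b) = differentiate s a :+ differentiate s b
  differentiate s (op [*] a b) = differentiate s a :* b :+ a :* differentiate s b
  differentiate s (con c) = con 0ℤ
  differentiate s (var i) = lookup s i
  differentiate s (a :^ zero) = con 0ℤ
  differentiate s (a :^ suc k) = differentiate s a :* a :^ k :+ a :* differentiate s (a :^ k)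
  differentiate s (:- a) = :- differentiate s a

  δ-differentiate : ∀ {m} (s : Vec (Polynomial m) m) (ρ : Env m) →
    (∀ i → δ (lookup ρ i) ≈ ⟦ lookup s i ⟧ ρ) → ∀ a → δ (⟦ a ⟧ ρ) ≈ ⟦ differentiate s a ⟧ ρ
  δ-differentiate s ρ h (op [+] a b) = ≈-trans (δ-⊕ _ _) (⊕-cong (δ-differentiate s ρ h a) (δ-differentiate s ρ h b))
  δ-differentiate s ρ h (op [*] a b) = ≈-trans (leibniz _ _) (⊕-cong (∙-cong (δ-differentiate s ρ h a) ≈-refl) (∙-cong ≈-refl (δ-differentiate s ρ h b)))
  δ-differentiate s ρ h (con c) = δ-const c
  δ-differentiate s ρ h (var i) = h i
  δ-differentiate s ρ h (a :^ zero) = δ-const 1ℤ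
  δ-differentiate s ρ h (a :^ suc k) = ≈-trans (leibniz _ _) (⊕-cong (∙-cong (δ-differentiate s ρ h a) ≈-refl) (∙-cong ≈-refl (δ-differentiate s ρ h (a :^ k))))
  δ-differentiate s ρ h (:- a) = ≈-trans (δ-⊖ _) (⊖-cong (δ-differentiate s ρ h a))

  :θ : ∀ {m} → Vec (Polynomial m) m → ℤ → Polynomial m → Polynomial m
  :θ s c a = differentiate s a :+ con (- c) :* a

  θ-differentiate : ∀ {m} (s : Vec (Polynomial m) m) (ρ : Env m) →
    (∀ i → δ (lookup ρ i) ≈ ⟦ lookup s i ⟧ ρ) → ∀ c {x} a → x ≈ ⟦ a ⟧ ρ → θ c x ≈ ⟦ :θ s c a ⟧ ρ
  θ-differentiate s ρ h c a e = ≈-trans (θ-cong c e) (⊕-cong (δ-differentiate s ρ h a) ≈-refl)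

  inverse-cancel : ∀ {u v} x → u ∙ v ≈ 𝟙 → u ∙ x ≈ 𝟘 → x ≈ 𝟘
  inverse-cancel {u} {v} x uv ux = begin
    x ≈⟨ ≈-sym (∙-identityˡ x) ⟩
    𝟙 ∙ x ≈⟨ ∙-cong (≈-sym uv) ≈-refl ⟩
    u ∙ v ∙ x ≈⟨ Solver.solve 3 (λ u v x → u Solver.:* v Solver.:* x Solver.:= v Solver.:* (u Solver.:* x)) ≈-refl u v x ⟩
    v ∙ (u ∙ x) ≈⟨ ∙-cong ≈-refl ux ⟩
    v ∙ 𝟘 ≈⟨ Solver.solve 1 (λ v → v Solver.:* Solver.con 0ℤ Solver.:= Solver.con 0ℤ) ≈-refl v ⟩
    𝟘 ∎

  δ-inverse : ∀ P E → P ∙ E ≈ 𝟙 → δ E ≈ ⊖ (E ∙ (E ∙ δ P))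
  δ-inverse P E PE = begin
    δ E ≈⟨ ≈-sym (∙-identityˡ (δ E)) ⟩
    𝟙 ∙ δ E ≈⟨ ∙-cong (≈-sym PE) ≈-refl ⟩
    P ∙ E ∙ δ E ≈⟨ Solver.solve 4 (λ P E p e → P Solver.:* E Solver.:* e Solver.:= E Solver.:* (p Solver.:* E Solver.:+ P Solver.:* e) Solver.:+ Solver.:- (E Solver.:* (E Solver.:* p))) ≈-refl P E (δ P) (δ E) ⟩
    E ∙ (δ P ∙ E ⊕ P ∙ δ E) ⊕ ⊖ (E ∙ (E ∙ δ P)) ≈⟨ ⊕-cong (∙-cong ≈-refl (≈-trans (≈-sym (leibniz P E)) (≈-trans (δ-cong PE) (δ-const 1ℤ)))) ≈-refl ⟩
    E ∙ 𝟘 ⊕ ⊖ (E ∙ (E ∙ δ P)) ≈⟨ Solver.solve 2 (λ E x → E Solver.:* Solver.con 0ℤ Solver.:+ x Solver.:= x) ≈-refl E _ ⟩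
    ⊖ (E ∙ (E ∙ δ P)) ∎

-- Modulo 7 the three residues of triangular numbers and the four residues of pentagonal
-- numbers give differential equations for E³ and E; together they make the logarithmic
-- derivative of P a polynomial in a series Q with δ Q = 2 (1 - Q³).
module Ramanujan where

  open Mod (+ 7)
  open Calculus 6
  open CharSolver 6 refl
  open import Relation.Binary.Reasoning.Setoid setoid

  module Logarithmic (P E : Series) (PE : P ∙ E ≈ 𝟙)
    (cube-ode : θ 0ℤ (θ 1ℤ (θ (+ 3) (E ∙ E ∙ E))) ≈ 𝟘)
    (E-ode : θ (+ 2) (θ 0ℤ (θ 1ℤ (θ (+ 5) E))) ≈ 𝟘) where

    -- For the partition series these are classical objects modulo 7. Since 24 φ = 1 - E₂, the
    -- series `u` is E₂. Ramanujan's formula 12 δE₂ = E₂² - E₄ makes `Q` equal to E₄. As E₆ = 1 and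
    -- 1728 = -1, `Δ` is the discriminant.
    φ φ₁ φ₂ u Q Δ F : Series
    φ = E ∙ δ P
    φ₁ = δ φ
    φ₂ = δ φ₁
    u = 𝟙 ⊕ const (+ 4) ∙ φ
    Q = u ∙ u ⊕ φ₁
    Δ = 𝟙 ⊕ ⊖ (Q ∙ (Q ∙ Q))
    F = E ∙ E ∙ E

    δE : δ E ≈ ⊖ (E ∙ φ)
    δE = δ-inverse P E PE

    δF : δ F ≈ const (+ 4) ∙ (F ∙ φ)
    δF = begin
      δ (E ∙ E ∙ E) ≈⟨ leibniz (E ∙ E) E ⟩
      δ (E ∙ E) ∙ E ⊕ E ∙ E ∙ δ E ≈⟨ ⊕-cong (∙-cong (leibniz E E) ≈-refl) ≈-refl ⟩
      (δ E ∙ E ⊕ E ∙ δ E) ∙ E ⊕ E ∙ E ∙ δ E ≈⟨ ⊕-cong (∙-cong (⊕-cong (∙-cong δE ≈-refl) (∙-cong ≈-refl δE)) ≈-refl) (∙-cong ≈-refl δE) ⟩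
      (⊖ (E ∙ φ) ∙ E ⊕ E ∙ ⊖ (E ∙ φ)) ∙ E ⊕ E ∙ E ∙ ⊖ (E ∙ φ) ≈⟨ solve 2 (λ E f → (:- (E :* f) :* E :+ E :* :- (E :* f)) :* E :+ E :* E :* :- (E :* f) := con (+ 4) :* (E :* E :* E :* f)) ≈-refl E φ ⟩
      const (+ 4) ∙ (F ∙ φ) ∎

    -- Pulling F out turns δ into δ + 4 φ, so an equation for F becomes a polynomial equation in φ
    -- and its derivatives.
    θF : ∀ c {x} g g′ → x ≈ F ∙ g → δ g ≈ g′ → θ c x ≈ F ∙ (g′ ⊕ const (+ 4) ∙ φ ∙ g ⊕ const (- c) ∙ g)
    θF c {x} g g′ e e′ = begin
      θ c x ≈⟨ θ-cong c e ⟩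
      δ (F ∙ g) ⊕ const (- c) ∙ (F ∙ g) ≈⟨ ⊕-cong (leibniz F g) ≈-refl ⟩
      δ F ∙ g ⊕ F ∙ δ g ⊕ const (- c) ∙ (F ∙ g) ≈⟨ ⊕-cong (⊕-cong (∙-cong δF ≈-refl) (∙-cong ≈-refl e′)) ≈-refl ⟩
      const (+ 4) ∙ (F ∙ φ) ∙ g ⊕ F ∙ g′ ⊕ const (- c) ∙ (F ∙ g) ≈⟨ solve 5 (λ F f g h c → con (+ 4) :* (F :* f) :* g :+ F :* h :+ c :* (F :* g) := F :* (h :+ con (+ 4) :* f :* g :+ c :* g)) ≈-refl F φ g g′ (const (- c)) ⟩
      F ∙ (g′ ⊕ const (+ 4) ∙ φ ∙ g ⊕ const (- c) ∙ g) ∎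

    δ-const∙ : ∀ c x → δ (const c ∙ x) ≈ const c ∙ δ x
    δ-const∙ c x = begin
      δ (const c ∙ x) ≈⟨ leibniz (const c) x ⟩
      δ (const c) ∙ x ⊕ const c ∙ δ x ≈⟨ ⊕-cong (∙-cong (δ-const c) ≈-refl) ≈-refl ⟩
      𝟘 ∙ x ⊕ const c ∙ δ x ≈⟨ solve 2 (λ x y → con 0ℤ :* x :+ y := y) ≈-refl x (const c ∙ δ x) ⟩
      const c ∙ δ x ∎

    -- This is `cube-ode` with the invertible factor F removed. Its leading term is 4 φ₂, which the
    -- factor 2 makes monic modulo 7.
    second-order : φ₂ ⊕ const (+ 5) ∙ φ ∙ φ₁ ⊕ const (+ 3) ∙ φ₁ ⊕ const (+ 2) ∙ (φ ∙ φ ∙ φ) ⊕ const (+ 5) ∙ (φ ∙ φ) ⊕ const (+ 3) ∙ φ ≈ 𝟘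
    second-order = inverse-cancel {F} {P ∙ P ∙ P} _ inverse (begin
      F ∙ _ ≈⟨ solve 4 (λ F f f₁ f₂ → F :* (f₂ :+ con (+ 5) :* f :* f₁ :+ con (+ 3) :* f₁ :+ con (+ 2) :* (f :* f :* f) :+ con (+ 5) :* (f :* f) :+ con (+ 3) :* f)
           := con (+ 2) :* (F :* (:g₃ f f₁ f₂))) ≈-refl F φ φ₁ φ₂ ⟩
      const (+ 2) ∙ (F ∙ g₃) ≈⟨ ∙-cong ≈-refl (≈-trans (≈-sym (θF 0ℤ g₂ _ (θF 1ℤ g₁ _ (θF (+ 3) 𝟙 𝟘 (solve 1 (λ F → F := F :* con 1ℤ) ≈-refl F) (δ-const 1ℤ)) δg₁) δg₂)) cube-ode) ⟩
      const (+ 2) ∙ 𝟘 ≈⟨ solve 0 (con (+ 2) :* con 0ℤ := con 0ℤ) ≈-refl ⟩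
      𝟘 ∎)
      where
      :g₃ : ∀ {m} (f f₁ f₂ : Polynomial m) → Polynomial m
      :g₃ f f₁ f₂ = g₂′ :+ con (+ 4) :* f :* g₂ :+ con 0ℤ :* g₂
        where
        g₁ = con 0ℤ :+ con (+ 4) :* f :* con 1ℤ :+ con (- (+ 3)) :* con 1ℤ
        g₂ = con (+ 4) :* f₁ :+ con (+ 4) :* f :* g₁ :+ con (- 1ℤ) :* g₁
        g₂′ = con (+ 4) :* f₂ :+ con (+ 4) :* (f₁ :* g₁ :+ f :* (con (+ 4) :* f₁)) :+ con (- 1ℤ) :* (con (+ 4) :* f₁)
      g₁ g₂ g₂′ g₃ : Series
      g₁ = 𝟘 ⊕ const (+ 4) ∙ φ ∙ 𝟙 ⊕ const (- (+ 3)) ∙ 𝟙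
      g₂ = const (+ 4) ∙ φ₁ ⊕ const (+ 4) ∙ φ ∙ g₁ ⊕ const (- 1ℤ) ∙ g₁
      g₂′ = const (+ 4) ∙ φ₂ ⊕ const (+ 4) ∙ (φ₁ ∙ g₁ ⊕ φ ∙ (const (+ 4) ∙ φ₁)) ⊕ const (- 1ℤ) ∙ (const (+ 4) ∙ φ₁)
      g₃ = g₂′ ⊕ const (+ 4) ∙ φ ∙ g₂ ⊕ 𝟘 ∙ g₂
      δg₁ : δ g₁ ≈ const (+ 4) ∙ φ₁
      δg₁ = begin
        δ g₁ ≈⟨ δ-cong (solve 1 (λ f → con 0ℤ :+ con (+ 4) :* f :* con 1ℤ :+ con (- (+ 3)) :* con 1ℤ := con (+ 4) :* f :+ con (+ 4)) ≈-refl φ) ⟩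
        δ (const (+ 4) ∙ φ ⊕ const (+ 4)) ≈⟨ ≈-trans (δ-⊕ _ _) (⊕-cong (δ-const∙ (+ 4) φ) (δ-const (+ 4))) ⟩
        const (+ 4) ∙ φ₁ ⊕ 𝟘 ≈⟨ solve 1 (λ x → x :+ con 0ℤ := x) ≈-refl _ ⟩
        const (+ 4) ∙ φ₁ ∎
      δg₂ : δ g₂ ≈ g₂′
      δg₂ = begin
        δ g₂ ≈⟨ δ-cong (solve 3 (λ f f₁ g → con (+ 4) :* f₁ :+ con (+ 4) :* f :* g :+ con (- 1ℤ) :* g := con (+ 4) :* f₁ :+ con (+ 4) :* (f :* g) :+ con (- 1ℤ) :* g) ≈-refl φ φ₁ g₁) ⟩
        δ (const (+ 4) ∙ φ₁ ⊕ const (+ 4) ∙ (φ ∙ g₁) ⊕ const (- 1ℤ) ∙ g₁)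
          ≈⟨ ≈-trans (δ-⊕ _ _) (⊕-cong (≈-trans (δ-⊕ _ _) (⊕-cong (δ-const∙ (+ 4) φ₁)
               (≈-trans (δ-const∙ (+ 4) (φ ∙ g₁)) (∙-cong ≈-refl (≈-trans (leibniz φ g₁) (⊕-cong (≈-refl {φ₁ ∙ g₁}) (∙-cong (≈-refl {φ}) δg₁)))))))
               (≈-trans (δ-const∙ (- 1ℤ) g₁) (∙-cong ≈-refl δg₁))) ⟩
        g₂′ ∎
      inverse : F ∙ (P ∙ P ∙ P) ≈ 𝟙
      inverse = begin
        E ∙ E ∙ E ∙ (P ∙ P ∙ P) ≈⟨ solve 2 (λ P E → E :* E :* E :* (P :* P :* P) := P :* E :* (P :* E) :* (P :* E)) ≈-refl P E ⟩
        P ∙ E ∙ (P ∙ E) ∙ (P ∙ E) ≈⟨ ∙-cong (∙-cong PE PE) PE ⟩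
        𝟙 ∙ 𝟙 ∙ 𝟙 ≈⟨ solve 0 (con 1ℤ :* con 1ℤ :* con 1ℤ := con 1ℤ) ≈-refl ⟩
        𝟙 ∎

    -- Ramanujan's 3 δE₄ = E₂E₄ - E₆ with E₆ = 1 and 1/3 = 5. The two sides differ exactly by the
    -- left side of `second-order`.
    δQ₀ : δ Q ≈ const (+ 5) ∙ (Q ∙ u ⊕ ⊖ 𝟙)
    δQ₀ = begin
      δ Q ≈⟨ δ-cong (solve 2 (λ f f₁ → :u f :* :u f :+ f₁ := con (+ 2) :* (f :* f) :+ f :+ f₁ :+ con (+ 1)) ≈-refl φ φ₁) ⟩
      δ (const (+ 2) ∙ (φ ∙ φ) ⊕ φ ⊕ φ₁ ⊕ 𝟙)
        ≈⟨ ≈-trans (δ-⊕ _ _) (⊕-cong (≈-trans (δ-⊕ _ _) (⊕-cong (≈-trans (δ-⊕ _ _) (⊕-cong (≈-trans (δ-const∙ (+ 2) (φ ∙ φ)) (∙-cong (≈-refl {const (+ 2)}) (leibniz φ φ))) (≈-refl {φ₁}))) (≈-refl {φ₂}))) (δ-const 1ℤ)) ⟩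
      const (+ 2) ∙ (φ₁ ∙ φ ⊕ φ ∙ φ₁) ⊕ φ₁ ⊕ φ₂ ⊕ 𝟘
        ≈⟨ solve 3 (λ f f₁ f₂ → con (+ 2) :* (f₁ :* f :+ f :* f₁) :+ f₁ :+ f₂ :+ con 0ℤ
             := con (+ 5) :* ((:u f :* :u f :+ f₁) :* :u f :- con 1ℤ) :+ (f₂ :+ con (+ 5) :* f :* f₁ :+ con (+ 3) :* f₁ :+ con (+ 2) :* (f :* f :* f) :+ con (+ 5) :* (f :* f) :+ con (+ 3) :* f)) ≈-refl φ φ₁ φ₂ ⟩
      const (+ 5) ∙ (Q ∙ u ⊕ ⊖ 𝟙) ⊕ _ ≈⟨ ⊕-cong (≈-refl {const (+ 5) ∙ (Q ∙ u ⊕ ⊖ 𝟙)}) second-order ⟩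
      const (+ 5) ∙ (Q ∙ u ⊕ ⊖ 𝟙) ⊕ 𝟘 ≈⟨ solve 1 (λ x → x :+ con 0ℤ := x) ≈-refl _ ⟩
      const (+ 5) ∙ (Q ∙ u ⊕ ⊖ 𝟙) ∎
      where
      :u : ∀ {m} → Polynomial m → Polynomial m
      :u f = con 1ℤ :+ con (+ 4) :* f

    δu : δ u ≈ const (+ 4) ∙ (Q ∙ 𝟙 ⊕ ⊖ (u ∙ u))
    δu = begin
      δ u ≈⟨ ≈-trans (δ-⊕ 𝟙 _) (⊕-cong (δ-const 1ℤ) (δ-const∙ (+ 4) φ)) ⟩
      𝟘 ⊕ const (+ 4) ∙ φ₁ ≈⟨ solve 2 (λ u f → con 0ℤ :+ con (+ 4) :* f := con (+ 4) :* ((u :* u :+ f) :* con 1ℤ :- u :* u)) ≈-refl u φ₁ ⟩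
      const (+ 4) ∙ (Q ∙ 𝟙 ⊕ ⊖ (u ∙ u)) ∎

    φ-u : φ ≈ const (+ 2) ∙ (u ⊕ ⊖ 𝟙)
    φ-u = solve 1 (λ f → f := con (+ 2) :* (con 1ℤ :+ con (+ 4) :* f :- con 1ℤ)) ≈-refl φ

    private
      :E :Q :u : Polynomial 3
      :E = var zero
      :Q = var (suc zero)
      :u = var (suc (suc zero))

      ρ : Env 3
      ρ = E ∷ Q ∷ u ∷ []

      derivatives : Vec (Polynomial 3) 3
      derivatives = (:- (:E :* (con (+ 2) :* (:u :- con 1ℤ)))) ∷ (con (+ 5) :* (:Q :* :u :- con 1ℤ)) ∷ (con (+ 4) :* (:Q :* con 1ℤ :- :u :* :u)) ∷ []

      derivatives-correct : ∀ i → δ (lookup ρ i) ≈ ⟦ lookup derivatives i ⟧ ρ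
      derivatives-correct zero = ≈-trans δE (⊖-cong (∙-cong (≈-refl {E}) φ-u))
      derivatives-correct (suc zero) = δQ₀
      derivatives-correct (suc (suc zero)) = δu

      third : Polynomial 3
      third = :θ derivatives 0ℤ (:θ derivatives 1ℤ (:θ derivatives (+ 5) :E))

      third-correct : θ 0ℤ (θ 1ℤ (θ (+ 5) E)) ≈ ⟦ third ⟧ ρ
      third-correct = θ-differentiate derivatives ρ derivatives-correct 0ℤ (:θ derivatives 1ℤ (:θ derivatives (+ 5) :E))
        (θ-differentiate derivatives ρ derivatives-correct 1ℤ (:θ derivatives (+ 5) :E)
          (θ-differentiate derivatives ρ derivatives-correct (+ 5) :E ≈-refl))

    -- Written in E, Q and u, the fourth-order equation for E collapses to E (Q² - u) = 0, and E is
    -- invertible. Classically this is E₄² = E₈, together with E₈ = E₂ modulo 7.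
    Q²≈u : Q ∙ Q ≈ u
    Q²≈u = begin
      Q ∙ Q ≈⟨ solve 2 (λ Q u → Q :* Q := (Q :* Q :- u) :+ u) ≈-refl Q u ⟩
      Q ∙ Q ⊕ ⊖ u ⊕ u ≈⟨ ⊕-cong (inverse-cancel {E} {P} (Q ∙ Q ⊕ ⊖ u) (≈-trans (solve 2 (λ E P → E :* P := P :* E) ≈-refl E P) PE) vanishing) ≈-refl ⟩
      𝟘 ⊕ u ≈⟨ solve 1 (λ u → con 0ℤ :+ u := u) ≈-refl u ⟩
      u ∎
      where
      vanishing : E ∙ (Q ∙ Q ⊕ ⊖ u) ≈ 𝟘
      vanishing = begin
        E ∙ (Q ∙ Q ⊕ ⊖ u) ≈⟨ prove ρ (:E :* (:Q :* :Q :- :u)) (:θ derivatives (+ 2) third) ≈-refl ⟩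
        ⟦ :θ derivatives (+ 2) third ⟧ ρ ≈⟨ ≈-sym (θ-differentiate derivatives ρ derivatives-correct (+ 2) third third-correct) ⟩
        θ (+ 2) (θ 0ℤ (θ 1ℤ (θ (+ 5) E))) ≈⟨ E-ode ⟩
        𝟘 ∎

    -- Without the outermost operator of `E-ode` only the exponents congruent to 2 modulo 7 remain,
    -- and what is left is a square up to the factor -E: the polynomial 1 + u³ - 2 Q u becomes (1 -
    -- Q³)² once u = Q².
    third-derivative : θ 0ℤ (θ 1ℤ (θ (+ 5) E)) ≈ ⊖ (E ∙ (Δ ∙ Δ))
    third-derivative = begin
      θ 0ℤ (θ 1ℤ (θ (+ 5) E)) ≈⟨ third-correct ⟩
      ⟦ third ⟧ ρ ≈⟨ prove ρ third (:- (:E :* (con 1ℤ :+ :u :* (:u :* :u) :- con (+ 2) :* (:Q :* :u)))) ≈-refl ⟩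
      ⊖ (E ∙ (𝟙 ⊕ u ∙ (u ∙ u) ⊕ ⊖ (const (+ 2) ∙ (Q ∙ u))))
        ≈⟨ ⊖-cong (∙-cong (≈-refl {E}) (⊕-cong (⊕-cong (≈-refl {𝟙}) (∙-cong Q²≈u′ (∙-cong Q²≈u′ Q²≈u′))) (⊖-cong (∙-cong (≈-refl {const (+ 2)}) (∙-cong (≈-refl {Q}) Q²≈u′))))) ⟩
      ⊖ (E ∙ (𝟙 ⊕ Q ∙ Q ∙ (Q ∙ Q ∙ (Q ∙ Q)) ⊕ ⊖ (const (+ 2) ∙ (Q ∙ (Q ∙ Q)))))
        ≈⟨ solve 2 (λ E Q → :- (E :* (con 1ℤ :+ Q :* Q :* (Q :* Q :* (Q :* Q)) :- con (+ 2) :* (Q :* (Q :* Q)))) := :- (E :* ((con 1ℤ :- Q :* (Q :* Q)) :* (con 1ℤ :- Q :* (Q :* Q))))) ≈-refl E Q ⟩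
      ⊖ (E ∙ (Δ ∙ Δ)) ∎
      where Q²≈u′ = ≈-sym Q²≈u

    δQ : δ Q ≈ const (+ 2) ∙ (𝟙 ⊕ ⊖ (Q ∙ (Q ∙ Q)))
    δQ = begin
      δ Q ≈⟨ δQ₀ ⟩
      const (+ 5) ∙ (Q ∙ u ⊕ ⊖ 𝟙) ≈⟨ ∙-cong (≈-refl {const (+ 5)}) (⊕-cong (∙-cong (≈-refl {Q}) (≈-sym Q²≈u)) (≈-refl {⊖ 𝟙})) ⟩
      const (+ 5) ∙ (Q ∙ (Q ∙ Q) ⊕ ⊖ 𝟙) ≈⟨ solve 1 (λ Q → con (+ 5) :* (Q :* (Q :* Q) :- con 1ℤ) := con (+ 2) :* (con 1ℤ :- Q :* (Q :* Q))) ≈-refl Q ⟩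
      const (+ 2) ∙ (𝟙 ⊕ ⊖ (Q ∙ (Q ∙ Q))) ∎

    φ-Q : φ ≈ const (+ 2) ∙ (Q ∙ Q ⊕ ⊖ 𝟙)
    φ-Q = ≈-trans φ-u (∙-cong (≈-refl {const (+ 2)}) (⊕-cong (≈-sym Q²≈u) (≈-refl {⊖ 𝟙})))

    φ₁-Q : φ₁ ≈ Q ⊕ ⊖ (Q ∙ Q ∙ (Q ∙ Q))
    φ₁-Q = begin
      φ₁ ≈⟨ solve 2 (λ u f → f := u :* u :+ f :- u :* u) ≈-refl u φ₁ ⟩
      Q ⊕ ⊖ (u ∙ u) ≈⟨ ⊕-cong (≈-refl {Q}) (⊖-cong (∙-cong (≈-sym Q²≈u) (≈-sym Q²≈u))) ⟩
      Q ⊕ ⊖ (Q ∙ Q ∙ (Q ∙ Q)) ∎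

    δP : δ P ≈ P ∙ φ
    δP = begin
      δ P ≈⟨ ≈-sym (∙-identityˡ (δ P)) ⟩
      𝟙 ∙ δ P ≈⟨ ∙-cong (≈-sym PE) (≈-refl {δ P}) ⟩
      P ∙ E ∙ δ P ≈⟨ solve 3 (λ P E p → P :* E :* p := P :* (E :* p)) ≈-refl P E (δ P) ⟩
      P ∙ φ ∎

    private
      :P′ :Q′ :h : Polynomial 2
      :P′ = var zero
      :Q′ = var (suc zero)
      :h = con (+ 5) :+ con (+ 2) :* :Q′ :+ con (+ 3) :* :Q′ :^ 2 :+ con (+ 4) :* :Q′ :^ 3 :+ :Q′ :^ 4 :+ con (+ 4) :* :Q′ :^ 5 :+ con (+ 2) :* :Q′ :^ 8

      ρ′ : Env 2
      ρ′ = P ∷ Q ∷ []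

      derivatives′ : Vec (Polynomial 2) 2
      derivatives′ = (:P′ :* (con (+ 2) :* (:Q′ :* :Q′ :- con 1ℤ))) ∷ (con (+ 2) :* (con 1ℤ :- :Q′ :* (:Q′ :* :Q′))) ∷ []

      derivatives-correct′ : ∀ i → δ (lookup ρ′ i) ≈ ⟦ lookup derivatives′ i ⟧ ρ′
      derivatives-correct′ zero = ≈-trans δP (∙-cong (≈-refl {P}) φ-Q)
      derivatives-correct′ (suc zero) = δQ

    antiderivative : Series
    antiderivative = ⟦ :P′ :* :h ⟧ ρ′

    -- The antiderivative was found by linear algebra on polynomials in Q over the field with 7 elements.
    exactness : P ∙ (const (+ 5) ∙ (φ ∙ φ) ∙ (φ ∙ φ ⊕ const (+ 2) ∙ φ₁ ⊕ const (+ 5) ∙ φ) ⊕ φ ∙ φ ∙ (φ ∙ φ)) ≈ θ (+ 5) antiderivative ⊕ const (+ 4) ∙ (P ∙ Δ)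
    exactness = begin
      P ∙ (const (+ 5) ∙ (φ ∙ φ) ∙ (φ ∙ φ ⊕ const (+ 2) ∙ φ₁ ⊕ const (+ 5) ∙ φ) ⊕ φ ∙ φ ∙ (φ ∙ φ))
        ≈⟨ ∙-cong (≈-refl {P}) (⊕-cong (∙-cong (∙-cong (≈-refl {const (+ 5)}) (∙-cong φ-Q φ-Q)) (⊕-cong (⊕-cong (∙-cong φ-Q φ-Q) (∙-cong (≈-refl {const (+ 2)}) φ₁-Q)) (∙-cong (≈-refl {const (+ 5)}) φ-Q))) (∙-cong (∙-cong φ-Q φ-Q) (∙-cong φ-Q φ-Q))) ⟩
      ⟦ left ⟧ ρ′ ≈⟨ prove ρ′ left right ≈-refl ⟩
      ⟦ right ⟧ ρ′ ≈⟨ ⊕-cong (≈-sym (θ-differentiate derivatives′ ρ′ derivatives-correct′ (+ 5) {antiderivative} (:P′ :* :h) ≈-refl)) ≈-refl ⟩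
      θ (+ 5) antiderivative ⊕ const (+ 4) ∙ (P ∙ Δ) ∎
      where
      f f₁ left right : Polynomial 2
      f = con (+ 2) :* (:Q′ :* :Q′ :- con 1ℤ)
      f₁ = :Q′ :- :Q′ :* :Q′ :* (:Q′ :* :Q′)
      left = :P′ :* (con (+ 5) :* (f :* f) :* (f :* f :+ con (+ 2) :* f₁ :+ con (+ 5) :* f) :+ f :* f :* (f :* f))
      right = :θ derivatives′ (+ 5) (:P′ :* :h) :+ con (+ 4) :* (:P′ :* (con 1ℤ :- :Q′ :* (:Q′ :* :Q′)))

    open import Algebra.Properties.CommutativeSemiring.Exp (CommutativeRing.commutativeSemiring ring)

    -- The discriminant is q times the 24th power of the Euler product, so classically `Y` is just q
    -- modulo 7. Only its support modulo 49 will be derived, from its square.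
    Y : Series
    Y = Δ ∙ P ^ 24

    -- One more factor P E = 1 raises P⁴⁸ to P⁴⁹, a 49th power in characteristic 7, and supplies the
    -- E of `third-derivative`.
    Y² : Y ∙ Y ≈ ⊖ (θ 0ℤ (θ 1ℤ (θ (+ 5) E)) ∙ P ^ 49)
    Y² = begin
      Δ ∙ P ^ 24 ∙ (Δ ∙ P ^ 24) ≈⟨ solve 2 (λ D x → D :* x :* (D :* x) := con 1ℤ :* (D :* D :* (x :* x))) ≈-refl Δ (P ^ 24) ⟩
      𝟙 ∙ (Δ ∙ Δ ∙ (P ^ 24 ∙ P ^ 24)) ≈⟨ ∙-cong (≈-sym PE) (∙-cong (≈-refl {Δ ∙ Δ}) (≈-sym (^-homo-* P 24 24))) ⟩
      P ∙ E ∙ (Δ ∙ Δ ∙ P ^ 48) ≈⟨ solve 4 (λ P E D x → P :* E :* (D :* D :* x) := :- (:- (E :* (D :* D)) :* (P :* x))) ≈-refl P E Δ (P ^ 48) ⟩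
      ⊖ (⊖ (E ∙ (Δ ∙ Δ)) ∙ P ^ 49) ≈⟨ ⊖-cong (∙-cong (≈-sym third-derivative) (≈-refl {P ^ 49})) ⟩
      ⊖ (θ 0ℤ (θ 1ℤ (θ (+ 5) E)) ∙ P ^ 49) ∎

    -- Here P Δ = Y E²³, and 23 = 21 + 2 splits off E²¹ = F⁷, whose support modulo 49 comes from
    -- that of F modulo 7.
    PΔ : P ∙ Δ ≈ Y ∙ (F ^ 7 ∙ (E ∙ E))
    PΔ = begin
      P ∙ Δ ≈⟨ solve 2 (λ P D → P :* D := con 1ℤ :* (D :* P)) ≈-refl P Δ ⟩
      𝟙 ∙ (Δ ∙ P) ≈⟨ ∙-cong (≈-sym (one^ 23)) (≈-refl {Δ ∙ P}) ⟩
      𝟙 ^ 23 ∙ (Δ ∙ P) ≈⟨ ∙-cong (≈-trans (^-congˡ 23 (≈-sym PE)) (^-distrib-* P E 23)) (≈-refl {Δ ∙ P}) ⟩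
      P ^ 23 ∙ E ^ 23 ∙ (Δ ∙ P) ≈⟨ solve 5 (λ P D x E y → x :* (E :* (E :* y)) :* (D :* P) := D :* (P :* x) :* (y :* (E :* E))) ≈-refl P Δ (P ^ 23) E (E ^ 21) ⟩
      Y ∙ (E ^ 21 ∙ (E ∙ E)) ≈⟨ ∙-cong (≈-refl {Y}) (∙-cong E²¹ (≈-refl {E ∙ E})) ⟩
      Y ∙ (F ^ 7 ∙ (E ∙ E)) ∎
      where
      one^ : ∀ k → 𝟙 ^ k ≈ 𝟙
      one^ zero = ≈-refl
      one^ (suc k) = ≈-trans (∙-identityˡ (𝟙 ^ k)) (one^ k)
      E²¹ : E ^ 21 ≈ F ^ 7
      E²¹ = ≈-sym (begin
        (E ∙ E ∙ E) ^ 7 ≈⟨ ≈-trans (^-distrib-* (E ∙ E) E 7) (∙-cong (^-distrib-* E E 7) (≈-refl {E ^ 7})) ⟩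
        E ^ 7 ∙ E ^ 7 ∙ E ^ 7 ≈⟨ ∙-cong (≈-sym (^-homo-* E 7 7)) (≈-refl {E ^ 7}) ⟩
        E ^ 14 ∙ E ^ 7 ≈⟨ ≈-sym (^-homo-* E 14 7) ⟩
        E ^ 21 ∎)

-- Supports modulo p

module Support (p : ℤ) where

  open Mod p

  ≋0-*ˡ : ∀ {a} b → a ≋ 0ℤ → a * b ≋ 0ℤ
  ≋0-*ˡ b e = ≋-* e (≋-refl {b})

  ≋0-*ʳ : ∀ a {b} → b ≋ 0ℤ → a * b ≋ 0ℤ
  ≋0-*ʳ a e = ≋-trans (≋-* (≋-refl {a}) e) (≋-reflexive (ℤₚ.*-zeroʳ a))

  -- A coefficient of a product vanishes unless one of its terms produces evidence for `C`. The
  -- evidence is membership of a residue in a list, or an absurdity.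
  ∙-cases : ∀ {C : Set} x y n → (∀ i j → i ℕ.+ j ≡ n → x i * y j ≋ 0ℤ ⊎ C) → (x ∙ y) n ≋ 0ℤ ⊎ C
  ∙-cases x y zero h = h 0 0 refl
  ∙-cases x y (suc n) h with h 0 (suc n) refl | ∙-cases (tail x) y n (λ i j e → h (suc i) j (cong suc e))
  ... | inj₂ c | _ = inj₂ c
  ... | inj₁ _ | inj₂ c = inj₂ c
  ... | inj₁ e | inj₁ f = inj₁ (≋-+ e f)

  -- The residues form an explicit list, so sumsets, inclusions and the absence of a residue are
  -- settled by evaluation.
  Supported : (M : ℕ) .{{_ : ℕ.NonZero M}} → List ℕ → Series → Set
  Supported M R x = ∀ n → x n ≋ 0ℤ ⊎ n % M ∈ R

  Supported-1 : ∀ x → Supported 1 (0 ∷ []) x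
  Supported-1 x n = inj₂ (here (trans (cong (_% 1) (sym (ℕₚ.*-identityʳ n))) (m*n%n≡0 n 1)))

  module _ {M : ℕ} .{{_ : ℕ.NonZero M}} where

    Supported-≈ : ∀ {R x y} → x ≈ y → Supported M R y → Supported M R x
    Supported-≈ e s n with s n
    ... | inj₁ z = inj₁ (≋-trans (at e n) z)
    ... | inj₂ r = inj₂ r

    sums : List ℕ → List ℕ → List ℕ
    sums = cartesianProductWith (λ a b → (a ℕ.+ b) % M)

    Supported-∙ : ∀ {R S x y} → Supported M R x → Supported M S y → Supported M (sums R S) (x ∙ y)
    Supported-∙ {R} {S} {x} {y} s t n = ∙-cases x y n λ i j e → term i j e (s i) (t j)
      where
      term : ∀ i j → i ℕ.+ j ≡ n → x i ≋ 0ℤ ⊎ i % M ∈ R → y j ≋ 0ℤ ⊎ j % M ∈ S → x i * y j ≋ 0ℤ ⊎ n % M ∈ sums R S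
      term i j refl (inj₁ e) _ = inj₁ (≋0-*ˡ (y j) e)
      term i j refl (inj₂ _) (inj₁ e) = inj₁ (≋0-*ʳ (x i) e)
      term i j refl (inj₂ r) (inj₂ s) = inj₂ (subst (_∈ sums R S) (sym (%-distribˡ-+ i j M)) (∈-cartesianProductWith⁺ _ r s))

    Supported-⊕ : ∀ {R x y} → Supported M R x → Supported M R y → Supported M R (x ⊕ y)
    Supported-⊕ s t n with s n | t n
    ... | inj₂ r | _ = inj₂ r
    ... | inj₁ _ | inj₂ r = inj₂ r
    ... | inj₁ e | inj₁ f = inj₁ (≋-+ e f)

    Supported-⊖ : ∀ {R x} → Supported M R x → Supported M R (⊖ x)
    Supported-⊖ s n with s n
    ... | inj₂ r = inj₂ r
    ... | inj₁ e = inj₁ (≋-neg e)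

    Supported-const∙ : ∀ c {R x} → Supported M R x → Supported M R (const c ∙ x)
    Supported-const∙ c {x = x} s n with s n
    ... | inj₂ r = inj₂ r
    ... | inj₁ e = inj₁ (≋-trans (≋-reflexive (const-∙ c x n)) (≋0-*ʳ c e))

    Supported-⊆ : ∀ {R x} S → True (All.all? (_∈? S) R) → Supported M R x → Supported M S x
    Supported-⊆ S R⊆S s n with s n
    ... | inj₂ r = inj₂ (All.lookup (toWitness R⊆S) r)
    ... | inj₁ e = inj₁ e

    vanishes-at : ∀ {R x r} → Supported M R x → ∀ n → n % M ≡ r → False (r ∈? R) → x n ≋ 0ℤ
    vanishes-at {R} {r = r} s n h r∉R with s n
    ... | inj₁ e = e
    ... | inj₂ n∈R = ⊥-elim (toWitnessFalse r∉R (subst (_∈ R) h n∈R))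

  -- Each coefficient of the square beyond the leading one contains 2 x₀ xₙ, and the other products
  -- involve a lower coefficient outside the multiples of M.
  square-root-support : ∀ {M} .{{_ : ℕ.NonZero M}} x a → a * (x 0 + x 0) ≋ 1ℤ → Supported M (0 ∷ []) (x ∙ x) → Supported M (0 ∷ []) x
  square-root-support {M} x a unit s n with n % M ℕ.≟ 0
  ... | yes e = inj₂ (here e)
  ... | no h = inj₁ (<-rec (λ n → n % M ≢ 0 → x n ≋ 0ℤ) step n h)
    where
    outside : ∀ n → n % M ≢ 0 → (x ∙ x) n ≋ 0ℤ
    outside n h with s n
    ... | inj₁ e = e
    ... | inj₂ (here e) = ⊥-elim (h e)

    cancel : ∀ b → (x 0 + x 0) * b ≋ 0ℤ → b ≋ 0ℤ
    cancel b e = ≋-trans (≋-sym (≋-trans (≋-* unit (≋-refl {b})) (≋-reflexive (ℤₚ.*-identityˡ b)))) (≋-trans (≋-reflexive (ℤₚ.*-assoc a _ b)) (≋0-*ʳ a e))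

    step : ∀ n → (∀ {m} → m ℕ.< n → m % M ≢ 0 → x m ≋ 0ℤ) → n % M ≢ 0 → x n ≋ 0ℤ
    step zero ih h = ⊥-elim (h (m*n%n≡0 0 M))
    step (suc zero) ih h = cancel (x 1) (≋-trans (≋-reflexive (identity (x 0) (x 1))) (outside 1 h))
      where
      identity : ∀ a b → (a + a) * b ≡ a * b + b * a
      identity = solve-∀
    step (suc (suc n)) ih h = cancel (x (suc (suc n)))
      (≋-trans (≋-reflexive (identity (x 0) (x (suc (suc n))) (rest n)))
      (≋-trans (≋-+ (≋-reflexive (sym expand)) (≋-neg rest≋0))
      (≋-+ (outside (suc (suc n)) h) ≋-refl)))
      where
      rest : ℕ → ℤ
      rest = tail x ∙ tail x

      expand : (x ∙ x) (suc (suc n)) ≡ x 0 * x (suc (suc n)) + (rest n + x (suc (suc n)) * x 0)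
      expand = cong (_+_ (x 0 * x (suc (suc n)))) (∙-suc (tail x) x n)

      identity : ∀ a b r → (a + a) * b ≡ a * b + (r + b * a) + - r
      identity = solve-∀

      lower : ∀ i j → i ℕ.+ j ≡ n → x (suc i) * x (suc j) ≋ 0ℤ ⊎ ⊥
      lower i j e with suc i % M ℕ.≟ 0 | suc j % M ℕ.≟ 0
      ... | no i≢ | _ = inj₁ (≋0-*ˡ (x (suc j)) (ih (s≤s (s≤s (subst (i ℕ.≤_) e (ℕₚ.m≤m+n i j)))) i≢))
      ... | yes _ | no j≢ = inj₁ (≋0-*ʳ (x (suc i)) (ih (s≤s (s≤s (subst (j ℕ.≤_) e (ℕₚ.m≤n+m j i)))) j≢))
      ... | yes i≡ | yes j≡ = ⊥-elim (h (begin
        suc (suc n) % M ≡⟨ cong (_% M) (cong suc (trans (cong suc (sym e)) (sym (ℕₚ.+-suc i j)))) ⟩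
        (suc i ℕ.+ suc j) % M ≡⟨ %-distribˡ-+ (suc i) (suc j) M ⟩
        (suc i % M ℕ.+ suc j % M) % M ≡⟨ cong₂ (λ a b → (a ℕ.+ b) % M) i≡ j≡ ⟩
        0 % M ≡⟨ m*n%n≡0 0 M ⟩
        0 ∎))
        where open ≡-Reasoning

      rest≋0 : rest n ≋ 0ℤ
      rest≋0 with ∙-cases (tail x) (tail x) n lower
      ... | inj₁ e = e

  open import Algebra.Properties.CommutativeSemiring.Exp (CommutativeRing.commutativeSemiring ring)
  open import Relation.Binary.Reasoning.Setoid setoid

  module Frobenius (k : ℕ) (additive : ∀ x y → (x ⊕ y) ^ suc k ≈ x ^ suc k ⊕ y ^ suc k) where

    X : Series
    X zero = 0ℤ
    X (suc n) = 𝟙 n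

    X∙ : ∀ y n → (X ∙ y) (suc n) ≋ y n
    X∙ y n = ≋-trans (≋-reflexive (ℤₚ.+-identityˡ _)) (at (∙-identityˡ y) n)

    X^∙-< : ∀ j y r → r ℕ.< j → (X ^ j ∙ y) r ≋ 0ℤ
    X^∙-+ : ∀ j y n → (X ^ j ∙ y) (j ℕ.+ n) ≋ y n
    X^∙-< (suc j) y r r<j = ≋-trans (at (≈-reflexive (∙-assoc X (X ^ j) y)) r) (below r r<j)
      where
      below : ∀ r → r ℕ.< suc j → (X ∙ (X ^ j ∙ y)) r ≋ 0ℤ
      below zero _ = ≋-reflexive refl
      below (suc r) (s≤s r<j) = ≋-trans (X∙ (X ^ j ∙ y) r) (X^∙-< j y r r<j)
    X^∙-+ zero y n = at (∙-identityˡ y) n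
    X^∙-+ (suc j) y n = ≋-trans (at (≈-reflexive (∙-assoc X (X ^ j) y)) (suc j ℕ.+ n)) (≋-trans (X∙ (X ^ j ∙ y) (j ℕ.+ n)) (X^∙-+ j y n))

    const-^ : ∀ c j → const c ^ j ≈ const (c ℤ.^ j)
    const-^ c zero = ≈-refl
    const-^ c (suc j) = ≈-trans (∙-cong (≈-refl {const c}) (const-^ c j)) (≈-reflexive λ { zero → refl ; (suc n) → trans (const-∙ c (const (c ℤ.^ j)) (suc n)) (ℤₚ.*-zeroʳ c) })

    split : ∀ x → x ^ suc k ≈ const (x 0 ℤ.^ suc k) ⊕ X ^ suc k ∙ tail x ^ suc k
    split x = begin
      x ^ suc k ≈⟨ ^-congˡ (suc k) head+tail ⟩
      (const (x 0) ⊕ X ∙ tail x) ^ suc k ≈⟨ additive (const (x 0)) (X ∙ tail x) ⟩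
      const (x 0) ^ suc k ⊕ (X ∙ tail x) ^ suc k ≈⟨ ⊕-cong (const-^ (x 0) (suc k)) (^-distrib-* X (tail x) (suc k)) ⟩
      const (x 0 ℤ.^ suc k) ⊕ X ^ suc k ∙ tail x ^ suc k ∎
      where
      head+tail : x ≈ const (x 0) ⊕ X ∙ tail x
      head+tail = coefficients λ
        { zero → ≋-reflexive (sym (ℤₚ.+-identityʳ (x 0)))
        ; (suc n) → ≋-trans (≋-sym (X∙ (tail x) n)) (≋-reflexive (sym (ℤₚ.+-identityˡ _))) }

    -- In characteristic p the p-th power of Σ xₘ qᵐ is Σ xₘᵖ qᵐᵖ. Iterating `split` removes one
    -- coefficient of x and p exponents at a time.
    power-coefficient : ∀ m r x → r ℕ.< suc k → (x ^ suc k) (m ℕ.* suc k ℕ.+ r) ≋ const (x m ℤ.^ suc k) r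
    power-coefficient zero r x r<p = ≋-trans (at (split x) r) (≋-trans (≋-+ (≋-refl {const (x 0 ℤ.^ suc k) r}) (X^∙-< (suc k) (tail x ^ suc k) r r<p)) (≋-reflexive (ℤₚ.+-identityʳ _)))
    power-coefficient (suc m) r x r<p = ≋-trans (≋-reflexive (cong (x ^ suc k) (ℕₚ.+-assoc (suc k) (m ℕ.* suc k) r)))
      (≋-trans (at (split x) (suc k ℕ.+ (m ℕ.* suc k ℕ.+ r)))
      (≋-trans (≋-reflexive (ℤₚ.+-identityˡ _))
      (≋-trans (X^∙-+ (suc k) (tail x ^ suc k) (m ℕ.* suc k ℕ.+ r)) (power-coefficient m r (tail x) r<p))))

    Supported-^ : ∀ {M} .{{_ : ℕ.NonZero M}} {R x} .{{_ : ℕ.NonZero (M ℕ.* suc k)}} → Supported M R x →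
      Supported (M ℕ.* suc k) (map (ℕ._* suc k) R) (x ^ suc k)
    Supported-^ {M} {R} {x} s n = subst (λ n → (x ^ suc k) n ≋ 0ℤ ⊎ n % (M ℕ.* suc k) ∈ map (ℕ._* suc k) R) (sym division)
      (residue (n % suc k) (m%n<n n (suc k)) (s m))
      where
      m = n / suc k
      division : n ≡ m ℕ.* suc k ℕ.+ n % suc k
      division = trans (m≡m%n+[m/n]*n n (suc k)) (ℕₚ.+-comm (n % suc k) _)
      residue : ∀ r → r ℕ.< suc k → x m ≋ 0ℤ ⊎ m % M ∈ R → (x ^ suc k) (m ℕ.* suc k ℕ.+ r) ≋ 0ℤ ⊎ (m ℕ.* suc k ℕ.+ r) % (M ℕ.* suc k) ∈ map (ℕ._* suc k) R
      residue (suc r) r<p _ = inj₁ (power-coefficient m (suc r) x r<p)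
      residue zero r<p (inj₁ e) = inj₁ (≋-trans (power-coefficient m 0 x r<p) (≋0-*ˡ (x m ℤ.^ k) e))
      residue zero r<p (inj₂ i) = inj₂ (subst (_∈ map (ℕ._* suc k) R) (sym multiple) (∈-map⁺ (ℕ._* suc k) i))
        where
        multiple : (m ℕ.* suc k ℕ.+ 0) % (M ℕ.* suc k) ≡ m % M ℕ.* suc k
        multiple = trans (cong (_% (M ℕ.* suc k)) (ℕₚ.+-identityʳ (m ℕ.* suc k))) (sym (m%n*o≡m*o%[n*o] m M (suc k)))

-- Finite sums and lacunary series

sum : ℕ → (ℕ → ℤ) → ℤ
sum zero f = 0ℤ
sum (suc n) f = sum n f + f n

sum-cong : ∀ n {f g} → (∀ i → i ℕ.< n → f i ≡ g i) → sum n f ≡ sum n g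
sum-cong zero e = refl
sum-cong (suc n) e = cong₂ _+_ (sum-cong n (λ i i<n → e i (ℕₚ.m<n⇒m<1+n i<n))) (e n ℕₚ.≤-refl)

sum-0 : ∀ n {f} → (∀ i → i ℕ.< n → f i ≡ 0ℤ) → sum n f ≡ 0ℤ
sum-0 n e = trans (sum-cong n e) (zeros n)
  where
  zeros : ∀ n → sum n (λ _ → 0ℤ) ≡ 0ℤ
  zeros zero = refl
  zeros (suc n) = trans (ℤₚ.+-identityʳ _) (zeros n)

sum-+ : ∀ n f g → sum n (λ i → f i + g i) ≡ sum n f + sum n g
sum-+ zero f g = refl
sum-+ (suc n) f g = trans (cong (_+ (f n + g n)) (sum-+ n f g)) (interchange (sum n f) (sum n g) (f n) (g n))
  where
  interchange : ∀ a b c d → a + b + (c + d) ≡ a + c + (b + d)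
  interchange = solve-∀

sum-* : ∀ n c f → sum n (λ i → c * f i) ≡ c * sum n f
sum-* zero c f = sym (ℤₚ.*-zeroʳ c)
sum-* (suc n) c f = trans (cong (_+ c * f n) (sum-* n c f)) (sym (ℤₚ.*-distribˡ-+ c (sum n f) (f n)))

sum-split : ∀ m n f → sum (m ℕ.+ n) f ≡ sum m f + sum n (λ i → f (m ℕ.+ i))
sum-split m zero f = trans (cong (λ k → sum k f) (ℕₚ.+-identityʳ m)) (sym (ℤₚ.+-identityʳ _))
sum-split m (suc n) f = begin
  sum (m ℕ.+ suc n) f ≡⟨ cong (λ k → sum k f) (ℕₚ.+-suc m n) ⟩
  sum (m ℕ.+ n) f + f (m ℕ.+ n) ≡⟨ cong (_+ f (m ℕ.+ n)) (sum-split m n f) ⟩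
  sum m f + sum n (λ i → f (m ℕ.+ i)) + f (m ℕ.+ n) ≡⟨ ℤₚ.+-assoc (sum m f) _ _ ⟩
  sum m f + sum (suc n) (λ i → f (m ℕ.+ i)) ∎
  where open ≡-Reasoning

sum-first : ∀ n f → sum (suc n) f ≡ f 0 + sum n (f ∘ suc)
sum-first n f = trans (sum-split 1 n f) (cong (_+ sum n (f ∘ suc)) (ℤₚ.+-identityˡ (f 0)))

sum-truncate : ∀ {m n} f → m ℕ.≤ n → (∀ i → m ℕ.≤ i → f i ≡ 0ℤ) → sum n f ≡ sum m f
sum-truncate {m} {n} f m≤n e = begin
  sum n f ≡⟨ cong (λ k → sum k f) (sym (ℕₚ.m+[n∸m]≡n m≤n)) ⟩
  sum (m ℕ.+ (n ℕ.∸ m)) f ≡⟨ sum-split m (n ℕ.∸ m) f ⟩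
  sum m f + sum (n ℕ.∸ m) (λ i → f (m ℕ.+ i)) ≡⟨ cong (_+_ (sum m f)) (sum-0 (n ℕ.∸ m) (λ i _ → e (m ℕ.+ i) (ℕₚ.m≤m+n m i))) ⟩
  sum m f + 0ℤ ≡⟨ ℤₚ.+-identityʳ (sum m f) ⟩
  sum m f ∎
  where open ≡-Reasoning

sum-swap : ∀ m n (f : ℕ → ℕ → ℤ) → sum m (λ i → sum n (f i)) ≡ sum n (λ j → sum m (λ i → f i j))
sum-swap zero n f = sym (sum-0 n (λ _ _ → refl))
sum-swap (suc m) n f = trans (cong (_+ sum n (f m)) (sum-swap m n f)) (sym (sum-+ n (λ j → sum m (λ i → f i j)) (f m)))

ext : Series → ℤ → ℤ
ext x (+ n) = x n
ext x -[1+ n ] = 0ℤ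

monomial : ℕ → Series
monomial zero = 𝟙
monomial (suc e) zero = 0ℤ
monomial (suc e) (suc n) = monomial e n

monomial-∙ : ∀ e x n → (monomial e ∙ x) n ≡ ext x (+ n - + e)
monomial-∙ zero x n = trans (trans (const-∙ 1ℤ x n) (ℤₚ.*-identityˡ (x n))) (cong (ext x) (sym (ℤₚ.+-identityʳ (+ n))))
monomial-∙ (suc e) x zero = refl
monomial-∙ (suc e) x (suc n) = trans (ℤₚ.+-identityˡ _) (trans (monomial-∙ e x n) (cong (ext x) (lemma e)))
  where
  lemma : ∀ e → + n - + e ≡ + suc n - + suc e
  lemma e = trans (ℤₚ.m-n≡m⊖n n e) (trans (sym (ℤₚ.[1+m]⊖[1+n]≡m⊖n n e)) (sym (ℤₚ.m-n≡m⊖n (suc n) (suc e))))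

monomial-≡ : ∀ e n → monomial e n ≡ 0ℤ ⊎ e ≡ n
monomial-≡ zero zero = inj₂ refl
monomial-≡ zero (suc n) = inj₁ refl
monomial-≡ (suc e) zero = inj₁ refl
monomial-≡ (suc e) (suc n) with monomial-≡ e n
... | inj₁ z = inj₁ z
... | inj₂ refl = inj₂ refl

monomial-< : ∀ e n → n ℕ.< e → monomial e n ≡ 0ℤ
monomial-< e n n<e with monomial-≡ e n
... | inj₁ z = z
... | inj₂ refl = ⊥-elim (ℕₚ.<-irrefl refl n<e)

-- The truncation is only correct for exponents with k ≤ e k.
lacunary : (ℕ → ℕ) → (ℕ → ℤ) → Series
lacunary e a n = sum (suc n) (λ k → a k * monomial (e k) n)

lacunary-extend : ∀ e a → (∀ k → k ℕ.≤ e k) → ∀ {m n} → n ℕ.< m → sum m (λ k → a k * monomial (e k) n) ≡ lacunary e a n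
lacunary-extend e a k≤e {m} {n} n<m = sum-truncate _ n<m (λ k n<k → trans (cong (a k *_) (monomial-< (e k) n (ℕₚ.≤-trans n<k (k≤e k)))) (ℤₚ.*-zeroʳ (a k)))

∙-cong-≤ : ∀ {x x′ : Series} (y : Series) n → (∀ i → i ℕ.≤ n → x i ≡ x′ i) → (x ∙ y) n ≡ (x′ ∙ y) n
∙-cong-≤ y zero e = cong (_* y 0) (e 0 z≤n)
∙-cong-≤ y (suc n) e = cong₂ _+_ (cong (_* y (suc n)) (e 0 z≤n)) (∙-cong-≤ y n (λ i i≤n → e (suc i) (s≤s i≤n)))

sum-∙ : ∀ m (a : ℕ → ℤ) (x : ℕ → Series) y n → ((λ i → sum m (λ k → a k * x k i)) ∙ y) n ≡ sum m (λ k → a k * (x k ∙ y) n)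
sum-∙ zero a x y n = 𝟘-∙ y n
sum-∙ (suc m) a x y n = trans (∙-distribʳ-⊕ y _ (a m · x m) n) (cong₂ _+_ (sum-∙ m a x y n) (·-∙ (a m) (x m) y n))

lacunary-∙ : ∀ e a → (∀ k → k ℕ.≤ e k) → ∀ x n → (lacunary e a ∙ x) n ≡ sum (suc n) (λ k → a k * ext x (+ n - + e k))
lacunary-∙ e a k≤e x n = begin
  (lacunary e a ∙ x) n ≡⟨ ∙-cong-≤ x n (λ i i≤n → sym (lacunary-extend e a k≤e (s≤s i≤n))) ⟩
  ((λ i → sum (suc n) (λ k → a k * monomial (e k) i)) ∙ x) n ≡⟨ sum-∙ (suc n) a (monomial ∘ e) x n ⟩
  sum (suc n) (λ k → a k * (monomial (e k) ∙ x) n) ≡⟨ sum-cong (suc n) (λ k _ → cong (a k *_) (monomial-∙ (e k) x n)) ⟩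
  sum (suc n) (λ k → a k * ext x (+ n - + e k)) ∎
  where open ≡-Reasoning

-- The k-th monomial contributes to the n-th coefficient only when e k = n, so a factor depending on
-- e k alone turns into a factor depending on n.
lacunary-scale : ∀ e {a b} c (g : ℕ → ℤ) → (∀ k → c * b k ≡ g (e k) * a k) → ∀ n → c * lacunary e b n ≡ g n * lacunary e a n
lacunary-scale e {a} {b} c g h n = begin
  c * lacunary e b n ≡⟨ sym (sum-* (suc n) c _) ⟩
  sum (suc n) (λ k → c * (b k * monomial (e k) n)) ≡⟨ sum-cong (suc n) (λ k _ → term k (monomial-≡ (e k) n)) ⟩
  sum (suc n) (λ k → g n * (a k * monomial (e k) n)) ≡⟨ sum-* (suc n) (g n) _ ⟩
  g n * lacunary e a n ∎
  where
  open ≡-Reasoning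
  zeros : ∀ c d x y → c * (x * 0ℤ) ≡ d * (y * 0ℤ)
  zeros = solve-∀
  term : ∀ k → monomial (e k) n ≡ 0ℤ ⊎ e k ≡ n → c * (b k * monomial (e k) n) ≡ g n * (a k * monomial (e k) n)
  term k (inj₁ z) rewrite z = zeros c (g n) (b k) (a k)
  term k (inj₂ refl) = trans (sym (ℤₚ.*-assoc c (b k) _)) (trans (cong (_* monomial (e k) n) (h k)) (ℤₚ.*-assoc (g (e k)) (a k) _))

module LacunarySupport (p : ℤ) where

  open Mod p
  open Support p

  Supported-lacunary : ∀ {M} .{{_ : ℕ.NonZero M}} {R} e a → (∀ k → a k ≋ 0ℤ ⊎ e k % M ∈ R) → Supported M R (lacunary e a)
  Supported-lacunary {M} {R} e a h n = go (suc n)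
    where
    term : ∀ k → a k * monomial (e k) n ≋ 0ℤ ⊎ n % M ∈ R
    term k with h k | monomial-≡ (e k) n
    ... | inj₁ z | _ = inj₁ (≋0-*ˡ (monomial (e k) n) z)
    ... | inj₂ _ | inj₁ z = inj₁ (≋-reflexive (trans (cong (a k *_) z) (ℤₚ.*-zeroʳ (a k))))
    ... | inj₂ r | inj₂ refl = inj₂ r
    go : ∀ m → sum m (λ k → a k * monomial (e k) n) ≋ 0ℤ ⊎ n % M ∈ R
    go zero = inj₁ ≋-refl
    go (suc m) with go m | term m
    ... | inj₂ r | _ = inj₂ r
    ... | inj₁ _ | inj₂ r = inj₂ r
    ... | inj₁ x | inj₁ y = inj₁ (≋-+ x y)

-- Coefficients of z⁻ᵏ + ... + zᵏ as a polynomial in y = z + z⁻¹ - 2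

choose : ℕ → ℕ → ℤ
choose n zero = 1ℤ
choose zero (suc k) = 0ℤ
choose (suc n) (suc k) = choose n k + choose n (suc k)

choose-absorb : ∀ n k → (1ℤ + + k) * choose n (suc k) ≡ (+ n - + k) * choose n k
choose-absorb zero zero = refl
choose-absorb zero (suc k) = trans (ℤₚ.*-zeroʳ (1ℤ + + suc k)) (sym (ℤₚ.*-zeroʳ (0ℤ - + suc k)))
choose-absorb (suc n) zero = trans (identity (choose n 1)) (trans (cong (_+_ 1ℤ) (choose-absorb n 0)) (trans (collect (+ n)) (cong (λ m → (m - 0ℤ) * 1ℤ) (sym (ℤₚ.pos-+ 1 n)))))
  where
  identity : ∀ c → (1ℤ + 0ℤ) * (1ℤ + c) ≡ 1ℤ + (1ℤ + 0ℤ) * c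
  identity = solve-∀
  collect : ∀ n → 1ℤ + (n - 0ℤ) * 1ℤ ≡ ((1ℤ + n) - 0ℤ) * 1ℤ
  collect = solve-∀
choose-absorb (suc n) (suc k) = begin
  (1ℤ + + suc k) * (choose n (suc k) + choose n (suc (suc k))) ≡⟨ ℤₚ.*-distribˡ-+ (1ℤ + + suc k) (choose n (suc k)) _ ⟩
  (1ℤ + + suc k) * choose n (suc k) + (1ℤ + + suc k) * choose n (suc (suc k)) ≡⟨ cong (_+_ ((1ℤ + + suc k) * choose n (suc k))) (choose-absorb n (suc k)) ⟩
  (1ℤ + + suc k) * choose n (suc k) + (+ n - + suc k) * choose n (suc k) ≡⟨ cong (λ m → (1ℤ + m) * choose n (suc k) + (+ n - m) * choose n (suc k)) (ℤₚ.pos-+ 1 k) ⟩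
  (1ℤ + (1ℤ + + k)) * choose n (suc k) + (+ n - (1ℤ + + k)) * choose n (suc k) ≡⟨ regroup (+ n) (+ k) (choose n (suc k)) ⟩
  (1ℤ + + k) * choose n (suc k) + (+ n - + k) * choose n (suc k) ≡⟨ cong (_+ (+ n - + k) * choose n (suc k)) (choose-absorb n k) ⟩
  (+ n - + k) * choose n k + (+ n - + k) * choose n (suc k) ≡⟨ sym (ℤₚ.*-distribˡ-+ (+ n - + k) (choose n k) _) ⟩
  (+ n - + k) * choose (suc n) (suc k) ≡⟨ cong (_* choose (suc n) (suc k)) (trans (shift (+ n) (+ k)) (cong₂ _-_ (sym (ℤₚ.pos-+ 1 n)) (sym (ℤₚ.pos-+ 1 k)))) ⟩
  (+ suc n - + suc k) * choose (suc n) (suc k) ∎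
  where
  open ≡-Reasoning
  regroup : ∀ n k c → (1ℤ + (1ℤ + k)) * c + (n - (1ℤ + k)) * c ≡ (1ℤ + k) * c + (n - k) * c
  regroup = solve-∀
  shift : ∀ n k → n - k ≡ 1ℤ + n - (1ℤ + k)
  shift = solve-∀

-- Equal to (2k + 1)/(2l + 1) times the binomial coefficient of k + l over 2l; the sum of two
-- binomial coefficients keeps it visibly integral.
χ : ℕ → ℕ → ℤ
χ k l = choose (k ℕ.+ l) (l ℕ.+ l) + + 2 * choose (k ℕ.+ l) (suc (l ℕ.+ l))

χ-cleared : ∀ k l → (1ℤ + + l + + l) * χ k l ≡ (1ℤ + + k + + k) * choose (k ℕ.+ l) (l ℕ.+ l)
χ-cleared k l = begin
  (1ℤ + + l + + l) * (C + + 2 * C′) ≡⟨ expand (+ l) C C′ ⟩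
  (1ℤ + + l + + l) * C + + 2 * ((1ℤ + (+ l + + l)) * C′) ≡⟨ cong (λ m → (1ℤ + + l + + l) * C + + 2 * ((1ℤ + m) * C′)) (sym (ℤₚ.pos-+ l l)) ⟩
  (1ℤ + + l + + l) * C + + 2 * ((1ℤ + + (l ℕ.+ l)) * C′) ≡⟨ cong (λ t → (1ℤ + + l + + l) * C + + 2 * t) (choose-absorb (k ℕ.+ l) (l ℕ.+ l)) ⟩
  (1ℤ + + l + + l) * C + + 2 * ((+ (k ℕ.+ l) - + (l ℕ.+ l)) * C) ≡⟨ cong₂ (λ a b → (1ℤ + + l + + l) * C + + 2 * ((a - b) * C)) (ℤₚ.pos-+ k l) (ℤₚ.pos-+ l l) ⟩
  (1ℤ + + l + + l) * C + + 2 * ((+ k + + l - (+ l + + l)) * C) ≡⟨ collect (+ k) (+ l) C ⟩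
  (1ℤ + + k + + k) * C ∎
  where
  open ≡-Reasoning
  C = choose (k ℕ.+ l) (l ℕ.+ l)
  C′ = choose (k ℕ.+ l) (suc (l ℕ.+ l))
  expand : ∀ l c d → (1ℤ + l + l) * (c + + 2 * d) ≡ (1ℤ + l + l) * c + + 2 * ((1ℤ + (l + l)) * d)
  expand = solve-∀
  collect : ∀ k l c → (1ℤ + l + l) * c + + 2 * ((k + l - (l + l)) * c) ≡ (1ℤ + k + k) * c
  collect = solve-∀

χ₀ : ∀ k → χ k 0 ≡ 1ℤ + + k + + k
χ₀ k = trans (sym (ℤₚ.*-identityˡ (χ k 0))) (trans (χ-cleared k 0) (ℤₚ.*-identityʳ _))

-- Multiplying z⁻ᵏ⁻¹ + ... + zᵏ⁺¹ by z + z⁻¹ = y + 2 yields the corresponding sums for k + 2 and k.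
χ-recurrence : ∀ k l → χ (suc (suc k)) (suc l) + χ k (suc l) ≡ + 2 * χ (suc k) (suc l) + χ (suc k) l
χ-recurrence k l rewrite ℕₚ.+-suc k l | ℕₚ.+-suc l l =
  identity (choose n j) (choose n (1 ℕ.+ j)) (choose n (2 ℕ.+ j)) (choose n (3 ℕ.+ j))
  where
  n = suc (k ℕ.+ l)
  j = l ℕ.+ l
  identity : ∀ c₀ c₁ c₂ c₃ → ((c₀ + c₁) + (c₁ + c₂)) + + 2 * ((c₁ + c₂) + (c₂ + c₃)) + (c₂ + + 2 * c₃) ≡ + 2 * ((c₁ + c₂) + + 2 * (c₂ + c₃)) + (c₀ + + 2 * c₁)
  identity = solve-∀

χ-recurrence₀ : ∀ k → χ (suc (suc k)) 0 + χ k 0 ≡ + 2 * χ (suc k) 0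
χ-recurrence₀ k = begin
  χ (suc (suc k)) 0 + χ k 0 ≡⟨ cong₂ _+_ (χ₀ (suc (suc k))) (χ₀ k) ⟩
  1ℤ + + (2 ℕ.+ k) + + (2 ℕ.+ k) + (1ℤ + + k + + k) ≡⟨ cong (λ m → 1ℤ + m + m + (1ℤ + + k + + k)) (ℤₚ.pos-+ 2 k) ⟩
  1ℤ + (+ 2 + + k) + (+ 2 + + k) + (1ℤ + + k + + k) ≡⟨ identity (+ k) ⟩
  + 2 * (1ℤ + (1ℤ + + k) + (1ℤ + + k)) ≡⟨ cong (λ m → + 2 * (1ℤ + m + m)) (sym (ℤₚ.pos-+ 1 k)) ⟩
  + 2 * (1ℤ + + suc k + + suc k) ≡⟨ cong (+ 2 *_) (sym (χ₀ (suc k))) ⟩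
  + 2 * χ (suc k) 0 ∎
  where
  open ≡-Reasoning
  identity : ∀ k → 1ℤ + (+ 2 + k) + (+ 2 + k) + (1ℤ + k + k) ≡ + 2 * (1ℤ + (1ℤ + k) + (1ℤ + k))
  identity = solve-∀

choose-falling : ∀ n k → + (k !) * choose n k ≡ falling (+ n) k
choose-falling n zero = refl
choose-falling n (suc k) = begin
  + (suc k ℕ.* k !) * choose n (suc k) ≡⟨ cong (_* choose n (suc k)) (ℤₚ.pos-* (suc k) (k !)) ⟩
  + suc k * + (k !) * choose n (suc k) ≡⟨ cong (λ m → m * + (k !) * choose n (suc k)) (ℤₚ.pos-+ 1 k) ⟩
  (1ℤ + + k) * + (k !) * choose n (suc k) ≡⟨ regroup (1ℤ + + k) (+ (k !)) (choose n (suc k)) ⟩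
  + (k !) * ((1ℤ + + k) * choose n (suc k)) ≡⟨ cong (+ (k !) *_) (choose-absorb n k) ⟩
  + (k !) * ((+ n - + k) * choose n k) ≡⟨ regroup′ (+ (k !)) (+ n - + k) (choose n k) ⟩
  + (k !) * choose n k * (+ n - + k) ≡⟨ cong (_* (+ n - + k)) (choose-falling n k) ⟩
  falling (+ n) k * (+ n - + k) ∎
  where
  open ≡-Reasoning
  regroup : ∀ a b c → a * b * c ≡ b * (a * c)
  regroup = solve-∀
  regroup′ : ∀ a b c → a * (b * c) ≡ a * c * b
  regroup′ = solve-∀

χ-falling : ∀ k l → + ((l ℕ.+ l) !) * ((1ℤ + + l + + l) * χ k l) ≡ (1ℤ + + k + + k) * falling (+ k + + l) (l ℕ.+ l)
χ-falling k l = begin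
  + ((l ℕ.+ l) !) * ((1ℤ + + l + + l) * χ k l) ≡⟨ cong (+ ((l ℕ.+ l) !) *_) (χ-cleared k l) ⟩
  + ((l ℕ.+ l) !) * ((1ℤ + + k + + k) * choose (k ℕ.+ l) (l ℕ.+ l)) ≡⟨ regroup (+ ((l ℕ.+ l) !)) (1ℤ + + k + + k) (choose (k ℕ.+ l) (l ℕ.+ l)) ⟩
  (1ℤ + + k + + k) * (+ ((l ℕ.+ l) !) * choose (k ℕ.+ l) (l ℕ.+ l)) ≡⟨ cong ((1ℤ + + k + + k) *_) (choose-falling (k ℕ.+ l) (l ℕ.+ l)) ⟩
  (1ℤ + + k + + k) * falling (+ (k ℕ.+ l)) (l ℕ.+ l) ≡⟨ cong (λ x → (1ℤ + + k + + k) * falling x (l ℕ.+ l)) (ℤₚ.pos-+ k l) ⟩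
  (1ℤ + + k + + k) * falling (+ k + + l) (l ℕ.+ l) ∎
  where
  open ≡-Reasoning
  regroup : ∀ a b c → a * (b * c) ≡ b * (a * c)
  regroup = solve-∀

-- Theta series and the Euler product

-- Exponents are given by their increments a + k c, which avoids halving and makes periodicity
-- modulo M an induction.
quadratic : ℕ → ℕ → ℕ → ℕ → ℕ
quadratic e a c zero = e
quadratic e a c (suc k) = quadratic e a c k ℕ.+ (a ℕ.+ k ℕ.* c)

-- The pentagonal exponents are k(3k + 1)/2 and (k + 1)(3k + 2)/2. The second starts at 1, whence
-- the opposite sign in `Euler`.
triangular pentagonal⁺ pentagonal⁻ : ℕ → ℕ
triangular = quadratic 0 1 1
pentagonal⁺ = quadratic 0 2 3
pentagonal⁻ = quadratic 1 4 3

quadratic-≥ : ∀ e a c k → k ℕ.≤ quadratic e (suc a) c k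
quadratic-≥ e a c zero = z≤n
quadratic-≥ e a c (suc k) = subst (ℕ._≤ quadratic e (suc a) c (suc k)) (ℕₚ.+-comm k 1) (ℕₚ.+-mono-≤ (quadratic-≥ e a c k) (s≤s z≤n))

triangular-double : ∀ k → + 2 * + triangular k ≡ + k * (1ℤ + + k)
triangular-double zero = refl
triangular-double (suc k) = begin
  + 2 * + (triangular k ℕ.+ suc (k ℕ.* 1)) ≡⟨ cong (λ m → + 2 * + (triangular k ℕ.+ suc m)) (ℕₚ.*-identityʳ k) ⟩
  + 2 * + (triangular k ℕ.+ suc k) ≡⟨ cong (+ 2 *_) (ℤₚ.pos-+ (triangular k) (suc k)) ⟩
  + 2 * (+ triangular k + + suc k) ≡⟨ ℤₚ.*-distribˡ-+ (+ 2) (+ triangular k) (+ suc k) ⟩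
  + 2 * + triangular k + + 2 * + suc k ≡⟨ cong₂ (λ a b → a + + 2 * b) (triangular-double k) (ℤₚ.pos-+ 1 k) ⟩
  + k * (1ℤ + + k) + + 2 * (1ℤ + + k) ≡⟨ identity (+ k) ⟩
  (1ℤ + + k) * (1ℤ + (1ℤ + + k)) ≡⟨ cong (λ m → m * (1ℤ + m)) (sym (ℤₚ.pos-+ 1 k)) ⟩
  + suc k * (1ℤ + + suc k) ∎
  where
  open ≡-Reasoning
  identity : ∀ k → k * (1ℤ + k) + + 2 * (1ℤ + k) ≡ (1ℤ + k) * (1ℤ + (1ℤ + k))
  identity = solve-∀

sgn : ℕ → ℤ
sgn zero = 1ℤ
sgn (suc k) = - sgn k

Θ : ℕ → Series
Θ l = lacunary triangular (λ k → sgn k * χ k l)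

Euler : Series
Euler = lacunary pentagonal⁺ sgn ⊕ lacunary pentagonal⁻ (λ k → - sgn k)

-- Because 6 χ(k,1) = k(k + 1)(2k + 1), which is twice the exponent times χ(k,0).
Θ₁-δ : ∀ n → + 3 * Θ 1 n ≡ + n * Θ 0 n
Θ₁-δ = lacunary-scale triangular (+ 3) +_ λ k → ℤₚ.*-cancelˡ-≡ (+ 2) _ _ (begin
  + 2 * (+ 3 * (sgn k * χ k 1)) ≡⟨ left (sgn k) (χ k 1) ⟩
  sgn k * (+ 2 * ((1ℤ + 1ℤ + 1ℤ) * χ k 1)) ≡⟨ cong (sgn k *_) (χ-falling k 1) ⟩
  sgn k * ((1ℤ + + k + + k) * (1ℤ * (+ k + 1ℤ - 0ℤ) * (+ k + 1ℤ - 1ℤ))) ≡⟨ middle (sgn k) (+ k) ⟩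
  (+ k * (1ℤ + + k)) * (sgn k * (1ℤ + + k + + k)) ≡⟨ cong₂ (λ a b → a * (sgn k * b)) (sym (triangular-double k)) (sym (χ₀ k)) ⟩
  + 2 * + triangular k * (sgn k * χ k 0) ≡⟨ ℤₚ.*-assoc (+ 2) (+ triangular k) _ ⟩
  + 2 * (+ triangular k * (sgn k * χ k 0)) ∎)
  where
  open ≡-Reasoning
  left : ∀ s c → + 2 * (+ 3 * (s * c)) ≡ s * (+ 2 * ((1ℤ + 1ℤ + 1ℤ) * c))
  left = solve-∀
  middle : ∀ s k → s * ((1ℤ + k + k) * (1ℤ * (k + 1ℤ - 0ℤ) * (k + 1ℤ - 1ℤ))) ≡ (k * (1ℤ + k)) * (s * (1ℤ + k + k))
  middle = solve-∀

-- Because 120 χ(k,2) = (2k + 1)(k - 1)k(k + 1)(k + 2), and (k - 1)(k + 2) = k(k + 1) - 2 is twice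
-- the exponent minus 2.
Θ₂-δ : ∀ n → + 30 * Θ 2 n ≡ + n * (+ n - 1ℤ) * Θ 0 n
Θ₂-δ = lacunary-scale triangular (+ 30) (λ n → + n * (+ n - 1ℤ)) λ k → ℤₚ.*-cancelˡ-≡ (+ 4) _ _ (begin
  + 4 * (+ 30 * (sgn k * χ k 2)) ≡⟨ left (sgn k) (χ k 2) ⟩
  sgn k * (+ 24 * ((1ℤ + + 2 + + 2) * χ k 2)) ≡⟨ cong (sgn k *_) (χ-falling k 2) ⟩
  sgn k * ((1ℤ + + k + + k) * (1ℤ * (+ k + + 2 - 0ℤ) * (+ k + + 2 - 1ℤ) * (+ k + + 2 - + 2) * (+ k + + 2 - + 3))) ≡⟨ middle (sgn k) (+ k) ⟩
  (+ k * (1ℤ + + k)) * ((+ k * (1ℤ + + k)) - + 2) * (sgn k * (1ℤ + + k + + k)) ≡⟨ cong₂ (λ a b → a * (a - + 2) * (sgn k * b)) (sym (triangular-double k)) (sym (χ₀ k)) ⟩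
  + 2 * + triangular k * (+ 2 * + triangular k - + 2) * (sgn k * χ k 0) ≡⟨ right (+ triangular k) (sgn k * χ k 0) ⟩
  + 4 * (+ triangular k * (+ triangular k - 1ℤ) * (sgn k * χ k 0)) ∎)
  where
  open ≡-Reasoning
  left : ∀ s c → + 4 * (+ 30 * (s * c)) ≡ s * (+ 24 * ((1ℤ + + 2 + + 2) * c))
  left = solve-∀
  middle : ∀ s k → s * ((1ℤ + k + k) * (1ℤ * (k + + 2 - 0ℤ) * (k + + 2 - 1ℤ) * (k + + 2 - + 2) * (k + + 2 - + 3))) ≡ (k * (1ℤ + k)) * ((k * (1ℤ + k)) - + 2) * (s * (1ℤ + k + k))
  middle = solve-∀
  right : ∀ t x → + 2 * t * (+ 2 * t - + 2) * x ≡ + 4 * (t * (t - 1ℤ) * x)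
  right = solve-∀

quadratic-period : ∀ e a c M .{{_ : ℕ.NonZero M}} → quadratic e a c M % M ≡ e % M → ∀ k → quadratic e a c (k ℕ.+ M) % M ≡ quadratic e a c k % M
quadratic-period e a c M h zero = h
quadratic-period e a c M h (suc k) = begin
  (quadratic e a c (k ℕ.+ M) ℕ.+ (a ℕ.+ (k ℕ.+ M) ℕ.* c)) % M ≡⟨ %-distribˡ-+ (quadratic e a c (k ℕ.+ M)) _ M ⟩
  (quadratic e a c (k ℕ.+ M) % M ℕ.+ (a ℕ.+ (k ℕ.+ M) ℕ.* c) % M) % M ≡⟨ cong₂ (λ x y → (x ℕ.+ y) % M) (quadratic-period e a c M h k) increment ⟩
  (quadratic e a c k % M ℕ.+ (a ℕ.+ k ℕ.* c) % M) % M ≡⟨ sym (%-distribˡ-+ (quadratic e a c k) (a ℕ.+ k ℕ.* c) M) ⟩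
  quadratic e a c (suc k) % M ∎
  where
  open ≡-Reasoning
  increment : (a ℕ.+ (k ℕ.+ M) ℕ.* c) % M ≡ (a ℕ.+ k ℕ.* c) % M
  increment = trans (cong (_% M) (trans (cong (a ℕ.+_) (trans (ℕₚ.*-distribʳ-+ c k M) (cong (k ℕ.* c ℕ.+_) (ℕₚ.*-comm M c)))) (sym (ℕₚ.+-assoc a (k ℕ.* c) (c ℕ.* M))))) ([m+kn]%n≡m%n (a ℕ.+ k ℕ.* c) c M)

quadratic-% : ∀ e a c M .{{_ : ℕ.NonZero M}} → quadratic e a c M % M ≡ e % M → ∀ k → quadratic e a c k % M ≡ quadratic e a c (k % M) % M
quadratic-% e a c M h k = trans (cong (λ n → quadratic e a c n % M) (m≡m%n+[m/n]*n k M)) (go (k / M))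
  where
  go : ∀ q → quadratic e a c (k % M ℕ.+ q ℕ.* M) % M ≡ quadratic e a c (k % M) % M
  go zero = cong (λ n → quadratic e a c n % M) (ℕₚ.+-identityʳ (k % M))
  go (suc q) = trans (cong (λ n → quadratic e a c n % M) (trans (cong (k % M ℕ.+_) (ℕₚ.+-comm M (q ℕ.* M))) (sym (ℕₚ.+-assoc (k % M) (q ℕ.* M) M))))
    (trans (quadratic-period e a c M h (k % M ℕ.+ q ℕ.* M)) (go q))

module ThetaSupport (p : ℕ) .{{_ : ℕ.NonZero p}} where

  open Mod (+ p) public
  open Support (+ p) public
  open LacunarySupport (+ p)

  ⊥? : Dec ⊥
  ⊥? = no (λ x → x)

  Supported-quadratic : ∀ {M} .{{_ : ℕ.NonZero M}} R e a c w {Z : ℕ → Set} (Z? : ∀ r → Dec (Z r)) → (∀ k → Z (k % M) → w k ≋ 0ℤ) →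
    quadratic e a c M % M ≡ e % M → True (ℕₚ.allUpTo? (λ r → Z? r ⊎-dec (quadratic e a c r % M ∈? R)) M) →
    Supported M R (lacunary (quadratic e a c) w)
  Supported-quadratic {M} R e a c w {Z} Z? zeros h check = Supported-lacunary (quadratic e a c) w residue
    where
    residue : ∀ k → w k ≋ 0ℤ ⊎ quadratic e a c k % M ∈ R
    residue k with toWitness check (m%n<n k M)
    ... | inj₁ z = inj₁ (zeros k z)
    ... | inj₂ r = inj₂ (subst (_∈ R) (sym (quadratic-% e a c M h k)) r)

  ≋-% : ∀ {M} .{{_ : ℕ.NonZero M}} → p ℕ∣.∣ M → ∀ n → + n ≋ + (n % M)
  ≋-% {M} (ℕ∣.divides q refl) n = by (+ (n / M) * + q) (begin
    + n ≡⟨ cong +_ (m≡m%n+[m/n]*n n M) ⟩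
    + (n % M ℕ.+ n / M ℕ.* (q ℕ.* p)) ≡⟨ ℤₚ.pos-+ (n % M) _ ⟩
    + (n % M) + + (n / M ℕ.* (q ℕ.* p)) ≡⟨ cong (_+_ (+ (n % M))) (trans (ℤₚ.pos-* (n / M) (q ℕ.* p)) (cong (+ (n / M) *_) (ℤₚ.pos-* q p))) ⟩
    + (n % M) + + (n / M) * (+ q * + p) ≡⟨ cong (_+_ (+ (n % M))) (sym (ℤₚ.*-assoc (+ (n / M)) (+ q) (+ p))) ⟩
    + (n % M) + + (n / M) * + q * + p ∎)
    where open ≡-Reasoning

  -- Multiplying the coefficients by a polynomial in the exponent kills residues.
  Supported-scale : ∀ {M} .{{_ : ℕ.NonZero M}} → p ℕ∣.∣ M → ∀ {R x y} R′ u c (g : ℤ → ℤ) → u * c ≋ 1ℤ → (∀ {a b} → a ≋ b → g a ≋ g b) →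
    (∀ n → c * y n ≋ g (+ n) * x n) → True (All.all? (λ r → (+ p ∣? g (+ r)) ⊎-dec (r ∈? R′)) R) → Supported M R x → Supported M R′ y
  Supported-scale {M} p∣M {R} {x} {y} R′ u c g unit g-cong eq check s n with s n
  ... | inj₁ z = inj₁ (cancel (≋-trans (eq n) (≋0-*ʳ (g (+ n)) z)))
    where
    cancel : c * y n ≋ 0ℤ → y n ≋ 0ℤ
    cancel e = ≋-trans (≋-sym (≋-trans (≋-* unit (≋-refl {y n})) (≋-reflexive (ℤₚ.*-identityˡ (y n))))) (≋-trans (≋-reflexive (ℤₚ.*-assoc u c (y n))) (≋0-*ʳ u e))
  ... | inj₂ r with All.lookup (toWitness check) r
  ... | inj₂ r′ = inj₂ r′
  ... | inj₁ d = inj₁ (≋-trans (≋-sym (≋-trans (≋-* unit (≋-refl {y n})) (≋-reflexive (ℤₚ.*-identityˡ (y n))))) (≋-trans (≋-reflexive (ℤₚ.*-assoc u c (y n))) (≋0-*ʳ u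
          (≋-trans (eq n) (≋0-*ˡ (x n) (≋-trans (g-cong (≋-% p∣M n)) (∣⇒≋0 d)))))))

  -- By `χ-cleared`, (2l + 1) χ(k,l) is a multiple of 2k + 1, which is divisible by p when k is
  -- congruent to (p - 1)/2.
  χ-≋0 : ∀ l u r → u * (1ℤ + + l + + l) ≋ 1ℤ → p ≡ suc (r ℕ.+ r) → ∀ k → k % p ≡ r → χ k l ≋ 0ℤ
  χ-≋0 l u r unit p≡ k k≡r = ≋-trans (≋-sym (≋-trans (≋-* unit (≋-refl {χ k l})) (≋-reflexive (ℤₚ.*-identityˡ (χ k l)))))
    (≋-trans (≋-reflexive (ℤₚ.*-assoc u _ (χ k l))) (≋0-*ʳ u (≋-trans (≋-reflexive (χ-cleared k l)) (≋0-*ˡ (choose (k ℕ.+ l) (l ℕ.+ l)) odd))))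
    where
    k≋r : + k ≋ + r
    k≋r = ≋-trans (≋-% ℕ∣.∣-refl k) (≋-reflexive (cong +_ k≡r))
    odd : 1ℤ + + k + + k ≋ 0ℤ
    odd = ≋-trans (≋-+ (≋-+ (≋-refl {1ℤ}) k≋r) k≋r) (by 1ℤ (trans (cong (_+ + r) (sym (ℤₚ.pos-+ 1 r))) (trans (sym (ℤₚ.pos-+ (suc r) r)) (trans (cong +_ (sym p≡)) (sym (trans (ℤₚ.+-identityˡ _) (ℤₚ.*-identityˡ (+ p))))))))

  Supported-Euler : ∀ {M} .{{_ : ℕ.NonZero M}} R → quadratic 0 2 3 M % M ≡ 0 % M → quadratic 1 4 3 M % M ≡ 1 % M →
    True (ℕₚ.allUpTo? (λ r → ⊥? ⊎-dec (quadratic 0 2 3 r % M ∈? R)) M) →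
    True (ℕₚ.allUpTo? (λ r → ⊥? ⊎-dec (quadratic 1 4 3 r % M ∈? R)) M) → Supported M R Euler
  Supported-Euler R h⁺ h⁻ c⁺ c⁻ = Supported-⊕ (Supported-quadratic R 0 2 3 sgn (λ _ → ⊥?) (λ _ ()) h⁺ c⁺) (Supported-quadratic R 1 4 3 (λ k → - sgn k) (λ _ → ⊥?) (λ _ ()) h⁻ c⁻)

  Supported-Θ : ∀ {M} .{{_ : ℕ.NonZero M}} R l → quadratic 0 1 1 M % M ≡ 0 % M →
    True (ℕₚ.allUpTo? (λ r → ⊥? ⊎-dec (quadratic 0 1 1 r % M ∈? R)) M) → Supported M R (Θ l)
  Supported-Θ R l h check = Supported-quadratic R 0 1 1 (λ k → sgn k * χ k l) (λ _ → ⊥?) (λ _ ()) h check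

  -- If 2l + 1 is invertible, the terms with 2k + 1 divisible by p drop out.
  Supported-Θ-unit : ∀ {M} .{{_ : ℕ.NonZero M}} → p ℕ∣.∣ M → ∀ R l u r → u * (1ℤ + + l + + l) ≋ 1ℤ → p ≡ suc (r ℕ.+ r) → quadratic 0 1 1 M % M ≡ 0 % M →
    True (ℕₚ.allUpTo? (λ s → (s % p ℕ.≟ r) ⊎-dec (quadratic 0 1 1 s % M ∈? R)) M) → Supported M R (Θ l)
  Supported-Θ-unit {M} p∣M R l u r unit p≡ h check = Supported-quadratic R 0 1 1 (λ k → sgn k * χ k l) (λ s → s % p ℕ.≟ r)
    (λ k e → ≋0-*ʳ (sgn k) (χ-≋0 l u r unit p≡ k (trans (sym (m∣n⇒o%n%m≡o%m p M k p∣M)) e))) h check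

-- Congruences from Euler's and Jacobi's identities

module Identities (p : ℤ) (P : Series) where

  open Mod p
  open Solver
  open import Relation.Binary.Reasoning.Setoid setoid

  -- By Jacobi's identity P³ is the inverse of Θ 0, so these are the coefficients of the theta
  -- series scaled to constant term 1.
  normalised : ℕ → Series
  normalised i = P ∙ P ∙ P ∙ Θ i

  module Products (PE : P ∙ Euler ≈ 𝟙) (P³Θ₀ : P ∙ P ∙ P ∙ Θ 0 ≈ 𝟙) where

    Θ₀≈E³ : Θ 0 ≈ Euler ∙ Euler ∙ Euler
    Θ₀≈E³ = begin
      Θ 0 ≈⟨ solve 1 (λ F → F := con 1ℤ :* con 1ℤ :* con 1ℤ :* F) ≈-refl (Θ 0) ⟩
      𝟙 ∙ 𝟙 ∙ 𝟙 ∙ Θ 0 ≈⟨ ∙-cong (∙-cong (∙-cong (≈-sym PE) (≈-sym PE)) (≈-sym PE)) (≈-refl {Θ 0}) ⟩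
      P ∙ Euler ∙ (P ∙ Euler) ∙ (P ∙ Euler) ∙ Θ 0 ≈⟨ solve 3 (λ P E F → P :* E :* (P :* E) :* (P :* E) :* F := E :* E :* E :* (P :* P :* P :* F)) ≈-refl P Euler (Θ 0) ⟩
      Euler ∙ Euler ∙ Euler ∙ (P ∙ P ∙ P ∙ Θ 0) ≈⟨ ∙-cong (≈-refl {Euler ∙ Euler ∙ Euler}) P³Θ₀ ⟩
      Euler ∙ Euler ∙ Euler ∙ 𝟙 ≈⟨ solve 1 (λ E → E :* con 1ℤ := E) ≈-refl (Euler ∙ Euler ∙ Euler) ⟩
      Euler ∙ Euler ∙ Euler ∎

  Θ₁≈ : const (+ 3) ∙ Θ 1 ≈ δ (Θ 0)
  Θ₁≈ = ≈-reflexive (λ n → trans (const-∙ (+ 3) (Θ 1) n) (Θ₁-δ n))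

-- The coefficient of y³ modulo 5

module Five (P : Series) where

  open ThetaSupport 5
  open Calculus 4
  open CharSolver 4 refl
  open Identities (+ 5) P
  open import Algebra.Properties.CommutativeSemiring.Exp (CommutativeRing.commutativeSemiring ring)
  open import Relation.Binary.Reasoning.Setoid setoid

  open Frobenius 4 (solve 2 (λ x y → (x :+ y) :^ 5 := x :^ 5 :+ y :^ 5) ≈-refl)

  -- Modulo 5 the cubic term has coefficient -20 and drops out, while -6 and 24 both become 4. The
  -- linear term carries P⁴ = P⁵ E, and in the quadratic one P⁷ E² = P⁵.
  third-coefficient : ∀ P E e t₁ t₂ t₃ → P ∙ E ≈ 𝟙 → t₁ ≈ E ∙ E ∙ e →
    const (+ 2) ∙ (P ∙ (const (- + 3) ∙ (P ∙ P ∙ P ∙ t₃) ⊕ const (+ 12) ∙ (P ∙ P ∙ P ∙ t₁ ∙ (P ∙ P ∙ P ∙ t₂)) ⊕ const (- + 10) ∙ (P ∙ P ∙ P ∙ t₁ ∙ (P ∙ P ∙ P ∙ t₁) ∙ (P ∙ P ∙ P ∙ t₁))))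
      ≈ P ^ 5 ∙ (const (+ 4) ∙ (E ∙ t₃ ⊕ e ∙ t₂))
  third-coefficient P E e t₁ t₂ t₃ PE t₁≈ = begin
    const (+ 2) ∙ (P ∙ (const (- + 3) ∙ (c ∙ t₃) ⊕ const (+ 12) ∙ (c ∙ t₁ ∙ (c ∙ t₂)) ⊕ const (- + 10) ∙ (c ∙ t₁ ∙ (c ∙ t₁) ∙ (c ∙ t₁))))
      ≈⟨ solve 5 (λ P s₁ s₂ s₃ o → con (+ 2) :* (P :* (con (- + 3) :* s₃ :+ con (+ 12) :* (s₁ :* s₂) :+ con (- + 10) :* o))
           := con (+ 4) :* (P :* s₃) :+ con (+ 4) :* (P :* (s₁ :* s₂))) ≈-refl P (c ∙ t₁) (c ∙ t₂) (c ∙ t₃) (c ∙ t₁ ∙ (c ∙ t₁) ∙ (c ∙ t₁)) ⟩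
    const (+ 4) ∙ (P ∙ (c ∙ t₃)) ⊕ const (+ 4) ∙ (P ∙ (c ∙ t₁ ∙ (c ∙ t₂))) ≈⟨ ⊕-cong left right ⟩
    P ^ 5 ∙ (const (+ 4) ∙ (E ∙ t₃)) ⊕ P ^ 5 ∙ (const (+ 4) ∙ (e ∙ t₂))
      ≈⟨ solve 3 (λ Q a b → Q :* (con (+ 4) :* a) :+ Q :* (con (+ 4) :* b) := Q :* (con (+ 4) :* (a :+ b))) ≈-refl (P ^ 5) (E ∙ t₃) (e ∙ t₂) ⟩
    P ^ 5 ∙ (const (+ 4) ∙ (E ∙ t₃ ⊕ e ∙ t₂)) ∎
    where
    c = P ∙ P ∙ P
    left : const (+ 4) ∙ (P ∙ (c ∙ t₃)) ≈ P ^ 5 ∙ (const (+ 4) ∙ (E ∙ t₃))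
    left = begin
      const (+ 4) ∙ (P ∙ (c ∙ t₃)) ≈⟨ ≈-sym (∙-identityˡ (const (+ 4) ∙ (P ∙ (c ∙ t₃)))) ⟩
      𝟙 ∙ (const (+ 4) ∙ (P ∙ (c ∙ t₃))) ≈⟨ ∙-cong (≈-sym PE) (≈-refl {const (+ 4) ∙ (P ∙ (c ∙ t₃))}) ⟩
      P ∙ E ∙ (const (+ 4) ∙ (P ∙ (c ∙ t₃))) ≈⟨ solve 3 (λ P E t → P :* E :* (con (+ 4) :* (P :* (P :* P :* P :* t))) := P :^ 5 :* (con (+ 4) :* (E :* t))) ≈-refl P E t₃ ⟩
      P ^ 5 ∙ (const (+ 4) ∙ (E ∙ t₃)) ∎
    right : const (+ 4) ∙ (P ∙ (c ∙ t₁ ∙ (c ∙ t₂))) ≈ P ^ 5 ∙ (const (+ 4) ∙ (e ∙ t₂))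
    right = begin
      const (+ 4) ∙ (P ∙ (c ∙ t₁ ∙ (c ∙ t₂))) ≈⟨ ∙-cong (≈-refl {const (+ 4)}) (∙-cong (≈-refl {P}) (∙-cong (∙-cong (≈-refl {c}) t₁≈) (≈-refl {c ∙ t₂}))) ⟩
      const (+ 4) ∙ (P ∙ (c ∙ (E ∙ E ∙ e) ∙ (c ∙ t₂))) ≈⟨ solve 4 (λ P E e t → con (+ 4) :* (P :* (P :* P :* P :* (E :* E :* e) :* (P :* P :* P :* t))) := P :* E :* (P :* E) :* (P :^ 5 :* (con (+ 4) :* (e :* t)))) ≈-refl P E e t₂ ⟩
      P ∙ E ∙ (P ∙ E) ∙ (P ^ 5 ∙ (const (+ 4) ∙ (e ∙ t₂))) ≈⟨ ∙-cong (∙-cong PE PE) (≈-refl {P ^ 5 ∙ (const (+ 4) ∙ (e ∙ t₂))}) ⟩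
      𝟙 ∙ 𝟙 ∙ (P ^ 5 ∙ (const (+ 4) ∙ (e ∙ t₂))) ≈⟨ solve 1 (λ x → con 1ℤ :* con 1ℤ :* x := x) ≈-refl (P ^ 5 ∙ (const (+ 4) ∙ (e ∙ t₂))) ⟩
      P ^ 5 ∙ (const (+ 4) ∙ (e ∙ t₂)) ∎

  -- The bracket is the coefficient of y³ in the inverse cube of the normalised theta series.
  B₃ : Series
  B₃ = const (+ 2) ∙ (P ∙ (const (- + 3) ∙ normalised 3 ⊕ const (+ 12) ∙ (normalised 1 ∙ normalised 2) ⊕ const (- + 10) ∙ (normalised 1 ∙ normalised 1 ∙ normalised 1)))

  module _ (PE : P ∙ Euler ≈ 𝟙) (P³Θ₀ : P ∙ P ∙ P ∙ Θ 0 ≈ 𝟙) where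

    open Products PE P³Θ₀

    Θ₁≈E²δE : Θ 1 ≈ Euler ∙ Euler ∙ δ Euler
    Θ₁≈E²δE = begin
      Θ 1 ≈⟨ solve 1 (λ x → x := con (+ 2) :* (con (+ 3) :* x)) ≈-refl (Θ 1) ⟩
      const (+ 2) ∙ (const (+ 3) ∙ Θ 1) ≈⟨ ∙-cong (≈-refl {const (+ 2)}) (≈-trans Θ₁≈ (≈-trans (δ-cong Θ₀≈E³) (≈-trans (leibniz (Euler ∙ Euler) Euler) (⊕-cong (∙-cong (leibniz Euler Euler) (≈-refl {Euler})) (≈-refl {Euler ∙ Euler ∙ δ Euler}))))) ⟩
      const (+ 2) ∙ ((δ Euler ∙ Euler ⊕ Euler ∙ δ Euler) ∙ Euler ⊕ Euler ∙ Euler ∙ δ Euler) ≈⟨ solve 2 (λ E e → con (+ 2) :* ((e :* E :+ E :* e) :* E :+ E :* E :* e) := E :* E :* e) ≈-refl Euler (δ Euler) ⟩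
      Euler ∙ Euler ∙ δ Euler ∎

    B₃-factor : B₃ ≈ P ^ 5 ∙ (const (+ 4) ∙ (Euler ∙ Θ 3 ⊕ δ Euler ∙ Θ 2))
    B₃-factor = third-coefficient P Euler (δ Euler) (Θ 1) (Θ 2) (Θ 3) PE Θ₁≈E²δE

    -- Ramanujan's congruence p(5n + 4) ≡ 0, in terms of supports.
    P-support : Supported 5 (0 ∷ 1 ∷ 2 ∷ 3 ∷ []) P
    P-support = Supported-⊆ (0 ∷ 1 ∷ 2 ∷ 3 ∷ []) _
      (Supported-≈ P≈P¹⁰Θ₀³ (Supported-∙ (Supported-∙ (Supported-^ (Supported-1 P)) (Supported-^ (Supported-1 P))) (Supported-∙ (Supported-∙ Θ₀-support Θ₀-support) Θ₀-support)))
      where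
      -- The triangular numbers congruent to 3 drop out, as 2k + 1 is then divisible by 5. Three
      -- exponents from 0 and 1 cannot add up to 4.
      Θ₀-support : Supported 5 (0 ∷ 1 ∷ []) (Θ 0)
      Θ₀-support = Supported-Θ-unit ℕ∣.∣-refl _ 0 1ℤ 2 (≋-reflexive refl) refl refl _
      P≈P¹⁰Θ₀³ : P ≈ P ^ 5 ∙ P ^ 5 ∙ (Θ 0 ∙ Θ 0 ∙ Θ 0)
      P≈P¹⁰Θ₀³ = ≈-sym (begin
        P ^ 5 ∙ P ^ 5 ∙ (Θ 0 ∙ Θ 0 ∙ Θ 0) ≈⟨ solve 2 (λ P F → P :^ 5 :* P :^ 5 :* (F :* F :* F) := P :* (P :* P :* P :* F :* (P :* P :* P :* F) :* (P :* P :* P :* F))) ≈-refl P (Θ 0) ⟩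
        P ∙ (P ∙ P ∙ P ∙ Θ 0 ∙ (P ∙ P ∙ P ∙ Θ 0) ∙ (P ∙ P ∙ P ∙ Θ 0)) ≈⟨ ∙-cong (≈-refl {P}) (∙-cong (∙-cong P³Θ₀ P³Θ₀) P³Θ₀) ⟩
        P ∙ (𝟙 ∙ 𝟙 ∙ 𝟙) ≈⟨ solve 1 (λ P → P :* (con 1ℤ :* con 1ℤ :* con 1ℤ) := P) ≈-refl P ⟩
        P ∎)

    B₃≋0 : ∀ n → n % 25 ≡ 24 → B₃ n ≋ 0ℤ
    B₃≋0 n h = ≋-trans (at B₃-factor n) (vanishes-at (Supported-∙ (Supported-^ P-support) factor-support) n h _)
      where
      factor-residues E-residues δE-residues Θ₃-residues Θ₂-residues : List ℕ
      -- The residues 9, 14, 19 and 24 are missing, exactly those that reach 24 from the residues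
      -- 15, 10, 5, 0 of P⁵. The entry 4, arising only as 1 + 3 from `δ Euler` and `Θ 2`, would need
      -- the residue 20, which `P-support` excludes.
      factor-residues = 0 ∷ 1 ∷ 2 ∷ 3 ∷ 4 ∷ 5 ∷ 6 ∷ 7 ∷ 8 ∷ 10 ∷ 11 ∷ 12 ∷ 13 ∷ 15 ∷ 16 ∷ 17 ∷ 18 ∷ 20 ∷ 21 ∷ 22 ∷ 23 ∷ []
      E-residues = 0 ∷ 1 ∷ 2 ∷ 5 ∷ 7 ∷ 10 ∷ 12 ∷ 15 ∷ 17 ∷ 20 ∷ 22 ∷ []
      δE-residues = 1 ∷ 2 ∷ 7 ∷ 12 ∷ 17 ∷ 22 ∷ []
      Θ₃-residues = 0 ∷ 1 ∷ 5 ∷ 6 ∷ 10 ∷ 11 ∷ 15 ∷ 16 ∷ 20 ∷ 21 ∷ []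
      Θ₂-residues = 0 ∷ 1 ∷ 3 ∷ 5 ∷ 6 ∷ 10 ∷ 11 ∷ 15 ∷ 16 ∷ 20 ∷ 21 ∷ []
      5∣25 = ℕ∣.divides {5} {25} 5 refl
      E-support : Supported 25 E-residues Euler
      E-support = Supported-Euler _ refl refl _ _
      δE-support : Supported 25 δE-residues (δ Euler)
      δE-support = Supported-scale 5∣25 {E-residues} {Euler} δE-residues 1ℤ 1ℤ (λ n → n) ≋-refl (λ e → e) (λ n → ≋-reflexive (ℤₚ.*-identityˡ _)) _ E-support
      Θ₃-support : Supported 25 Θ₃-residues (Θ 3)
      Θ₃-support = Supported-Θ-unit 5∣25 _ 3 (+ 3) 2 (by (+ 4) refl) refl refl _
      -- Here 2l + 1 = 5 is not invertible, so the residue 3 stays.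
      Θ₂-support : Supported 25 Θ₂-residues (Θ 2)
      Θ₂-support = Supported-Θ _ 2 refl _
      factor-support : Supported 25 factor-residues (const (+ 4) ∙ (Euler ∙ Θ 3 ⊕ δ Euler ∙ Θ 2))
      factor-support = Supported-const∙ (+ 4) {x = Euler ∙ Θ 3 ⊕ δ Euler ∙ Θ 2} (Supported-⊕
        (Supported-⊆ factor-residues _ (Supported-∙ E-support Θ₃-support))
        (Supported-⊆ factor-residues _ (Supported-∙ δE-support Θ₂-support)))

-- The coefficient of y⁴ modulo 7

module Seven (P : Series) where

  open ThetaSupport 7
  open Calculus 6
  open CharSolver 6 refl
  open Identities (+ 7) P
  open import Algebra.Properties.CommutativeSemiring.Exp (CommutativeRing.commutativeSemiring ring)
  open import Relation.Binary.Reasoning.Setoid setoid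

  open Frobenius 6 (solve 2 (λ x y → (x :+ y) :^ 7 := x :^ 7 :+ y :^ 7) ≈-refl)

  -- Doubling -3, 12, 6, -30, 15 gives 1, 3, 5, 3, 2 modulo 7. The linear and quadratic terms are P⁷
  -- times products of theta series, with P⁴ = P⁷ F in the linear one. The remaining terms carry too
  -- high a power of P and are instead expressed through φ.
  fourth-coefficient : ∀ P F φ φ₁ t₁ t₂ t₃ t₄ → P ∙ P ∙ P ∙ F ≈ 𝟙 → P ∙ P ∙ P ∙ t₁ ≈ ⊖ φ → P ∙ P ∙ P ∙ t₂ ≈ φ ∙ φ ⊕ const (+ 2) ∙ φ₁ ⊕ const (+ 5) ∙ φ →
    const (+ 2) ∙ (P ∙ (const (- + 3) ∙ (P ∙ P ∙ P ∙ t₄) ⊕ const (+ 12) ∙ (P ∙ P ∙ P ∙ t₁ ∙ (P ∙ P ∙ P ∙ t₃)) ⊕ const (+ 6) ∙ (P ∙ P ∙ P ∙ t₂ ∙ (P ∙ P ∙ P ∙ t₂))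
      ⊕ const (- + 30) ∙ (P ∙ P ∙ P ∙ t₁ ∙ (P ∙ P ∙ P ∙ t₁) ∙ (P ∙ P ∙ P ∙ t₂)) ⊕ const (+ 15) ∙ (P ∙ P ∙ P ∙ t₁ ∙ (P ∙ P ∙ P ∙ t₁) ∙ (P ∙ P ∙ P ∙ t₁ ∙ (P ∙ P ∙ P ∙ t₁)))))
      ≈ P ^ 7 ∙ (F ∙ t₄ ⊕ const (+ 3) ∙ (t₁ ∙ t₃) ⊕ const (+ 5) ∙ (t₂ ∙ t₂))
        ⊕ const (+ 2) ∙ (P ∙ (const (+ 5) ∙ (φ ∙ φ) ∙ (φ ∙ φ ⊕ const (+ 2) ∙ φ₁ ⊕ const (+ 5) ∙ φ) ⊕ φ ∙ φ ∙ (φ ∙ φ)))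
  fourth-coefficient P F φ φ₁ t₁ t₂ t₃ t₄ PF s₁≈ s₂≈ = begin
    _ ≈⟨ solve 5 (λ P s₁ s₂ s₃ s₄ → con (+ 2) :* (P :* (con (- + 3) :* s₄ :+ con (+ 12) :* (s₁ :* s₃) :+ con (+ 6) :* (s₂ :* s₂) :+ con (- + 30) :* (s₁ :* s₁ :* s₂) :+ con (+ 15) :* (s₁ :* s₁ :* (s₁ :* s₁))))
           := (P :* s₄ :+ con (+ 3) :* (P :* (s₁ :* s₃)) :+ con (+ 5) :* (P :* (s₂ :* s₂))) :+ con (+ 2) :* (P :* (con (+ 5) :* (s₁ :* s₁) :* s₂ :+ s₁ :* s₁ :* (s₁ :* s₁)))) ≈-refl P (c ∙ t₁) (c ∙ t₂) (c ∙ t₃) (c ∙ t₄) ⟩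
    _ ≈⟨ ⊕-cong lacunary-part (∙-cong (≈-refl {const (+ 2)}) (∙-cong (≈-refl {P}) (⊕-cong (∙-cong (∙-cong (≈-refl {const (+ 5)}) (∙-cong s₁≈ s₁≈)) s₂≈) (∙-cong (∙-cong s₁≈ s₁≈) (∙-cong s₁≈ s₁≈))))) ⟩
    _ ≈⟨ solve 4 (λ x P f s → x :+ con (+ 2) :* (P :* (con (+ 5) :* (:- f :* :- f) :* s :+ :- f :* :- f :* (:- f :* :- f))) := x :+ con (+ 2) :* (P :* (con (+ 5) :* (f :* f) :* s :+ f :* f :* (f :* f)))) ≈-refl
           (P ^ 7 ∙ (F ∙ t₄ ⊕ const (+ 3) ∙ (t₁ ∙ t₃) ⊕ const (+ 5) ∙ (t₂ ∙ t₂))) P φ (φ ∙ φ ⊕ const (+ 2) ∙ φ₁ ⊕ const (+ 5) ∙ φ) ⟩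
    _ ∎
    where
    c = P ∙ P ∙ P
    lacunary-part : P ∙ (c ∙ t₄) ⊕ const (+ 3) ∙ (P ∙ (c ∙ t₁ ∙ (c ∙ t₃))) ⊕ const (+ 5) ∙ (P ∙ (c ∙ t₂ ∙ (c ∙ t₂))) ≈ P ^ 7 ∙ (F ∙ t₄ ⊕ const (+ 3) ∙ (t₁ ∙ t₃) ⊕ const (+ 5) ∙ (t₂ ∙ t₂))
    lacunary-part = begin
      P ∙ (c ∙ t₄) ⊕ const (+ 3) ∙ (P ∙ (c ∙ t₁ ∙ (c ∙ t₃))) ⊕ const (+ 5) ∙ (P ∙ (c ∙ t₂ ∙ (c ∙ t₂)))
        ≈⟨ ⊕-cong (⊕-cong first (≈-refl {const (+ 3) ∙ (P ∙ (c ∙ t₁ ∙ (c ∙ t₃)))})) (≈-refl {const (+ 5) ∙ (P ∙ (c ∙ t₂ ∙ (c ∙ t₂)))}) ⟩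
      P ^ 7 ∙ (F ∙ t₄) ⊕ const (+ 3) ∙ (P ∙ (c ∙ t₁ ∙ (c ∙ t₃))) ⊕ const (+ 5) ∙ (P ∙ (c ∙ t₂ ∙ (c ∙ t₂)))
        ≈⟨ ⊕-cong (⊕-cong (≈-refl {P ^ 7 ∙ (F ∙ t₄)}) (∙-cong (≈-refl {const (+ 3)}) (pair t₁ t₃))) (∙-cong (≈-refl {const (+ 5)}) (pair t₂ t₂)) ⟩
      P ^ 7 ∙ (F ∙ t₄) ⊕ const (+ 3) ∙ (P ^ 7 ∙ (t₁ ∙ t₃)) ⊕ const (+ 5) ∙ (P ^ 7 ∙ (t₂ ∙ t₂))
        ≈⟨ solve 4 (λ Q a b d → Q :* a :+ con (+ 3) :* (Q :* b) :+ con (+ 5) :* (Q :* d) := Q :* (a :+ con (+ 3) :* b :+ con (+ 5) :* d)) ≈-refl (P ^ 7) (F ∙ t₄) (t₁ ∙ t₃) (t₂ ∙ t₂) ⟩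
      P ^ 7 ∙ (F ∙ t₄ ⊕ const (+ 3) ∙ (t₁ ∙ t₃) ⊕ const (+ 5) ∙ (t₂ ∙ t₂)) ∎
      where
      pair : ∀ s t → P ∙ (c ∙ s ∙ (c ∙ t)) ≈ P ^ 7 ∙ (s ∙ t)
      pair = solve 3 (λ P s t → P :* (P :* P :* P :* s :* (P :* P :* P :* t)) := P :^ 7 :* (s :* t)) ≈-refl P
      first : P ∙ (c ∙ t₄) ≈ P ^ 7 ∙ (F ∙ t₄)
      first = begin
        P ∙ (c ∙ t₄) ≈⟨ ≈-sym (∙-identityˡ (P ∙ (c ∙ t₄))) ⟩
        𝟙 ∙ (P ∙ (c ∙ t₄)) ≈⟨ ∙-cong (≈-sym PF) (≈-refl {P ∙ (c ∙ t₄)}) ⟩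
        c ∙ F ∙ (P ∙ (c ∙ t₄)) ≈⟨ solve 3 (λ P F t → P :* P :* P :* F :* (P :* (P :* P :* P :* t)) := P :^ 7 :* (F :* t)) ≈-refl P F t₄ ⟩
        P ^ 7 ∙ (F ∙ t₄) ∎

  -- The bracket is the coefficient of y⁴ in the inverse cube of the normalised theta series.
  B₄ : Series
  B₄ = const (+ 2) ∙ (P ∙ (const (- + 3) ∙ normalised 4 ⊕ const (+ 12) ∙ (normalised 1 ∙ normalised 3) ⊕ const (+ 6) ∙ (normalised 2 ∙ normalised 2)
      ⊕ const (- + 30) ∙ (normalised 1 ∙ normalised 1 ∙ normalised 2) ⊕ const (+ 15) ∙ (normalised 1 ∙ normalised 1 ∙ (normalised 1 ∙ normalised 1))))

  T-residues E₇-residues E-residues : List ℕ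
  T-residues = 0 ∷ 1 ∷ 3 ∷ []
  E₇-residues = 0 ∷ 1 ∷ 2 ∷ 5 ∷ []
  E-residues = 0 ∷ 1 ∷ 2 ∷ 5 ∷ 7 ∷ 8 ∷ 12 ∷ 14 ∷ 15 ∷ 19 ∷ 21 ∷ 22 ∷ 26 ∷ 28 ∷ 29 ∷ 33 ∷ 35 ∷ 36 ∷ 40 ∷ 42 ∷ 43 ∷ 47 ∷ []

  7∣49 : 7 ℕ∣.∣ 49
  7∣49 = ℕ∣.divides 7 refl

  Θ₀-support : Supported 7 T-residues (Θ 0)
  Θ₀-support = Supported-Θ-unit ℕ∣.∣-refl _ 0 1ℤ 3 (≋-reflexive refl) refl refl _

  Θ₁-support : Supported 7 (1 ∷ 3 ∷ []) (Θ 1)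
  Θ₁-support = Supported-scale ℕ∣.∣-refl {T-residues} {Θ 0} (1 ∷ 3 ∷ []) (+ 5) (+ 3) (λ n → n) (by (+ 2) refl) (λ e → e) (λ n → ≋-reflexive (Θ₁-δ n)) _ Θ₀-support

  Θ₂-support : Supported 7 (3 ∷ []) (Θ 2)
  Θ₂-support = Supported-scale ℕ∣.∣-refl {T-residues} {Θ 0} (3 ∷ []) (+ 4) (+ 30) (λ n → n * (n - 1ℤ)) (by (+ 17) refl) (λ e → ≋-* e (≋-+ e (≋-refl { - 1ℤ}))) (λ n → ≋-reflexive (Θ₂-δ n)) _ Θ₀-support

  -- Here 2l + 1 = 7 is not invertible, so the residue 6 stays, unlike for `Θ 0` and `Θ 4`.
  Θ₃-support : Supported 7 (0 ∷ 1 ∷ 3 ∷ 6 ∷ []) (Θ 3)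
  Θ₃-support = Supported-Θ _ 3 refl _

  Θ₄-support : Supported 7 T-residues (Θ 4)
  Θ₄-support = Supported-Θ-unit ℕ∣.∣-refl _ 4 (+ 4) 3 (by (+ 5) refl) refl refl _

  E₇-support : Supported 7 E₇-residues Euler
  E₇-support = Supported-Euler _ refl refl _ _

  E-support : Supported 49 E-residues Euler
  E-support = Supported-Euler _ refl refl _ _

module FourthCoefficient (P : Series) (PE : Mod._≈_ (+ 7) (P ∙ Euler) 𝟙) (P³Θ₀ : Mod._≈_ (+ 7) (P ∙ P ∙ P ∙ Θ 0) 𝟙) where

  open ThetaSupport 7
  open Calculus 6
  open CharSolver 6 refl
  open Identities (+ 7) P
  open Products PE P³Θ₀
  open Seven P
  open import Algebra.Properties.CommutativeSemiring.Exp (CommutativeRing.commutativeSemiring ring)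
  open import Relation.Binary.Reasoning.Setoid setoid
  open Frobenius 6 (solve 2 (λ x y → (x :+ y) :^ 7 := x :^ 7 :+ y :^ 7) ≈-refl) using (Supported-^)

  unsupported : ∀ {x} → Supported 7 [] x → x ≈ 𝟘
  unsupported {x} s = coefficients λ n → zero-at n (s n)
    where
    zero-at : ∀ n → x n ≋ 0ℤ ⊎ n % 7 ∈ [] → x n ≋ 𝟘 n
    zero-at n (inj₁ e) = ≋-trans e (≋-reflexive (sym (𝟘≡0 n)))

  ≋-shift : ∀ a {b c} → b ≋ c → b - a ≋ c - a
  ≋-shift a e = ≋-+ e (≋-refl { - a})

  θ³-coefficient : ∀ a b c x n → θ a (θ b (θ c x)) n ≡ (+ n - a) * ((+ n - b) * (+ n - c)) * x n
  θ³-coefficient a b c x n = trans (θ-coefficient a (θ b (θ c x)) n) (trans (cong ((+ n - a) *_) (trans (θ-coefficient b (θ c x) n) (cong ((+ n - b) *_) (θ-coefficient c x n))))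
    (regroup (+ n - a) (+ n - b) (+ n - c) (x n)))
    where
    regroup : ∀ a b c x → a * (b * (c * x)) ≡ a * (b * c) * x
    regroup = solve-∀

  cube-ode : θ 0ℤ (θ 1ℤ (θ (+ 3) (Euler ∙ Euler ∙ Euler))) ≈ 𝟘
  cube-ode = ≈-trans (θ-cong 0ℤ (θ-cong 1ℤ (θ-cong (+ 3) (≈-sym Θ₀≈E³)))) (unsupported
    (Supported-scale ℕ∣.∣-refl {T-residues} {Θ 0} [] 1ℤ 1ℤ (λ n → (n - 0ℤ) * ((n - 1ℤ) * (n - + 3))) ≋-refl
      (λ e → ≋-* (≋-shift 0ℤ e) (≋-* (≋-shift 1ℤ e) (≋-shift (+ 3) e)))
      (λ n → ≋-reflexive (trans (ℤₚ.*-identityˡ _) (θ³-coefficient 0ℤ 1ℤ (+ 3) (Θ 0) n))) _ Θ₀-support))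

  -- The residue 2 is put outermost because the inner three operators are needed again in
  -- `third-derivative`.
  E-ode : θ (+ 2) (θ 0ℤ (θ 1ℤ (θ (+ 5) Euler))) ≈ 𝟘
  E-ode = unsupported
    (Supported-scale ℕ∣.∣-refl {E₇-residues} {Euler} [] 1ℤ 1ℤ (λ n → (n - + 2) * ((n - 0ℤ) * ((n - 1ℤ) * (n - + 5)))) ≋-refl
      (λ e → ≋-* (≋-shift (+ 2) e) (≋-* (≋-shift 0ℤ e) (≋-* (≋-shift 1ℤ e) (≋-shift (+ 5) e))))
      (λ n → ≋-reflexive (trans (ℤₚ.*-identityˡ _) (trans (θ-coefficient (+ 2) (θ 0ℤ (θ 1ℤ (θ (+ 5) Euler))) n)
        (trans (cong ((+ n - + 2) *_) (θ³-coefficient 0ℤ 1ℤ (+ 5) Euler n)) (sym (ℤₚ.*-assoc (+ n - + 2) _ (Euler n))))))) _ E₇-support)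

  open Ramanujan.Logarithmic P Euler PE cube-ode E-ode

  P³F : P ∙ P ∙ P ∙ F ≈ 𝟙
  P³F = ≈-trans (∙-cong (≈-refl {P ∙ P ∙ P}) (≈-sym Θ₀≈E³)) P³Θ₀

  absorb-F : ∀ x y → x ≈ F ∙ y → P ∙ P ∙ P ∙ x ≈ y
  absorb-F x y e = begin
    P ∙ P ∙ P ∙ x ≈⟨ ∙-cong (≈-refl {P ∙ P ∙ P}) e ⟩
    P ∙ P ∙ P ∙ (F ∙ y) ≈⟨ solve 3 (λ c F y → c :* (F :* y) := c :* F :* y) ≈-refl (P ∙ P ∙ P) F y ⟩
    P ∙ P ∙ P ∙ F ∙ y ≈⟨ ∙-cong P³F (≈-refl {y}) ⟩
    𝟙 ∙ y ≈⟨ ∙-identityˡ y ⟩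
    y ∎

  normalised₁ : normalised 1 ≈ ⊖ φ
  normalised₁ = absorb-F (Θ 1) (⊖ φ) (begin
    Θ 1 ≈⟨ solve 1 (λ x → x := con (+ 5) :* (con (+ 3) :* x)) ≈-refl (Θ 1) ⟩
    const (+ 5) ∙ (const (+ 3) ∙ Θ 1) ≈⟨ ∙-cong (≈-refl {const (+ 5)}) (≈-trans Θ₁≈ (≈-trans (δ-cong Θ₀≈E³) δF)) ⟩
    const (+ 5) ∙ (const (+ 4) ∙ (F ∙ φ)) ≈⟨ solve 2 (λ F f → con (+ 5) :* (con (+ 4) :* (F :* f)) := F :* :- f) ≈-refl F φ ⟩
    F ∙ ⊖ φ ∎)

  normalised₂ : normalised 2 ≈ φ ∙ φ ⊕ const (+ 2) ∙ φ₁ ⊕ const (+ 5) ∙ φ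
  normalised₂ = absorb-F (Θ 2) (φ ∙ φ ⊕ const (+ 2) ∙ φ₁ ⊕ const (+ 5) ∙ φ) (begin
    Θ 2 ≈⟨ solve 1 (λ x → x := con (+ 4) :* (con (+ 30) :* x)) ≈-refl (Θ 2) ⟩
    const (+ 4) ∙ (const (+ 30) ∙ Θ 2) ≈⟨ ∙-cong (≈-refl {const (+ 4)}) (≈-trans Θ₂≈ (≈-trans (θ-cong 1ℤ (θ-cong 0ℤ Θ₀≈E³)) second)) ⟩
    const (+ 4) ∙ (F ∙ (const (+ 4) ∙ φ₁ ⊕ const (+ 4) ∙ φ ∙ (const (+ 4) ∙ φ) ⊕ const (- 1ℤ) ∙ (const (+ 4) ∙ φ)))
      ≈⟨ solve 3 (λ F f f₁ → con (+ 4) :* (F :* (con (+ 4) :* f₁ :+ con (+ 4) :* f :* (con (+ 4) :* f) :+ con (- 1ℤ) :* (con (+ 4) :* f))) := F :* (f :* f :+ con (+ 2) :* f₁ :+ con (+ 5) :* f)) ≈-refl F φ φ₁ ⟩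
    F ∙ (φ ∙ φ ⊕ const (+ 2) ∙ φ₁ ⊕ const (+ 5) ∙ φ) ∎)
    where
    Θ₂≈ : const (+ 30) ∙ Θ 2 ≈ θ 1ℤ (θ 0ℤ (Θ 0))
    Θ₂≈ = ≈-reflexive (λ n → trans (const-∙ (+ 30) (Θ 2) n) (trans (Θ₂-δ n) (sym (trans (θ-coefficient 1ℤ (θ 0ℤ (Θ 0)) n) (trans (cong ((+ n - 1ℤ) *_) (θ-coefficient 0ℤ (Θ 0) n)) (regroup (+ n) (Θ 0 n)))))))
      where
      regroup : ∀ n x → (n - 1ℤ) * ((n - 0ℤ) * x) ≡ n * (n - 1ℤ) * x
      regroup = solve-∀
    second : θ 1ℤ (θ 0ℤ F) ≈ F ∙ (const (+ 4) ∙ φ₁ ⊕ const (+ 4) ∙ φ ∙ (const (+ 4) ∙ φ) ⊕ const (- 1ℤ) ∙ (const (+ 4) ∙ φ))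
    second = θF 1ℤ (const (+ 4) ∙ φ) (const (+ 4) ∙ φ₁)
      (≈-trans (θF 0ℤ 𝟙 𝟘 (solve 1 (λ F → F := F :* con 1ℤ) ≈-refl F) (δ-const 1ℤ)) (solve 2 (λ F f → F :* (con 0ℤ :+ con (+ 4) :* f :* con 1ℤ :+ con 0ℤ :* con 1ℤ) := F :* (con (+ 4) :* f)) ≈-refl F φ))
      (δ-const∙ (+ 4) φ)

  not-5 : List ℕ
  not-5 = 0 ∷ 1 ∷ 2 ∷ 3 ∷ 4 ∷ 6 ∷ []

  lacunary-support : Supported 7 not-5 (P ^ 7 ∙ (Θ 0 ∙ Θ 4 ⊕ const (+ 3) ∙ (Θ 1 ∙ Θ 3) ⊕ const (+ 5) ∙ (Θ 2 ∙ Θ 2)))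
  lacunary-support = Supported-⊆ not-5 _
    (Supported-∙ (Supported-^ (Supported-1 P)) (Supported-⊕ (Supported-⊕
      (Supported-⊆ not-5 _ (Supported-∙ Θ₀-support Θ₄-support))
      (Supported-const∙ (+ 3) {x = Θ 1 ∙ Θ 3} (Supported-⊆ not-5 _ (Supported-∙ Θ₁-support Θ₃-support))))
      (Supported-const∙ (+ 5) {x = Θ 2 ∙ Θ 2} (Supported-⊆ not-5 _ (Supported-∙ Θ₂-support Θ₂-support)))))

  P⁴⁹-support : Supported 49 (0 ∷ []) (P ^ 49)
  P⁴⁹-support = Supported-≈ (≈-sym (^-assocʳ P 7 7)) (Supported-^ (Supported-^ (Supported-1 P)))

  -- A pentagonal exponent n makes 24n + 1 a square. If n is 2 modulo 7, this square is divisible by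
  -- 7, hence by 49, and n is 2 modulo 49. The factor P⁴⁹ only has exponents divisible by 49.
  Y²-support : Supported 49 (2 ∷ []) (Y ∙ Y)
  Y²-support = Supported-≈ Y² (Supported-⊖ (Supported-∙ third-support P⁴⁹-support))
    where
    third-support : Supported 49 (2 ∷ []) (θ 0ℤ (θ 1ℤ (θ (+ 5) Euler)))
    third-support = Supported-scale 7∣49 {E-residues} {Euler} (2 ∷ []) 1ℤ 1ℤ (λ n → (n - 0ℤ) * ((n - 1ℤ) * (n - + 5))) ≋-refl
      (λ e → ≋-* (≋-shift 0ℤ e) (≋-* (≋-shift 1ℤ e) (≋-shift (+ 5) e)))
      (λ n → ≋-reflexive (trans (ℤₚ.*-identityˡ _) (θ³-coefficient 0ℤ 1ℤ (+ 5) Euler n))) _ E-support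

  module _ (Y₀ : Y 0 ≋ 0ℤ) (Y₁ : Y 1 ≋ 1ℤ) where

    -- Since Y starts with q, its tail starts with a unit, and the square of the tail is Y² shifted
    -- by two: supported on multiples of 49. A square root with invertible constant term has the
    -- same support.
    Y-support : Supported 49 (1 ∷ []) Y
    Y-support zero = inj₁ Y₀
    Y-support (suc n) = raise (square-root-support (tail Y) (+ 4) unit tail²-support n)
      where
      unit : + 4 * (Y 1 + Y 1) ≋ 1ℤ
      unit = ≋-trans (≋-* (≋-refl {+ 4}) (≋-+ Y₁ Y₁)) (by 1ℤ refl)
      raise : tail Y n ≋ 0ℤ ⊎ n % 49 ∈ (0 ∷ []) → Y (suc n) ≋ 0ℤ ⊎ suc n % 49 ∈ (1 ∷ [])
      raise (inj₁ e) = inj₁ e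
      raise (inj₂ (here e)) = inj₂ (here (trans (%-distribˡ-+ 1 n 49) (cong (λ r → (1 ℕ.+ r) % 49) e)))
      tail²-support : Supported 49 (0 ∷ []) (tail Y ∙ tail Y)
      tail²-support m = lower (Y²-support (suc (suc m)))
        where
        expand : (tail Y ∙ tail Y) m ≋ (Y ∙ Y) (suc (suc m))
        expand = ≋-sym (≋-trans (≋-reflexive (cong (_+_ (Y 0 * Y (suc (suc m)))) (∙-suc (tail Y) Y m)))
          (≋-trans (≋-+ (≋0-*ˡ (Y (suc (suc m))) Y₀) (≋-+ (≋-refl {(tail Y ∙ tail Y) m}) (≋0-*ʳ (Y (suc (suc m))) Y₀)))
          (≋-reflexive (trans (ℤₚ.+-identityˡ _) (ℤₚ.+-identityʳ _)))))
        lower : (Y ∙ Y) (suc (suc m)) ≋ 0ℤ ⊎ (2 ℕ.+ m) % 49 ∈ (2 ∷ []) → (tail Y ∙ tail Y) m ≋ 0ℤ ⊎ m % 49 ∈ (0 ∷ [])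
        lower (inj₁ e) = inj₁ (≋-trans expand e)
        lower (inj₂ (here e)) = inj₂ (here (trans (sym ([m+kn]%n≡m%n m 1 49)) (trans (cong (_% 49) (trans (ℕₚ.+-comm m 49) (ℕₚ.+-comm 47 (2 ℕ.+ m))))
          (trans (%-distribˡ-+ (2 ℕ.+ m) 47 49) (cong (λ r → (r ℕ.+ 47) % 49) e)))))

    -- Y contributes 1 and F⁷ contributes 0, 7 or 21, so the two exponents from E would have to add
    -- up to 46, 39 or 25 modulo 49, all 4 modulo 7. With the residues 0, 1, 2, 5 this forces both
    -- to be 2 modulo 7, hence 2 modulo 49, and their sum is 4.
    PΔ-vanishes : ∀ n → n % 49 ≡ 47 → (P ∙ Δ) n ≋ 0ℤ
    PΔ-vanishes n h = ≋-trans (at PΔ n) (vanishes-at (Supported-∙ Y-support (Supported-∙ (Supported-^ F-support) (Supported-∙ E-support E-support))) n h _)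
      where
      F-support : Supported 7 T-residues F
      F-support = Supported-≈ (≈-sym Θ₀≈E³) Θ₀-support

    -- Such n is 5 modulo 7. This alone removes the part with P⁷ and the derivative `θ (+ 5)`; the
    -- finer residue modulo 49 is for P Δ.
    B₄≋0 : ∀ n → n % 49 ≡ 47 → B₄ n ≋ 0ℤ
    B₄≋0 n h = ≋-trans (at (fourth-coefficient P (Θ 0) φ φ₁ (Θ 1) (Θ 2) (Θ 3) (Θ 4) P³Θ₀ normalised₁ normalised₂) n)
      (≋-+ (vanishes-at lacunary-support n n%7 _) (≋-trans (≋-reflexive (const-∙ (+ 2) _ n)) (≋0-*ʳ (+ 2) (≋-trans (at exactness n)
        (≋-+ exact-part (≋-trans (≋-reflexive (const-∙ (+ 4) (P ∙ Δ) n)) (≋0-*ʳ (+ 4) (PΔ-vanishes n h))))))))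
      where
      n%7 : n % 7 ≡ 5
      n%7 = trans (sym (m∣n⇒o%n%m≡o%m 7 49 n 7∣49)) (cong (_% 7) h)
      exact-part : θ (+ 5) antiderivative n ≋ 0ℤ
      exact-part = ≋-trans (≋-reflexive (θ-coefficient (+ 5) antiderivative n)) (≋0-*ˡ (antiderivative n)
        (≋-trans (≋-shift (+ 5) (≋-trans (≋-% ℕ∣.∣-refl n) (≋-reflexive (cong +_ n%7)))) ≋-refl))

-- Partitions by largest part and length

total : ∀ {A : Set} → (A → ℤ) → List A → ℤ
total f [] = 0ℤ
total f (x ∷ xs) = f x + total f xs

total-++ : ∀ {A : Set} (f : A → ℤ) xs ys → total f (xs ++ ys) ≡ total f xs + total f ys
total-++ f [] ys = sym (ℤₚ.+-identityˡ _)
total-++ f (x ∷ xs) ys = trans (cong (_+_ (f x)) (total-++ f xs ys)) (sym (ℤₚ.+-assoc (f x) _ _))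

total-map : ∀ {A B : Set} (f : B → ℤ) (g : A → B) xs → total f (map g xs) ≡ total (f ∘ g) xs
total-map f g [] = refl
total-map f g (x ∷ xs) = cong (_+_ (f (g x))) (total-map f g xs)

total-concatMap : ∀ {A B : Set} (f : B → ℤ) (g : A → List B) xs → total f (concatMap g xs) ≡ total (total f ∘ g) xs
total-concatMap f g [] = refl
total-concatMap f g (x ∷ xs) = trans (total-++ f (g x) (concatMap g xs)) (cong (_+_ (total f (g x))) (total-concatMap f g xs))

total-filterᵇ : ∀ {A : Set} (f : A → ℤ) q xs → total f (filterᵇ q xs) ≡ total (λ x → if q x then f x else 0ℤ) xs
total-filterᵇ f q [] = refl
total-filterᵇ f q (x ∷ xs) with q x
... | true = cong (_+_ (f x)) (total-filterᵇ f q xs)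
... | false = trans (total-filterᵇ f q xs) (sym (ℤₚ.+-identityˡ _))

total-applyUpTo : ∀ {A : Set} (f : A → ℤ) g n → total f (applyUpTo g n) ≡ sum n (f ∘ g)
total-applyUpTo f g zero = refl
total-applyUpTo f g (suc n) = trans (cong (_+_ (f (g 0))) (total-applyUpTo f (g ∘ suc) n)) (sym (sum-first n (f ∘ g)))

total-cong : ∀ {A : Set} {f g : A → ℤ} → (∀ x → f x ≡ g x) → ∀ xs → total f xs ≡ total g xs
total-cong e [] = refl
total-cong e (x ∷ xs) = cong₂ _+_ (e x) (total-cong e xs)

total-+ : ∀ {A : Set} (f g : A → ℤ) xs → total (λ x → f x + g x) xs ≡ total f xs + total g xs
total-+ f g [] = refl
total-+ f g (x ∷ xs) = trans (cong (_+_ (f x + g x)) (total-+ f g xs)) (interchange (f x) (g x) (total f xs) (total g xs))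
  where
  interchange : ∀ a b c d → a + b + (c + d) ≡ a + c + (b + d)
  interchange = solve-∀

total-* : ∀ {A : Set} c (f : A → ℤ) xs → total (λ x → c * f x) xs ≡ c * total f xs
total-* c f [] = sym (ℤₚ.*-zeroʳ c)
total-* c f (x ∷ xs) = trans (cong (_+_ (c * f x)) (total-* c f xs)) (sym (ℤₚ.*-distribˡ-+ c (f x) (total f xs)))

shift : ℕ → Series → Series
shift zero x n = x n
shift (suc k) x zero = 0ℤ
shift (suc k) x (suc n) = shift k x n

shift-cong : ∀ k {x y : Series} → (∀ n → x n ≡ y n) → ∀ n → shift k x n ≡ shift k y n
shift-cong zero e n = e n
shift-cong (suc k) e zero = refl
shift-cong (suc k) e (suc n) = shift-cong k e n

shift-⊕ : ∀ k x y n → shift k (x ⊕ y) n ≡ shift k x n + shift k y n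
shift-⊕ zero x y n = refl
shift-⊕ (suc k) x y zero = refl
shift-⊕ (suc k) x y (suc n) = shift-⊕ k x y n

shift-shift : ∀ k l x n → shift k (shift l x) n ≡ shift (k ℕ.+ l) x n
shift-shift zero l x n = refl
shift-shift (suc k) l x zero = refl
shift-shift (suc k) l x (suc n) = shift-shift k l x n

shift-0 : ∀ k n → shift k (λ _ → 0ℤ) n ≡ 0ℤ
shift-0 zero n = refl
shift-0 (suc k) zero = refl
shift-0 (suc k) (suc n) = shift-0 k n

shift-sum : ∀ k m (x : ℕ → Series) n → shift k (λ i → sum m (λ j → x j i)) n ≡ sum m (λ j → shift k (x j) n)
shift-sum k zero x n = shift-0 k n
shift-sum k (suc m) x n = trans (shift-⊕ k (λ i → sum m (λ j → x j i)) (x m) n) (cong (_+ shift k (x m) n) (shift-sum k m x n))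

shift-< : ∀ k x n → n ℕ.< k → shift k x n ≡ 0ℤ
shift-< (suc k) x zero _ = refl
shift-< (suc k) x (suc n) (s≤s n<k) = shift-< k x n n<k

suc-cancel : ∀ n k → + suc n - + suc k ≡ + n - + k
suc-cancel n k = trans (ℤₚ.m-n≡m⊖n (suc n) (suc k)) (trans (ℤₚ.[1+m]⊖[1+n]≡m⊖n n k) (sym (ℤₚ.m-n≡m⊖n n k)))

shift-ext : ∀ k x n → shift k x n ≡ ext x (+ n - + k)
shift-ext zero x n = cong (ext x) (sym (ℤₚ.+-identityʳ (+ n)))
shift-ext (suc k) x zero = refl
shift-ext (suc k) x (suc n) = trans (shift-ext k x n) (cong (ext x) (sym (suc-cancel n k)))

lt : ℕ → ℕ → ℤ
lt j b = if j ℕ.<ᵇ b then 1ℤ else 0ℤ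

lt-< : ∀ {j b} → j ℕ.< b → lt j b ≡ 1ℤ
lt-< {j} {b} j<b with j ℕ.<ᵇ b | ℕₚ.<⇒<ᵇ j<b
... | true | _ = refl

lt-≥ : ∀ {j b} → b ℕ.≤ j → lt j b ≡ 0ℤ
lt-≥ {j} {b} b≤j with j ℕ.<ᵇ b | ℕₚ.<ᵇ⇒< j b
... | false | _ = refl
... | true | j<b = ⊥-elim (ℕₚ.<⇒≱ (j<b _) b≤j)

-- Either bound on the largest part may serve as the range of summation and the other as an
-- indicator. This reconciles the enumeration, bounded by the size, with recursions bounded by the
-- box.
lt-exchange : ∀ a b (f : ℕ → ℤ) → sum a (λ j → lt j b * f j) ≡ sum b (λ j → lt j a * f j)
lt-exchange a b f = trans (left a b) (trans (trans (sum-cong (a ℕ.+ b) (λ j _ → swap (lt j a) (lt j b) (f j))) (cong (λ n → sum n (λ j → lt j b * (lt j a * f j))) (ℕₚ.+-comm a b))) (sym (left b a)))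
  where
  swap : ∀ x y z → x * (y * z) ≡ y * (x * z)
  swap = solve-∀
  left : ∀ a b → sum a (λ j → lt j b * f j) ≡ sum (a ℕ.+ b) (λ j → lt j a * (lt j b * f j))
  left a b = sym (trans (sum-truncate (λ j → lt j a * (lt j b * f j)) (ℕₚ.m≤m+n a b) (λ i a≤i → trans (cong (_* (lt i b * f i)) (lt-≥ a≤i)) refl)) (sum-cong a (λ i i<a → trans (cong (_* (lt i b * f i)) (lt-< i<a)) (ℤₚ.*-identityˡ _))))

shift-lt : ∀ j x n → shift j x n ≡ lt j (suc n) * x (n ℕ.∸ j)
shift-lt zero x n = sym (ℤₚ.*-identityˡ (x n))
shift-lt (suc j) x zero = refl
shift-lt (suc j) x (suc n) = shift-lt j x n

-- Partitions into exactly l parts of size at most b: in the recursion either no part equals b + 1,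
-- or one such part is removed.
exactly : ℕ → ℕ → Series
exactly b zero = 𝟙
exactly zero (suc l) n = 0ℤ
exactly (suc b) (suc l) = exactly b (suc l) ⊕ shift (suc b) (exactly (suc b) l)

-- The Gaussian binomial coefficient, counting partitions with at most l parts, each at most b.
box : ℕ → ℕ → Series
box b l n = sum (suc l) (λ i → exactly b i n)

exactly-sum : ∀ b l n → exactly b (suc l) n ≡ sum b (λ j → shift (suc j) (exactly (suc j) l) n)
exactly-sum zero l n = refl
exactly-sum (suc b) l n = cong (_+ shift (suc b) (exactly (suc b) l) n) (exactly-sum b l n)

box-suc : ∀ b l n → box (suc b) (suc l) n ≡ box b (suc l) n + shift (suc b) (box (suc b) l) n
box-suc b l n = begin
  box (suc b) (suc l) n ≡⟨ sum-first (suc l) (λ i → exactly (suc b) i n) ⟩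
  𝟙 n + sum (suc l) (λ i → exactly b (suc i) n + shift (suc b) (exactly (suc b) i) n) ≡⟨ cong (_+_ (𝟙 n)) (sum-+ (suc l) (λ i → exactly b (suc i) n) _) ⟩
  𝟙 n + (sum (suc l) (λ i → exactly b (suc i) n) + sum (suc l) (λ i → shift (suc b) (exactly (suc b) i) n)) ≡⟨ sym (ℤₚ.+-assoc (𝟙 n) _ _) ⟩
  𝟙 n + sum (suc l) (λ i → exactly b (suc i) n) + sum (suc l) (λ i → shift (suc b) (exactly (suc b) i) n)
    ≡⟨ cong₂ _+_ (sym (sum-first (suc l) (λ i → exactly b i n))) (sym (shift-sum (suc b) (suc l) (exactly (suc b)) n)) ⟩
  box b (suc l) n + shift (suc b) (box (suc b) l) n ∎
  where open ≡-Reasoning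

box-zero : ∀ l n → box 0 l n ≡ 𝟙 n
box-zero l n = trans (sum-first l (λ i → exactly 0 i n)) (trans (cong (_+_ (𝟙 n)) (sum-0 l (λ _ _ → refl))) (ℤₚ.+-identityʳ (𝟙 n)))

-- Subtracting 1 from each of the l parts removes the first column of the diagram and leaves a
-- partition in a box.
exactly-column : ∀ b l n → exactly (suc b) l n ≡ shift l (box b l) n
exactly-column b zero n = sym (ℤₚ.+-identityˡ (𝟙 n))
exactly-column zero (suc l) n = begin
  0ℤ + shift 1 (exactly 1 l) n ≡⟨ ℤₚ.+-identityˡ _ ⟩
  shift 1 (exactly 1 l) n ≡⟨ shift-cong 1 (exactly-column 0 l) n ⟩
  shift 1 (shift l (box 0 l)) n ≡⟨ shift-shift 1 l (box 0 l) n ⟩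
  shift (suc l) (box 0 l) n ≡⟨ shift-cong (suc l) (λ n → trans (box-zero l n) (sym (box-zero (suc l) n))) n ⟩
  shift (suc l) (box 0 (suc l)) n ∎
  where open ≡-Reasoning
exactly-column (suc b) (suc l) n = begin
  exactly (suc b) (suc l) n + shift (suc (suc b)) (exactly (suc (suc b)) l) n
    ≡⟨ cong₂ _+_ (exactly-column b (suc l) n) (trans (shift-cong (suc (suc b)) (exactly-column (suc b) l) n) (shift-shift (suc (suc b)) l (box (suc b) l) n)) ⟩
  shift (suc l) (box b (suc l)) n + shift (suc (suc b) ℕ.+ l) (box (suc b) l) n
    ≡⟨ cong (_+_ (shift (suc l) (box b (suc l)) n)) (trans (cong (λ k → shift k (box (suc b) l) n) (trans (ℕₚ.+-comm (suc (suc b)) l) (ℕₚ.+-suc l (suc b)))) (sym (shift-shift (suc l) (suc b) (box (suc b) l) n))) ⟩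
  shift (suc l) (box b (suc l)) n + shift (suc l) (shift (suc b) (box (suc b) l)) n ≡⟨ sym (shift-⊕ (suc l) (box b (suc l)) _ n) ⟩
  shift (suc l) (box b (suc l) ⊕ shift (suc b) (box (suc b) l)) n ≡⟨ shift-cong (suc l) (λ n → sym (box-suc b l n)) n ⟩
  shift (suc l) (box (suc b) (suc l)) n ∎
  where open ≡-Reasoning

partsBounded-total : ∀ (w : List ℕ → ℤ) fuel n m → total w (partsBounded (suc fuel) (suc n) m) ≡
  sum (suc n) (λ j → lt j m * total (λ p → w (suc j ∷ p)) (partsBounded fuel (n ℕ.∸ j) (suc j)))
partsBounded-total w fuel n m = begin
  total w (concatMap g (filterᵇ q (upTo (suc n)))) ≡⟨ total-concatMap w g (filterᵇ q (upTo (suc n))) ⟩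
  total (total w ∘ g) (filterᵇ q (upTo (suc n))) ≡⟨ total-filterᵇ (total w ∘ g) q (upTo (suc n)) ⟩
  total (λ j → if q j then total w (g j) else 0ℤ) (upTo (suc n)) ≡⟨ total-applyUpTo (λ j → if q j then total w (g j) else 0ℤ) (λ j → j) (suc n) ⟩
  sum (suc n) (λ j → if q j then total w (g j) else 0ℤ) ≡⟨ sum-cong (suc n) term ⟩
  sum (suc n) (λ j → lt j m * total (λ p → w (suc j ∷ p)) (partsBounded fuel (n ℕ.∸ j) (suc j))) ∎
  where
  open ≡-Reasoning
  g : ℕ → List (List ℕ)
  g j = map (λ p → suc j ∷ p) (partsBounded fuel (suc n ℕ.∸ suc j) (suc j))
  q : ℕ → Bool
  q j = (suc j ℕ.≤ᵇ m) ∧ (suc j ℕ.≤ᵇ suc n)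
  simplify : ∀ a b (x y : ℤ) → T b → x ≡ y → (if a ∧ b then x else 0ℤ) ≡ (if a then 1ℤ else 0ℤ) * y
  simplify false true x y _ e = refl
  simplify true true x y _ e = trans e (sym (ℤₚ.*-identityˡ y))
  term : ∀ j → j ℕ.< suc n → (if q j then total w (g j) else 0ℤ) ≡ lt j m * total (λ p → w (suc j ∷ p)) (partsBounded fuel (n ℕ.∸ j) (suc j))
  term j j<n = simplify (j ℕ.<ᵇ m) (j ℕ.<ᵇ suc n) _ _ (ℕₚ.<⇒<ᵇ j<n) (total-map w (λ p → suc j ∷ p) (partsBounded fuel (n ℕ.∸ j) (suc j)))

partsBounded-length : ∀ fuel n b B (h : ℕ → ℤ) → n ℕ.≤ fuel → n ℕ.< B → total (h ∘ length) (partsBounded fuel n b) ≡ sum B (λ l → h l * exactly b l n)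
partsBounded-length fuel zero b (suc B) h _ _ = sym (begin
  sum (suc B) (λ l → h l * exactly b l 0) ≡⟨ sum-first B (λ l → h l * exactly b l 0) ⟩
  h 0 * 1ℤ + sum B (λ l → h (suc l) * exactly b (suc l) 0) ≡⟨ cong₂ _+_ (ℤₚ.*-identityʳ (h 0)) (sum-0 B (λ l _ → trans (cong (h (suc l) *_) (trans (exactly-sum b l 0) (sum-0 b (λ _ _ → refl)))) (ℤₚ.*-zeroʳ (h (suc l))))) ⟩
  h 0 + 0ℤ ∎)
  where open ≡-Reasoning
partsBounded-length (suc fuel) (suc n) b (suc B) h (s≤s n≤fuel) (s≤s n<B) = begin
  total (h ∘ length) (partsBounded (suc fuel) (suc n) b) ≡⟨ partsBounded-total (h ∘ length) fuel n b ⟩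
  sum (suc n) (λ j → lt j b * total ((h ∘ suc) ∘ length) (partsBounded fuel (n ℕ.∸ j) (suc j)))
    ≡⟨ lt-exchange (suc n) b (λ j → total ((h ∘ suc) ∘ length) (partsBounded fuel (n ℕ.∸ j) (suc j))) ⟩
  sum b (λ j → lt j (suc n) * total ((h ∘ suc) ∘ length) (partsBounded fuel (n ℕ.∸ j) (suc j)))
    ≡⟨ sum-cong b (λ j _ → trans (cong (lt j (suc n) *_) (partsBounded-length fuel (n ℕ.∸ j) (suc j) B (h ∘ suc) (ℕₚ.≤-trans (ℕₚ.m∸n≤m n j) n≤fuel) (ℕₚ.≤-<-trans (ℕₚ.m∸n≤m n j) n<B)))
         (trans (sym (sum-* B (lt j (suc n)) _)) (sum-cong B (λ l _ → trans (regroup (lt j (suc n)) (h (suc l)) _) (cong (h (suc l) *_) (sym (shift-lt j (exactly (suc j) l) n))))))) ⟩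
  sum b (λ j → sum B (λ l → h (suc l) * shift j (exactly (suc j) l) n)) ≡⟨ sum-swap b B (λ j l → h (suc l) * shift j (exactly (suc j) l) n) ⟩
  sum B (λ l → sum b (λ j → h (suc l) * shift j (exactly (suc j) l) n)) ≡⟨ sum-cong B (λ l _ → trans (sum-* b (h (suc l)) _) (cong (h (suc l) *_) (sym (exactly-sum b l (suc n))))) ⟩
  sum B (λ l → h (suc l) * exactly b (suc l) (suc n)) ≡⟨ sym (trans (cong (_+ sum B (λ l → h (suc l) * exactly b (suc l) (suc n))) (ℤₚ.*-zeroʳ (h 0))) (ℤₚ.+-identityˡ _)) ⟩
  h 0 * 0ℤ + sum B (λ l → h (suc l) * exactly b (suc l) (suc n)) ≡⟨ sym (sum-first B (λ l → h l * exactly b l (suc n))) ⟩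
  sum (suc B) (λ l → h l * exactly b l (suc n)) ∎
  where
  open ≡-Reasoning
  regroup : ∀ a b c → a * (b * c) ≡ b * (a * c)
  regroup = solve-∀

W : (ℤ → ℤ) → Series
W f n = total (f ∘ rank) (partitions n)

-- Remove the largest part suc j, leaving l parts of size at most suc j; the rank is then j - l.
W-formula : ∀ f n A B → n ℕ.≤ A → n ℕ.≤ B → W f n ≡ f 0ℤ * 𝟙 n + sum A (λ j → sum B (λ l → f (+ j - + l) * shift (suc j) (exactly (suc j) l) n))
W-formula f zero A B _ _ = cong₂ _+_ (sym (ℤₚ.*-identityʳ (f 0ℤ))) (sym (sum-0 A (λ j _ → sum-0 B (λ l _ → ℤₚ.*-zeroʳ (f (+ j - + l))))))
W-formula f (suc n) A B n<A n<B = begin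
  total (f ∘ rank) (partsBounded (suc n) (suc n) (suc n)) ≡⟨ partsBounded-total (f ∘ rank) n n (suc n) ⟩
  sum (suc n) (λ j → lt j (suc n) * total (λ p → f (+ suc j - + suc (length p))) (partsBounded n (n ℕ.∸ j) (suc j)))
    ≡⟨ sum-cong (suc n) (λ j _ → trans (cong (lt j (suc n) *_) (trans (total-cong (λ p → cong f (suc-cancel j (length p))) (partsBounded n (n ℕ.∸ j) (suc j)))
         (partsBounded-length n (n ℕ.∸ j) (suc j) B (λ l → f (+ j - + l)) (ℕₚ.m∸n≤m n j) (ℕₚ.≤-<-trans (ℕₚ.m∸n≤m n j) n<B))))
         (trans (sym (sum-* B (lt j (suc n)) _)) (sum-cong B (λ l _ → trans (regroup (lt j (suc n)) (f (+ j - + l)) _) (cong (f (+ j - + l) *_) (sym (shift-lt j (exactly (suc j) l) n))))))) ⟩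
  sum (suc n) (λ j → sum B (λ l → f (+ j - + l) * shift j (exactly (suc j) l) n))
    ≡⟨ sym (sum-truncate _ n<A (λ j n<j → sum-0 B (λ l _ → trans (cong (f (+ j - + l) *_) (shift-< j _ n n<j)) (ℤₚ.*-zeroʳ (f (+ j - + l)))))) ⟩
  sum A (λ j → sum B (λ l → f (+ j - + l) * shift j (exactly (suc j) l) n)) ≡⟨ sym (trans (cong (_+ sum A (λ j → sum B (λ l → f (+ j - + l) * shift j (exactly (suc j) l) n))) (ℤₚ.*-zeroʳ (f 0ℤ))) (ℤₚ.+-identityˡ _)) ⟩
  f 0ℤ * 0ℤ + sum A (λ j → sum B (λ l → f (+ j - + l) * shift j (exactly (suc j) l) n)) ∎
  where
  open ≡-Reasoning
  regroup : ∀ a b c → a * (b * c) ≡ b * (a * c)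
  regroup = solve-∀

-- Dyson's adjoint, the symmetry of the rank, and Euler's pentagonal number theorem

nonneg : ℤ → ℤ
nonneg (+ _) = 1ℤ
nonneg -[1+ _ ] = 0ℤ

nonneg-lt : ∀ k j → nonneg (+ k - + j) ≡ lt j (suc k)
nonneg-lt k zero = refl
nonneg-lt zero (suc j) = refl
nonneg-lt (suc k) (suc j) = trans (cong nonneg (suc-cancel k j)) (nonneg-lt k j)

nonneg-complement : ∀ x → nonneg x + nonneg (- 1ℤ - x) ≡ 1ℤ
nonneg-complement (+ zero) = refl
nonneg-complement (+ suc n) = refl
nonneg-complement -[1+ zero ] = refl
nonneg-complement -[1+ suc n ] = refl

negative-sub : ∀ k j → ∃ λ i → -[1+ k ] - + j ≡ -[1+ i ]
negative-sub k zero = k , refl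
negative-sub k (suc j) = suc (k ℕ.+ j) , refl

sub-< : ∀ {i k} → i ℕ.< k → ∃ λ j → + i - + k ≡ -[1+ j ]
sub-< {zero} {suc k} _ = k , refl
sub-< {suc i} {suc k} (s≤s i<k) with sub-< i<k
... | j , e = j , trans (suc-cancel i k) e

sub-≤ : ∀ {i k} → k ℕ.≤ i → + i - + k ≡ + (i ℕ.∸ k)
sub-≤ {i} {zero} _ = ℤₚ.+-identityʳ (+ i)
sub-≤ {suc i} {suc k} (s≤s k≤i) = trans (suc-cancel i k) (sub-≤ k≤i)

-- The functional equations relate n to a smaller integer that may be negative, so all negative
-- integers form the base of the induction.
descent : (Z : ℤ → Set) → (∀ k → Z -[1+ k ]) → (∀ n → (∀ j → Z (+ n - + suc j)) → Z (+ n)) → ∀ n → Z n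
descent Z neg step -[1+ k ] = neg k
descent Z neg step (+ n) = <-rec (λ n → Z (+ n)) (λ n ih → step n (lower n ih)) n
  where
  lower : ∀ n → (∀ {m} → m ℕ.< n → Z (+ m)) → ∀ j → Z (+ n - + suc j)
  lower n ih j with suc j ℕ.≤? n
  ... | yes j<n = subst Z (sym (sub-≤ j<n)) (ih (ℕₚ.∸-monoʳ-< {n} {suc j} {0} (s≤s z≤n) j<n))
  ... | no j≮n with sub-< (ℕₚ.≰⇒> j≮n)
  ... | i , e = subst Z (sym e) (neg i)

partial-sum : ℤ → (ℕ → ℤ) → ℤ
partial-sum (+ k) t = sum (suc k) t
partial-sum -[1+ k ] t = 0ℤ

sum-nonneg : ∀ x A t → (∀ j → A ℕ.≤ j → t j ≡ 0ℤ) → sum A (λ j → nonneg (x - + j) * t j) ≡ partial-sum x t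
sum-nonneg (+ k) A t vanish = begin
  sum A (λ j → nonneg (+ k - + j) * t j) ≡⟨ sum-cong A (λ j _ → cong (_* t j) (nonneg-lt k j)) ⟩
  sum A (λ j → lt j (suc k) * t j) ≡⟨ lt-exchange A (suc k) t ⟩
  sum (suc k) (λ j → lt j A * t j) ≡⟨ sum-cong (suc k) (λ j _ → term j) ⟩
  sum (suc k) t ∎
  where
  open ≡-Reasoning
  term : ∀ j → lt j A * t j ≡ t j
  term j with j ℕ.<? A
  ... | yes j<A = trans (cong (_* t j) (lt-< j<A)) (ℤₚ.*-identityˡ (t j))
  ... | no j≮A = trans (cong (lt j A *_) z) (trans (ℤₚ.*-zeroʳ (lt j A)) (sym z))
    where z = vanish j (ℕₚ.≮⇒≥ j≮A)
sum-nonneg -[1+ k ] A t vanish = sum-0 A (λ j _ → cong (_* t j) (trans (cong nonneg (proj₂ (negative-sub k j))) refl))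

-- A box with a negative side holds nothing, not even the empty partition. This convention is where
-- the exceptional terms of Dyson's relation come from.
boxℤ : ℤ → ℤ → ℤ → ℤ
boxℤ (+ a) (+ l) n = ext (box a l) n
boxℤ (+ a) -[1+ l ] n = 0ℤ
boxℤ -[1+ a ] l n = 0ℤ

boxℤ-neg : ∀ x y k → boxℤ x y -[1+ k ] ≡ 0ℤ
boxℤ-neg (+ a) (+ l) k = refl
boxℤ-neg (+ a) -[1+ l ] k = refl
boxℤ-neg -[1+ a ] y k = refl

boxℤ-negʳ : ∀ x k n → boxℤ x -[1+ k ] n ≡ 0ℤ
boxℤ-negʳ (+ a) k n = refl
boxℤ-negʳ -[1+ a ] k n = refl

κ : ℤ → ℤ
κ = ext 𝟙

ext-cong : ∀ {x y : Series} → (∀ n → x n ≡ y n) → ∀ n → ext x n ≡ ext y n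
ext-cong e (+ n) = e n
ext-cong e -[1+ n ] = refl

boxℤ-zeroˡ : ∀ y n → boxℤ 0ℤ y n ≡ nonneg y * κ n
boxℤ-zeroˡ (+ l) n = trans (ext-cong (box-zero l) n) (sym (ℤₚ.*-identityˡ (κ n)))
boxℤ-zeroˡ -[1+ l ] n = refl

boxℤ-zeroʳ : ∀ x n → boxℤ x 0ℤ n ≡ nonneg x * κ n
boxℤ-zeroʳ (+ a) n = trans (ext-cong (λ n → ℤₚ.+-identityˡ (𝟙 n)) n) (sym (ℤₚ.*-identityˡ (κ n)))
boxℤ-zeroʳ -[1+ a ] n = refl

P : Series
P = W (λ _ → 1ℤ)

Q : ℤ → Series
Q m = W (λ r → nonneg (m - r))

Pℤ : ℤ → ℤ
Pℤ = ext P

Qℤ : ℤ → ℤ → ℤ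
Qℤ m = ext (Q m)

-- With l + 1 parts, rank at most m means that all parts are at most m + l + 1. Removing the first
-- column leaves a box of width m + l and height l + 1.
by-length : ∀ m n B → n ℕ.≤ B → Q m n ≡ nonneg m * 𝟙 n + sum B (λ l → boxℤ (m + + l) (+ suc l) (+ n - + suc l))
by-length m n B n≤B = begin
  Q m n ≡⟨ W-formula (λ r → nonneg (m - r)) n n B ℕₚ.≤-refl n≤B ⟩
  nonneg (m - 0ℤ) * 𝟙 n + sum n (λ j → sum B (λ l → nonneg (m - (+ j - + l)) * t j l))
    ≡⟨ cong₂ _+_ (cong (λ x → nonneg x * 𝟙 n) (ℤₚ.+-identityʳ m)) (sum-swap n B (λ j l → nonneg (m - (+ j - + l)) * t j l)) ⟩
  nonneg m * 𝟙 n + sum B (λ l → sum n (λ j → nonneg (m - (+ j - + l)) * t j l))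
    ≡⟨ cong (_+_ (nonneg m * 𝟙 n)) (sum-cong B (λ l _ → trans (sum-cong n (λ j _ → cong (λ x → nonneg x * t j l) (regroup m (+ j) (+ l))))
         (trans (sum-nonneg (m + + l) n (λ j → t j l) (λ j n≤j → shift-< (suc j) (exactly (suc j) l) n (s≤s n≤j))) (column (m + + l) l)))) ⟩
  nonneg m * 𝟙 n + sum B (λ l → boxℤ (m + + l) (+ suc l) (+ n - + suc l)) ∎
  where
  open ≡-Reasoning
  t : ℕ → ℕ → ℤ
  t j l = shift (suc j) (exactly (suc j) l) n
  regroup : ∀ m j l → m - (j - l) ≡ m + l - j
  regroup = solve-∀
  column : ∀ x l → partial-sum x (λ j → t j l) ≡ boxℤ x (+ suc l) (+ n - + suc l)
  column (+ k) l = trans (sym (exactly-sum (suc k) l n)) (trans (exactly-column k (suc l) n) (shift-ext (suc l) (box k (suc l)) n))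
  column -[1+ k ] l = refl

-- Removing the largest part j + 1 leaves parts of size at most j + 1, and rank at least s allows at
-- most j - s of them.
by-largest : ∀ s n A → n ℕ.≤ A → W (λ r → nonneg (r - s)) n ≡ nonneg (- s) * 𝟙 n + sum A (λ j → boxℤ (+ suc j) (+ j - s) (+ n - + suc j))
by-largest s n A n≤A = begin
  W (λ r → nonneg (r - s)) n ≡⟨ W-formula (λ r → nonneg (r - s)) n A n n≤A ℕₚ.≤-refl ⟩
  nonneg (0ℤ - s) * 𝟙 n + sum A (λ j → sum n (λ l → nonneg (+ j - + l - s) * t j l))
    ≡⟨ cong₂ _+_ (cong (λ x → nonneg x * 𝟙 n) (ℤₚ.+-identityˡ (- s))) (sum-cong A (λ j _ → trans (sum-cong n (λ l _ → cong (λ x → nonneg x * t j l) (regroup s (+ j) (+ l))))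
         (trans (sum-nonneg (+ j - s) n (t j) (high j)) (row (+ j - s) j)))) ⟩
  nonneg (- s) * 𝟙 n + sum A (λ j → boxℤ (+ suc j) (+ j - s) (+ n - + suc j)) ∎
  where
  open ≡-Reasoning
  t : ℕ → ℕ → ℤ
  t j l = shift (suc j) (exactly (suc j) l) n
  regroup : ∀ s j l → j - l - s ≡ j - s - l
  regroup = solve-∀
  high : ∀ j l → n ℕ.≤ l → t j l ≡ 0ℤ
  high j l n≤l = trans (shift-cong (suc j) (exactly-column j l) n) (trans (shift-shift (suc j) l (box j l) n) (shift-< (suc j ℕ.+ l) (box j l) n (s≤s (ℕₚ.≤-trans n≤l (ℕₚ.m≤n+m l j)))))
  row : ∀ x j → partial-sum x (t j) ≡ boxℤ (+ suc j) x (+ n - + suc j)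
  row (+ k) j = trans (sym (shift-sum (suc j) (suc k) (exactly (suc j)) n)) (shift-ext (suc j) (box (suc j) k) n)
  row -[1+ k ] j = refl

sum-diagonal : ∀ (g : ℤ → ℤ) d A → (∀ k → g -[1+ k ] ≡ 0ℤ) → (∀ x k → x - d ≡ -[1+ k ] → g x ≡ 0ℤ) → (∀ a → A ℕ.≤ a → g (+ a) ≡ 0ℤ) →
  sum A (λ a → g (+ a)) ≡ sum (ℤ.∣ d ∣ ℕ.+ A) (λ l → g (+ l + d))
sum-diagonal g (+ k) A neg low high = begin
  sum A (λ a → g (+ a)) ≡⟨ sym (sum-truncate (λ a → g (+ a)) (ℕₚ.m≤n+m A k) high) ⟩
  sum (k ℕ.+ A) (λ a → g (+ a)) ≡⟨ sum-split k A (λ a → g (+ a)) ⟩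
  sum k (λ a → g (+ a)) + sum A (λ i → g (+ (k ℕ.+ i))) ≡⟨ cong (_+ sum A (λ i → g (+ (k ℕ.+ i)))) (sum-0 k (λ i i<k → low (+ i) (proj₁ (sub-< i<k)) (proj₂ (sub-< i<k)))) ⟩
  0ℤ + sum A (λ i → g (+ (k ℕ.+ i))) ≡⟨ ℤₚ.+-identityˡ _ ⟩
  sum A (λ i → g (+ (k ℕ.+ i))) ≡⟨ sum-cong A (λ i _ → cong (λ n → g (+ n)) (ℕₚ.+-comm k i)) ⟩
  sum A (λ i → g (+ (i ℕ.+ k))) ≡⟨ sym (sum-truncate (λ i → g (+ (i ℕ.+ k))) (ℕₚ.m≤n+m A k) (λ i A≤i → high (i ℕ.+ k) (ℕₚ.≤-trans A≤i (ℕₚ.m≤m+n i k)))) ⟩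
  sum (k ℕ.+ A) (λ i → g (+ (i ℕ.+ k))) ∎
  where open ≡-Reasoning
sum-diagonal g -[1+ k ] A neg low high = sym (begin
  sum (suc k ℕ.+ A) (λ l → g (+ l + -[1+ k ])) ≡⟨ sum-split (suc k) A (λ l → g (+ l + -[1+ k ])) ⟩
  sum (suc k) (λ l → g (+ l - + suc k)) + sum A (λ i → g (+ (suc k ℕ.+ i) + -[1+ k ]))
    ≡⟨ cong₂ _+_ (sum-0 (suc k) (λ l l<k → trans (cong g (proj₂ (sub-< l<k))) (neg _))) (sum-cong A (λ i _ → cong g (trans (cong (_+ -[1+ k ]) (ℤₚ.pos-+ (suc k) i)) (cancel (+ suc k) (+ i))))) ⟩
  0ℤ + sum A (λ i → g (+ i)) ≡⟨ ℤₚ.+-identityˡ _ ⟩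
  sum A (λ i → g (+ i)) ∎)
  where
  open ≡-Reasoning
  cancel : ∀ k i → k + i + - k ≡ i
  cancel = solve-∀

-- The indicator of 0, in the shape in which it arises: the difference of two boundary conditions
-- for the empty partition.
ι : ℤ → ℤ
ι x = nonneg x - nonneg (x - 1ℤ)

-- Partitions in a box summed along a diagonal: adding a column counts ranks at most m,
-- adding a row counts ranks at least m - 2.
diagonal : ℕ → ℤ → ℤ → ℤ
diagonal B m n = sum B (λ a → boxℤ (+ a) (+ a - (m - 1ℤ)) (n - + a))

-- The diagonal contains one more box than `by-length`, the one with a = m - 1 and no rows. It
-- counts when m ≥ 1, whereas the empty partition counts in Q when m ≥ 0, so the discrepancy sits at
-- m = 0.
Q-diagonal : ∀ m n → Qℤ m (n - m + 1ℤ) ≡ ι m * κ (n - m + 1ℤ) + diagonal (suc ℤ.∣ n ∣) m n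
Q-diagonal m n = trans (direct (n - m + 1ℤ) (ℤ.∣ d ∣ ℕ.+ ℤ.∣ n ∣) bound refl) (cong (_+_ (ι m * κ (n - m + 1ℤ))) (sym (trans reindex (cong₂ sum (ℕₚ.+-suc ℤ.∣ d ∣ ℤ.∣ n ∣) refl))))
  where
  d = m - 1ℤ
  bound : ℤ.∣ n - m + 1ℤ ∣ ℕ.≤ ℤ.∣ d ∣ ℕ.+ ℤ.∣ n ∣
  bound = subst₂ (λ x y → ℤ.∣ x ∣ ℕ.≤ y) (regroup n m) (ℕₚ.+-comm ℤ.∣ n ∣ ℤ.∣ d ∣) (ℤₚ.∣i-j∣≤∣i∣+∣j∣ n d)
    where
    regroup : ∀ n m → n - (m - 1ℤ) ≡ n - m + 1ℤ
    regroup = solve-∀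
  g : ℤ → ℤ
  g x = boxℤ x (x - d) (n - x)
  high : ∀ n a → suc ℤ.∣ n ∣ ℕ.≤ a → ∃ λ k → n - + a ≡ -[1+ k ]
  high (+ n) a n<a = sub-< n<a
  high -[1+ n ] a _ = negative-sub n a
  reindex : diagonal (suc ℤ.∣ n ∣) m n ≡ sum (ℤ.∣ d ∣ ℕ.+ suc ℤ.∣ n ∣) (λ l → g (+ l + d))
  reindex = sum-diagonal g d (suc ℤ.∣ n ∣) (λ k → refl) (λ x k e → trans (cong (λ y → boxℤ x y (n - x)) e) (boxℤ-negʳ x k (n - x)))
    (λ a n<a → trans (cong (boxℤ (+ a) (+ a - d)) (proj₂ (high n a n<a))) (boxℤ-neg (+ a) (+ a - d) _))
  direct : ∀ N B → ℤ.∣ N ∣ ℕ.≤ B → N ≡ n - m + 1ℤ → Qℤ m N ≡ ι m * κ N + sum (suc B) (λ l → g (+ l + d))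
  direct N B N≤B e = sym (begin
    ι m * κ N + sum (suc B) (λ l → g (+ l + d)) ≡⟨ cong (_+_ (ι m * κ N)) (sum-first B (λ l → g (+ l + d))) ⟩
    ι m * κ N + (boxℤ (0ℤ + d) (0ℤ + d - d) (n - (0ℤ + d)) + sum B (λ l → g (+ suc l + d)))
      ≡⟨ cong (_+_ (ι m * κ N)) (cong₂ _+_ (trans (cong₃ boxℤ (ℤₚ.+-identityˡ d) (cancel d) (trans (start n m) (sym e))) (boxℤ-zeroʳ d N)) (sum-cong B (λ l _ → trans (cong (λ x → g (x + d)) (ℤₚ.pos-+ 1 l)) (trans (cong₃ boxℤ (first m (+ l)) (second m (+ l)) (third n m (+ l))) (cong₃ boxℤ (refl {x = m + + l}) (sym (ℤₚ.pos-+ 1 l)) (cong₂ _-_ (sym e) (sym (ℤₚ.pos-+ 1 l)))))))) ⟩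
    ι m * κ N + (nonneg d * κ N + sum B (λ l → boxℤ (m + + l) (+ suc l) (N - + suc l))) ≡⟨ collect (nonneg m) (nonneg d) (κ N) _ ⟩
    nonneg m * κ N + sum B (λ l → boxℤ (m + + l) (+ suc l) (N - + suc l)) ≡⟨ sym (extended N N≤B) ⟩
    Qℤ m N ∎)
    where
    open ≡-Reasoning
    cong₃ : ∀ (f : ℤ → ℤ → ℤ → ℤ) {a a′ b b′ c c′} → a ≡ a′ → b ≡ b′ → c ≡ c′ → f a b c ≡ f a′ b′ c′
    cong₃ f refl refl refl = refl
    cancel : ∀ d → 0ℤ + d - d ≡ 0ℤ
    cancel = solve-∀
    start : ∀ n m → n - (0ℤ + (m - 1ℤ)) ≡ n - m + 1ℤ
    start = solve-∀
    first : ∀ m l → 1ℤ + l + (m - 1ℤ) ≡ m + l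
    first = solve-∀
    second : ∀ m l → 1ℤ + l + (m - 1ℤ) - (m - 1ℤ) ≡ 1ℤ + l
    second = solve-∀
    third : ∀ n m l → n - (1ℤ + l + (m - 1ℤ)) ≡ n - m + 1ℤ - (1ℤ + l)
    third = solve-∀
    collect : ∀ a b k s → (a - b) * k + (b * k + s) ≡ a * k + s
    collect = solve-∀
    extended : ∀ N → ℤ.∣ N ∣ ℕ.≤ B → Qℤ m N ≡ nonneg m * κ N + sum B (λ l → boxℤ (m + + l) (+ suc l) (N - + suc l))
    extended (+ N) N≤B = by-length m N B N≤B
    extended -[1+ k ] _ = sym (cong₂ _+_ (ℤₚ.*-zeroʳ (nonneg m)) (sum-0 B (λ l _ → trans (cong (boxℤ (m + + l) (+ suc l)) (proj₂ (negative-sub k (suc l)))) (boxℤ-neg (m + + l) (+ suc l) _))))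

-- Here the additional box is a = 0, which counts when m ≤ 1, whereas the empty partition has rank
-- at least m - 2 when m ≤ 2. The discrepancy sits at m = 2.
P-Q-diagonal : ∀ m n → Pℤ n - Qℤ (m - + 3) n ≡ ι (+ 2 - m) * κ n + diagonal (suc ℤ.∣ n ∣) m n
P-Q-diagonal m -[1+ k ] = sym (cong₂ _+_ (ℤₚ.*-zeroʳ (ι (+ 2 - m))) (sum-0 (suc ℤ.∣ -[1+ k ] ∣) (λ a _ → trans (cong (boxℤ (+ a) (+ a - (m - 1ℤ))) (proj₂ (negative-sub k a))) (boxℤ-neg (+ a) (+ a - (m - 1ℤ)) _))))
P-Q-diagonal m (+ n) = begin
  P n - Q (m - + 3) n ≡⟨ complement ⟩
  W (λ r → nonneg (r - (m - + 2))) n ≡⟨ by-largest (m - + 2) n n ℕₚ.≤-refl ⟩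
  nonneg (- (m - + 2)) * 𝟙 n + sum n (λ j → boxℤ (+ suc j) (+ j - (m - + 2)) (+ n - + suc j))
    ≡⟨ cong₂ _+_ (cong (λ x → nonneg x * 𝟙 n) (flip m)) (sum-cong n (λ j _ → cong (λ x → boxℤ (+ suc j) x (+ n - + suc j)) (trans (raise m (+ j)) (cong (_- (m - 1ℤ)) (sym (ℤₚ.pos-+ 1 j)))))) ⟩
  nonneg (+ 2 - m) * 𝟙 n + sum n (λ j → boxℤ (+ suc j) (+ suc j - (m - 1ℤ)) (+ n - + suc j)) ≡⟨ collect (nonneg (+ 2 - m)) (nonneg (+ 2 - m - 1ℤ)) (𝟙 n) _ ⟩
  ι (+ 2 - m) * 𝟙 n + (nonneg (+ 2 - m - 1ℤ) * 𝟙 n + sum n (λ j → boxℤ (+ suc j) (+ suc j - (m - 1ℤ)) (+ n - + suc j)))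
    ≡⟨ cong (_+_ (ι (+ 2 - m) * 𝟙 n)) (cong (_+ sum n (λ j → boxℤ (+ suc j) (+ suc j - (m - 1ℤ)) (+ n - + suc j))) (sym (trans (cong (boxℤ 0ℤ (0ℤ - (m - 1ℤ))) (ℤₚ.+-identityʳ (+ n))) (trans (boxℤ-zeroˡ (0ℤ - (m - 1ℤ)) (+ n)) (cong (λ x → nonneg x * 𝟙 n) (zeroth m)))))) ⟩
  ι (+ 2 - m) * 𝟙 n + (boxℤ 0ℤ (0ℤ - (m - 1ℤ)) (+ n - 0ℤ) + sum n (λ j → boxℤ (+ suc j) (+ suc j - (m - 1ℤ)) (+ n - + suc j)))
    ≡⟨ cong (_+_ (ι (+ 2 - m) * 𝟙 n)) (sym (sum-first n (λ a → boxℤ (+ a) (+ a - (m - 1ℤ)) (+ n - + a)))) ⟩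
  ι (+ 2 - m) * 𝟙 n + diagonal (suc n) m (+ n) ∎
  where
  open ≡-Reasoning
  flip : ∀ m → - (m - + 2) ≡ + 2 - m
  flip = solve-∀
  raise : ∀ m j → j - (m - + 2) ≡ 1ℤ + j - (m - 1ℤ)
  raise = solve-∀
  zeroth : ∀ m → 0ℤ - (m - 1ℤ) ≡ + 2 - m - 1ℤ
  zeroth = solve-∀
  collect : ∀ a b k s → a * k + s ≡ (a - b) * k + (b * k + s)
  collect = solve-∀
  rest : ∀ m r → - 1ℤ - (m - + 3 - r) ≡ r - (m - + 2)
  rest = solve-∀
  complement : P n - Q (m - + 3) n ≡ W (λ r → nonneg (r - (m - + 2))) n
  complement = trans (cong (_- Q (m - + 3) n) (trans (total-cong (λ p → sym (trans (cong (_+_ (nonneg (m - + 3 - rank p))) (cong nonneg (sym (rest m (rank p))))) (nonneg-complement (m - + 3 - rank p)))) (partitions n))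
    (total-+ (λ p → nonneg (m - + 3 - rank p)) (λ p → nonneg (rank p - (m - + 2))) (partitions n)))) (cancel (Q (m - + 3) n) (W (λ r → nonneg (r - (m - + 2))) n))
    where
    cancel : ∀ a b → a + b - a ≡ b
    cancel = solve-∀

dyson : ∀ m n → Qℤ m (n - m + 1ℤ) + Qℤ (m - + 3) n ≡ Pℤ n + (ι m * κ (n - m + 1ℤ) - ι (+ 2 - m) * κ n)
dyson m n = solve-for (Qℤ m (n - m + 1ℤ)) (Qℤ (m - + 3) n) (Pℤ n) (ι m * κ (n - m + 1ℤ)) (ι (+ 2 - m) * κ n) (diagonal (suc ℤ.∣ n ∣) m n) (Q-diagonal m n) (P-Q-diagonal m n)
  where
  solve-for : ∀ a b p x y t → a ≡ x + t → p - b ≡ y + t → a + b ≡ p + (x - y)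
  solve-for a b p x y t e f = trans (cong (_+ b) e) (trans (cong (λ s → x + s + b) (trans (isolate y t) (cong (_- y) (sym f)))) (regroup x p b y))
    where
    isolate : ∀ y t → t ≡ y + t - y
    isolate = solve-∀
    regroup : ∀ x p b y → x + (p - b - y) + b ≡ p + (x - y)
    regroup = solve-∀

-- Rank at most -1 - m is the mirror image of rank at least m + 1, so the vanishing of this quantity
-- is the symmetry of the rank.
defect : ℤ → ℤ → ℤ
defect m n = Qℤ m n + Qℤ (- 1ℤ - m) n - Pℤ n

-- The substitution of m by 2 - m and n by n - m + 1 is an involution under which the exceptional
-- terms change sign, so they cancel between the two instances of `dyson`.
defect-step : ∀ m n → defect (m - + 3) n ≡ - defect m (n - m + 1ℤ)
defect-step m n = begin
  Qℤ (m - + 3) n + Qℤ (- 1ℤ - (m - + 3)) n - Pℤ n ≡⟨ cong (λ x → Qℤ (m - + 3) n + x - Pℤ n) (cong₂ Qℤ (index m) (inverse n m)) ⟩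
  Qℤ (m - + 3) n + Qℤ (+ 2 - m) (n - m + 1ℤ - (+ 2 - m) + 1ℤ) - Pℤ n
    ≡⟨ combine (Qℤ m n′) (Qℤ (m - + 3) n) (Pℤ n) (ι m * κ n′) (ι (+ 2 - m) * κ n) (Qℤ (+ 2 - m) (n′ - (+ 2 - m) + 1ℤ)) (Qℤ (- 1ℤ - m) n′) (Pℤ n′) (dyson m n) dyson′ ⟩
  - (Qℤ m n′ + Qℤ (- 1ℤ - m) n′ - Pℤ n′) ∎
  where
  open ≡-Reasoning
  n′ = n - m + 1ℤ
  index : ∀ m → - 1ℤ - (m - + 3) ≡ + 2 - m
  index = solve-∀
  inverse : ∀ n m → n ≡ n - m + 1ℤ - (+ 2 - m) + 1ℤ
  inverse = solve-∀
  involution : ∀ m → + 2 - (+ 2 - m) ≡ m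
  involution = solve-∀
  index′ : ∀ m → + 2 - m - + 3 ≡ - 1ℤ - m
  index′ = solve-∀
  dyson′ : Qℤ (+ 2 - m) (n′ - (+ 2 - m) + 1ℤ) + Qℤ (- 1ℤ - m) n′ ≡ Pℤ n′ + (ι (+ 2 - m) * κ n - ι m * κ n′)
  dyson′ = trans (cong (λ x → Qℤ (+ 2 - m) (n′ - (+ 2 - m) + 1ℤ) + Qℤ x n′) (sym (index′ m)))
    (trans (dyson (+ 2 - m) n′) (cong₂ (λ x y → Pℤ n′ + (ι (+ 2 - m) * κ x - ι y * κ n′)) (sym (inverse n m)) (involution m)))
  combine : ∀ a b p x y c d q → a + b ≡ p + (x - y) → c + d ≡ q + (y - x) → b + c - p ≡ - (a + d - q)
  combine a b p x y c d q e f = trans (split a b c d p) (trans (cong₂ (λ s t → s + t - p - a - d) e f) (merge a d p q x y))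
    where
    split : ∀ a b c d p → b + c - p ≡ a + b + (c + d) - p - a - d
    split = solve-∀
    merge : ∀ a d p q x y → p + (x - y) + (q + (y - x)) - p - a - d ≡ - (a + d - q)
    merge = solve-∀

-- Raising the index from k to k + 3 lowers the size from n to n - k - 2, until the size is
-- negative.
defect-pos : ∀ n k → defect (+ k) n ≡ 0ℤ
defect-pos = descent (λ n → ∀ k → defect (+ k) n ≡ 0ℤ) (λ _ _ → refl) λ n ih k → begin
  defect (+ k) (+ n) ≡⟨ cong (λ x → defect x (+ n)) (trans (up (+ k)) (cong (_- + 3) (sym (ℤₚ.pos-+ k 3)))) ⟩
  defect (+ (k ℕ.+ 3) - + 3) (+ n) ≡⟨ defect-step (+ (k ℕ.+ 3)) (+ n) ⟩
  - defect (+ (k ℕ.+ 3)) (+ n - + (k ℕ.+ 3) + 1ℤ) ≡⟨ cong (λ x → - defect (+ (k ℕ.+ 3)) x) (trans (cong (λ x → + n - x + 1ℤ) (ℤₚ.pos-+ k 3)) (trans (down (+ n) (+ k)) (cong (_-_ (+ n)) (sym (ℤₚ.pos-+ 2 k))))) ⟩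
  - defect (+ (k ℕ.+ 3)) (+ n - + suc (suc k)) ≡⟨ cong -_ (ih (suc k) (k ℕ.+ 3)) ⟩
  0ℤ ∎
  where
  open ≡-Reasoning
  up : ∀ k → k ≡ k + + 3 - + 3
  up = solve-∀
  down : ∀ n k → n - (k + + 3) + 1ℤ ≡ n - (+ 2 + k)
  down = solve-∀

defect≡0 : ∀ m n → defect m n ≡ 0ℤ
defect≡0 (+ k) n = defect-pos n k
defect≡0 -[1+ k ] n = trans (cong (_- Pℤ n) (trans (cong (_+_ (Qℤ -[1+ k ] n)) (cong (λ x → Qℤ x n) (reflect k))) (trans (ℤₚ.+-comm (Qℤ -[1+ k ] n) (Qℤ (+ k) n)) (cong (λ x → Qℤ (+ k) n + Qℤ x n) (reflect′ k))))) (defect-pos n k)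
  where
  reflect : ∀ k → - 1ℤ - -[1+ k ] ≡ + k
  reflect k = trans (cong (_+_ (- 1ℤ)) (ℤₚ.pos-+ 1 k)) (cancel (+ k))
    where
    cancel : ∀ k → - 1ℤ + (1ℤ + k) ≡ k
    cancel = solve-∀
  reflect′ : ∀ k → -[1+ k ] ≡ - 1ℤ - + k
  reflect′ zero = refl
  reflect′ (suc k) = refl

alternating : ∀ (r a : ℕ → ℤ) → (∀ k → r k ≡ a k - r (suc k)) → ∀ K → r 0 ≡ sum K (λ k → sgn k * a k) + sgn K * r K
alternating r a h zero = trans (sym (ℤₚ.*-identityˡ (r 0))) (sym (ℤₚ.+-identityˡ _))
alternating r a h (suc K) = trans (alternating r a h K) (trans (cong (λ x → sum K (λ k → sgn k * a k) + sgn K * x) (h K)) (regroup (sum K (λ k → sgn k * a k)) (sgn K) (a K) (r (suc K))))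
  where
  regroup : ∀ s g a r → s + g * (a - r) ≡ s + g * a + - g * r
  regroup = solve-∀

-- For m ≥ 4 Dyson's relation has no exceptional term.
dyson-iterate : ∀ m e n → Qℤ (+ suc m) (n - + e) ≡ Pℤ (n - + e) - Qℤ (+ suc (m ℕ.+ 3)) (n - + (e ℕ.+ (m ℕ.+ 3)))
dyson-iterate m e n = isolate (Qℤ (+ suc (m ℕ.+ 3)) (n - + (e ℕ.+ (m ℕ.+ 3)))) (Qℤ (+ suc m) (n - + e)) (Pℤ (n - + e)) (begin
  Qℤ M (n - + (e ℕ.+ (m ℕ.+ 3))) + Qℤ (+ suc m) (n - + e) ≡⟨ cong₂ (λ x y → Qℤ M x + Qℤ y (n - + e)) (trans (cong (_-_ n) (trans (ℤₚ.pos-+ e (m ℕ.+ 3)) (cong (_+_ (+ e)) (ℤₚ.pos-+ m 3)))) (trans (shifted n (+ e) (+ m)) (cong (λ x → n - + e - x + 1ℤ) (sym M≡)))) (trans (ℤₚ.pos-+ 1 m) (trans (lowered (+ m)) (cong (_- + 3) (sym M≡)))) ⟩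
  Qℤ M (n - + e - M + 1ℤ) + Qℤ (M - + 3) (n - + e) ≡⟨ dyson M (n - + e) ⟩
  Pℤ (n - + e) + (ι M * κ (n - + e - M + 1ℤ) - ι (+ 2 - M) * κ (n - + e)) ≡⟨ cong (_+_ (Pℤ (n - + e))) (cong₂ (λ x y → x * κ (n - + e - M + 1ℤ) - y * κ (n - + e)) ι-M ι-2-M) ⟩
  Pℤ (n - + e) + 0ℤ ≡⟨ ℤₚ.+-identityʳ _ ⟩
  Pℤ (n - + e) ∎)
  where
  open ≡-Reasoning
  M = + suc (m ℕ.+ 3)
  M≡ : M ≡ + m + + 4
  M≡ = trans (cong +_ (sym (ℕₚ.+-suc m 3))) (ℤₚ.pos-+ m 4)
  shifted : ∀ n e m → n - (e + (m + + 3)) ≡ n - e - (m + + 4) + 1ℤ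
  shifted = solve-∀
  lowered : ∀ m → 1ℤ + m ≡ m + + 4 - + 3
  lowered = solve-∀
  ι-M : ι M ≡ 0ℤ
  ι-M = refl
  ι-2-M : ι (+ 2 - M) ≡ 0ℤ
  ι-2-M rewrite ℕₚ.+-comm m 3 = refl
  isolate : ∀ a b p → a + b ≡ p → b ≡ p - a
  isolate a b p e = trans (rearrange a b) (cong (_- a) e)
    where
    rearrange : ∀ a b → b ≡ a + b - a
    rearrange = solve-∀

-- Each use of Dyson's relation raises the rank bound by 3, so the sizes drop by an arithmetic
-- progression and the exponents become quadratic in k.
pentagonal-expansion : ∀ e₀ n → ∀ (K : ℕ) {m} → Qℤ (+ suc m) (+ n - + e₀) ≡
  sum K (λ k → sgn k * Pℤ (+ n - + quadratic e₀ (m ℕ.+ 3) 3 k)) + sgn K * Qℤ (+ suc (m ℕ.+ K ℕ.* 3)) (+ n - + quadratic e₀ (m ℕ.+ 3) 3 K)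
pentagonal-expansion e₀ n K {m} = trans (cong (λ k → Qℤ (+ suc k) (+ n - + e₀)) (sym (ℕₚ.+-identityʳ m)))
  (alternating (λ k → Qℤ (+ suc (m ℕ.+ k ℕ.* 3)) (+ n - + quadratic e₀ (m ℕ.+ 3) 3 k)) (λ k → Pℤ (+ n - + quadratic e₀ (m ℕ.+ 3) 3 k))
    (λ k → trans (dyson-iterate (m ℕ.+ k ℕ.* 3) (quadratic e₀ (m ℕ.+ 3) 3 k) (+ n))
      (cong₂ (λ a b → Pℤ (+ n - + quadratic e₀ (m ℕ.+ 3) 3 k) - Qℤ (+ suc a) (+ n - + (quadratic e₀ (m ℕ.+ 3) 3 k ℕ.+ b))) (assoc₁ k) (assoc₂ k))) K)
  where
  assoc₁ : ∀ k → m ℕ.+ k ℕ.* 3 ℕ.+ 3 ≡ m ℕ.+ (3 ℕ.+ k ℕ.* 3)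
  assoc₁ k = trans (ℕₚ.+-assoc m (k ℕ.* 3) 3) (cong (m ℕ.+_) (ℕₚ.+-comm (k ℕ.* 3) 3))
  assoc₂ : ∀ k → m ℕ.+ k ℕ.* 3 ℕ.+ 3 ≡ m ℕ.+ 3 ℕ.+ k ℕ.* 3
  assoc₂ k = trans (assoc₁ k) (sym (ℕₚ.+-assoc m 3 (k ℕ.* 3)))

ext-negative : ∀ x {z k} → z ≡ -[1+ k ] → ext x z ≡ 0ℤ
ext-negative x refl = refl

-- The two halves of the pentagonal series are the expansions of Q at rank bounds 3 and 2. Dyson's
-- relation turns these into Q at 0 and at -1, which add up to P by symmetry; the exceptional term
-- at m = 2 leaves the constant 1.
P∙Euler : ∀ n → (P ∙ Euler) n ≡ 𝟙 n
P∙Euler n = trans (∙-comm P Euler n) (begin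
  (Euler ∙ P) n ≡⟨ ∙-distribʳ-⊕ P (lacunary pentagonal⁺ sgn) (lacunary pentagonal⁻ (λ k → - sgn k)) n ⟩
  (lacunary pentagonal⁺ sgn ∙ P) n + (lacunary pentagonal⁻ (λ k → - sgn k) ∙ P) n
    ≡⟨ cong₂ _+_ (lacunary-∙ pentagonal⁺ sgn (quadratic-≥ 0 1 3) P n) (lacunary-∙ pentagonal⁻ (λ k → - sgn k) (quadratic-≥ 1 3 3) P n) ⟩
  sum (suc n) (λ k → sgn k * Pℤ (+ n - + pentagonal⁺ k)) + sum (suc n) (λ k → - sgn k * Pℤ (+ n - + pentagonal⁻ k))
    ≡⟨ cong₂ _+_ plus minus ⟩
  (P n - Qℤ (+ 3) (+ n - + 2)) + - Qℤ (+ 2) (+ n - + 1) ≡⟨ combine (Q (+ 0) n) (Qℤ (+ 3) (+ n - + 2)) (Qℤ (+ 2) (+ n - + 1)) (Q -[1+ 0 ] n) (P n) (𝟙 n) three two (defect≡0 (+ 0) (+ n)) ⟩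
  𝟙 n ∎)
  where
  open ≡-Reasoning
  remainder : ∀ e a x → ext x (+ n - + quadratic e (suc a) 3 (suc n)) ≡ 0ℤ
  remainder e a x = ext-negative x (proj₂ (sub-< (quadratic-≥ e a 3 (suc n))))
  minus : sum (suc n) (λ k → - sgn k * Pℤ (+ n - + pentagonal⁻ k)) ≡ - Qℤ (+ 2) (+ n - + 1)
  minus = begin
    sum (suc n) (λ k → - sgn k * Pℤ (+ n - + pentagonal⁻ k)) ≡⟨ sum-cong (suc n) (λ k _ → pull (sgn k) (Pℤ (+ n - + pentagonal⁻ k))) ⟩
    sum (suc n) (λ k → - 1ℤ * (sgn k * Pℤ (+ n - + pentagonal⁻ k))) ≡⟨ sum-* (suc n) (- 1ℤ) (λ k → sgn k * Pℤ (+ n - + pentagonal⁻ k)) ⟩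
    - 1ℤ * s ≡⟨ negate s (sgn (suc n)) ⟩
    - (s + sgn (suc n) * 0ℤ) ≡⟨ cong (λ x → - (s + sgn (suc n) * x)) (sym (remainder 1 3 (Q (+ suc (1 ℕ.+ suc n ℕ.* 3))))) ⟩
    - (s + sgn (suc n) * Qℤ (+ suc (1 ℕ.+ suc n ℕ.* 3)) (+ n - + pentagonal⁻ (suc n))) ≡⟨ cong -_ (sym (pentagonal-expansion 1 n (suc n) {1})) ⟩
    - Qℤ (+ 2) (+ n - + 1) ∎
    where
    s = sum (suc n) (λ k → sgn k * Pℤ (+ n - + pentagonal⁻ k))
    pull : ∀ a b → - a * b ≡ - 1ℤ * (a * b)
    pull = solve-∀
    negate : ∀ s g → - 1ℤ * s ≡ - (s + g * 0ℤ)
    negate = solve-∀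
  pentagonal⁺-suc : ∀ k → pentagonal⁺ (suc k) ≡ quadratic 2 5 3 k
  pentagonal⁺-suc zero = refl
  pentagonal⁺-suc (suc k) = cong (ℕ._+ (5 ℕ.+ k ℕ.* 3)) (pentagonal⁺-suc k)
  plus : sum (suc n) (λ k → sgn k * Pℤ (+ n - + pentagonal⁺ k)) ≡ P n - Qℤ (+ 3) (+ n - + 2)
  plus = begin
    sum (suc n) (λ k → sgn k * Pℤ (+ n - + pentagonal⁺ k)) ≡⟨ sum-first n (λ k → sgn k * Pℤ (+ n - + pentagonal⁺ k)) ⟩
    1ℤ * Pℤ (+ n - 0ℤ) + sum n (λ k → - sgn k * Pℤ (+ n - + pentagonal⁺ (suc k))) ≡⟨ cong₂ _+_ (trans (ℤₚ.*-identityˡ _) (cong Pℤ (ℤₚ.+-identityʳ (+ n)))) tail-part ⟩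
    P n - Qℤ (+ 3) (+ n - + 2) ∎
    where
    s = sum n (λ k → sgn k * Pℤ (+ n - + quadratic 2 5 3 k))
    pull : ∀ a b → - a * b ≡ - 1ℤ * (a * b)
    pull = solve-∀
    negate : ∀ s g → - 1ℤ * s ≡ - (s + g * 0ℤ)
    negate = solve-∀
    tail-part : sum n (λ k → - sgn k * Pℤ (+ n - + pentagonal⁺ (suc k))) ≡ - Qℤ (+ 3) (+ n - + 2)
    tail-part = begin
      sum n (λ k → - sgn k * Pℤ (+ n - + pentagonal⁺ (suc k))) ≡⟨ sum-cong n (λ k _ → trans (cong (λ e → - sgn k * Pℤ (+ n - + e)) (pentagonal⁺-suc k)) (pull (sgn k) (Pℤ (+ n - + quadratic 2 5 3 k)))) ⟩
      sum n (λ k → - 1ℤ * (sgn k * Pℤ (+ n - + quadratic 2 5 3 k))) ≡⟨ sum-* n (- 1ℤ) (λ k → sgn k * Pℤ (+ n - + quadratic 2 5 3 k)) ⟩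
      - 1ℤ * s ≡⟨ negate s (sgn n) ⟩
      - (s + sgn n * 0ℤ) ≡⟨ cong (λ x → - (s + sgn n * x)) (sym (trans (cong (λ e → Qℤ (+ suc (2 ℕ.+ n ℕ.* 3)) (+ n - + e)) (sym (pentagonal⁺-suc n))) (remainder 0 1 (Q (+ suc (2 ℕ.+ n ℕ.* 3)))))) ⟩
      - (s + sgn n * Qℤ (+ suc (2 ℕ.+ n ℕ.* 3)) (+ n - + quadratic 2 5 3 n)) ≡⟨ cong -_ (sym (pentagonal-expansion 2 n n {2})) ⟩
      - Qℤ (+ 3) (+ n - + 2) ∎
  three : Qℤ (+ 3) (+ n - + 2) + Q (+ 0) n ≡ P n
  three = trans (cong (λ x → Qℤ (+ 3) x + Q (+ 0) n) (regroup (+ n))) (trans (dyson (+ 3) (+ n)) (ℤₚ.+-identityʳ (P n)))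
    where
    regroup : ∀ n → n - + 2 ≡ n - + 3 + 1ℤ
    regroup = solve-∀
  two : Qℤ (+ 2) (+ n - + 1) + Q -[1+ 0 ] n ≡ P n - 𝟙 n
  two = trans (cong (λ x → Qℤ (+ 2) x + Q -[1+ 0 ] n) (regroup (+ n))) (trans (dyson (+ 2) (+ n)) (cong (_+_ (P n)) (simplify (κ (+ n - + 2 + 1ℤ)) (𝟙 n))))
    where
    regroup : ∀ n → n - + 1 ≡ n - + 2 + 1ℤ
    regroup = solve-∀
    simplify : ∀ a b → 0ℤ * a - 1ℤ * b ≡ - b
    simplify = solve-∀
  combine : ∀ q₀ q₃ q₂ q₋ p k → q₃ + q₀ ≡ p → q₂ + q₋ ≡ p - k → q₀ + q₋ - p ≡ 0ℤ → p - q₃ + - q₂ ≡ k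
  combine q₀ q₃ q₂ q₋ p k e f g = trans (expand q₀ q₃ q₂ q₋ p) (trans (cong₂ (λ x y → (p - x) + (p - y) + (q₀ + q₋ - p)) e f) (trans (cong (_+_ (p - p + (p - (p - k)))) g) (collect p k)))
    where
    expand : ∀ q₀ q₃ q₂ q₋ p → p - q₃ + - q₂ ≡ (p - (q₃ + q₀)) + (p - (q₂ + q₋)) + (q₀ + q₋ - p)
    expand = solve-∀
    collect : ∀ p k → p - p + (p - (p - k)) + 0ℤ ≡ k
    collect = solve-∀

-- The theta function J annihilates quadratic polynomials in m

Array : Set
Array = ℤ → ℤ → ℤ

Vanishing : Array → Set
Vanishing X = ∀ m k → X m -[1+ k ] ≡ 0ℤ

infix 4 _≗_

_≗_ : Array → Array → Set
X ≗ Y = ∀ m n → X m n ≡ Y m n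

term : Array → ℤ → ℤ → ℕ → ℤ
term X m n k = sgn k * (X (m + + k) (n - + triangular k) - X (m - + suc k) (n - + triangular k))

triangular-beyond : ∀ n k → suc ℤ.∣ n ∣ ℕ.≤ k → ∃ λ i → n - + triangular k ≡ -[1+ i ]
triangular-beyond (+ n) k n<k = sub-< (ℕₚ.≤-trans n<k (quadratic-≥ 0 0 1 k))
triangular-beyond -[1+ n ] k _ = negative-sub n (triangular k)

Vanishing-at : ∀ {X} → Vanishing X → ∀ m {n k} → n ≡ -[1+ k ] → X m n ≡ 0ℤ
Vanishing-at v m refl = v m _

abstract

  -- The generating function of J is Σ (-1)ⁱ zⁱ q^{i(i-1)/2}, with the terms i = -k and i = k + 1 paired.
  J : Array → Array
  J X m n = sum (suc ℤ.∣ n ∣) (term X m n)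

  J-def : ∀ X m n → J X m n ≡ sum (suc ℤ.∣ n ∣) (term X m n)
  J-def X m n = refl

  J-extend : ∀ {X} → Vanishing X → ∀ m n B → suc ℤ.∣ n ∣ ℕ.≤ B → sum B (term X m n) ≡ J X m n
  J-extend {X} v m n B n<B = sum-truncate (term X m n) n<B λ k n<k →
    trans (cong (sgn k *_) (cong₂ _-_ (Vanishing-at {X} v _ (proj₂ (triangular-beyond n k n<k))) (Vanishing-at {X} v _ (proj₂ (triangular-beyond n k n<k))))) (ℤₚ.*-zeroʳ (sgn k))

  J-vanishing : ∀ {X} → Vanishing X → Vanishing (J X)
  J-vanishing {X} v m k = sum-0 (suc (suc k)) λ i _ →
    trans (cong (sgn i *_) (cong₂ _-_ (Vanishing-at {X} v _ (proj₂ (negative-sub k (triangular i)))) (Vanishing-at {X} v _ (proj₂ (negative-sub k (triangular i)))))) (ℤₚ.*-zeroʳ (sgn i))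

  J-cong : ∀ {X Y} → X ≗ Y → J X ≗ J Y
  J-cong e m n = sum-cong (suc ℤ.∣ n ∣) (λ k _ → cong (sgn k *_) (cong₂ _-_ (e _ _) (e _ _)))

  J-+ : ∀ X Y → J (λ m n → X m n + Y m n) ≗ (λ m n → J X m n + J Y m n)
  J-+ X Y m n = trans (sum-cong (suc ℤ.∣ n ∣) (λ k _ → distribute (sgn k) (X (m + + k) (n - + triangular k)) (Y (m + + k) (n - + triangular k)) (X (m - + suc k) (n - + triangular k)) (Y (m - + suc k) (n - + triangular k)))) (sum-+ (suc ℤ.∣ n ∣) (term X m n) (term Y m n))
    where
    distribute : ∀ s a b c d → s * (a + b - (c + d)) ≡ s * (a - c) + s * (b - d)
    distribute = solve-∀

  J-neg : ∀ X → J (λ m n → - X m n) ≗ (λ m n → - J X m n)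
  J-neg X m n = trans (sum-cong (suc ℤ.∣ n ∣) (λ k _ → distribute (sgn k) (X (m + + k) (n - + triangular k)) (X (m - + suc k) (n - + triangular k)))) (trans (sum-* (suc ℤ.∣ n ∣) (- 1ℤ) (term X m n)) (ℤₚ.-1*i≡-i (J X m n)))
    where
    distribute : ∀ s a c → s * (- a - - c) ≡ - 1ℤ * (s * (a - c))
    distribute = solve-∀

  J-translate : ∀ c X → J (λ m n → X (m - c) n) ≗ (λ m n → J X (m - c) n)
  J-translate c X m n = sum-cong (suc ℤ.∣ n ∣) (λ k _ → cong (sgn k *_) (cong₂ (λ a b → X a (n - + triangular k) - X b (n - + triangular k)) (commute m (+ k) c) (commute m (- + suc k) c)))
    where
    commute : ∀ m k c → m + k - c ≡ m - c + k
    commute = solve-∀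

-- On generating functions: z is replaced by zq, followed by division by q.
S : Array → Array
S X m n = X m (n - m + 1ℤ)

triangular-suc : ∀ k → + triangular (suc k) ≡ + triangular k + (1ℤ + + k)
triangular-suc k = trans (ℤₚ.pos-+ (triangular k) (suc (k ℕ.* 1))) (cong (_+_ (+ triangular k)) (trans (cong (λ j → + suc j) (ℕₚ.*-identityʳ k)) (ℤₚ.pos-+ 1 k)))

-- The quasi-periodicity j(zq) = -j(z)/z of the theta function.
J-S : ∀ {X} → Vanishing X → Vanishing (S X) → ∀ m n → J (S X) m n ≡ - S (J X) (m - 1ℤ) n
J-S {X} v vS m n = begin
  J (S X) m n ≡⟨ sym (J-extend {S X} vS m n (suc C) (s≤s (ℕₚ.≤-trans (ℕₚ.m≤m+n ℤ.∣ n ∣ ℤ.∣ N′ ∣) (ℕₚ.n≤1+n _)))) ⟩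
  sum (suc C) (term (S X) m n) ≡⟨ sum-cong (suc C) (λ k _ → cong (sgn k *_) (cong₂ _-_ (left k) (right k))) ⟩
  sum (suc C) (λ k → sgn k * (α (suc k) - β k)) ≡⟨ regroup-sum ⟩
  - sum (suc C) (λ k → sgn k * (α k - β (suc k))) ≡⟨ cong -_ (sum-cong (suc C) (λ k _ → cong (λ x → sgn k * (α k - x)) (β-suc k))) ⟩
  - sum (suc C) (term X (m - 1ℤ) N′) ≡⟨ cong -_ (J-extend {X} v (m - 1ℤ) N′ (suc C) (s≤s (ℕₚ.≤-trans (ℕₚ.m≤n+m ℤ.∣ N′ ∣ ℤ.∣ n ∣) (ℕₚ.n≤1+n _)))) ⟩
  - J X (m - 1ℤ) N′ ∎
  where
  open ≡-Reasoning
  N′ : ℤ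
  N′ = n - (m - 1ℤ) + 1ℤ
  -- Beyond both truncation points, that of n and that of the shifted exponent `N′`.
  C : ℕ
  C = suc (ℤ.∣ n ∣ ℕ.+ ℤ.∣ N′ ∣)
  α β : ℕ → ℤ
  α k = X (m - 1ℤ + + k) (N′ - + triangular k)
  β k = X (m - 1ℤ - + k) (N′ - (+ triangular k - + k))
  left : ∀ k → S X (m + + k) (n - + triangular k) ≡ α (suc k)
  left k = cong₂ X (trans (index m (+ k)) (cong (_+_ (m - 1ℤ)) (sym (ℤₚ.pos-+ 1 k)))) (trans (exponent n m (+ k) (+ triangular k)) (cong (_-_ N′) (sym (triangular-suc k))))
    where
    index : ∀ m k → m + k ≡ m - 1ℤ + (1ℤ + k)
    index = solve-∀
    exponent : ∀ n m k t → n - t - (m + k) + 1ℤ ≡ n - (m - 1ℤ) + 1ℤ - (t + (1ℤ + k))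
    exponent = solve-∀
  right : ∀ k → S X (m - + suc k) (n - + triangular k) ≡ β k
  right k = cong₂ X (trans (cong (_-_ m) (ℤₚ.pos-+ 1 k)) (index m (+ k))) (trans (cong (λ x → n - + triangular k - (m - x) + 1ℤ) (ℤₚ.pos-+ 1 k)) (exponent n m (+ k) (+ triangular k)))
    where
    index : ∀ m k → m - (1ℤ + k) ≡ m - 1ℤ - k
    index = solve-∀
    exponent : ∀ n m k t → n - t - (m - (1ℤ + k)) + 1ℤ ≡ n - (m - 1ℤ) + 1ℤ - (t - k)
    exponent = solve-∀
  β-suc : ∀ k → β (suc k) ≡ X (m - 1ℤ - + suc k) (N′ - + triangular k)
  β-suc k = cong (λ x → X (m - 1ℤ - + suc k) (N′ - x)) (trans (cong₂ _-_ (triangular-suc k) (ℤₚ.pos-+ 1 k)) (cancel (+ triangular k) (1ℤ + + k)))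
    where
    cancel : ∀ t k → t + k - k ≡ t
    cancel = solve-∀
  beyond : ∀ k → C ℕ.≤ k → suc ℤ.∣ N′ ∣ ℕ.≤ k
  beyond k C≤k = ℕₚ.≤-trans (s≤s (ℕₚ.m≤n+m ℤ.∣ N′ ∣ ℤ.∣ n ∣)) C≤k
  α-last : α (suc C) ≡ 0ℤ
  α-last = Vanishing-at {X} v _ (proj₂ (triangular-beyond N′ (suc C) (beyond (suc C) (ℕₚ.n≤1+n C))))
  β-last : β (suc C) ≡ 0ℤ
  β-last = trans (β-suc C) (Vanishing-at {X} v _ (proj₂ (triangular-beyond N′ C (beyond C ℕₚ.≤-refl))))
  -- The substitution moves the two-sided sum by one index, so its terms must be paired anew. The
  -- boundary terms disappear because α 0 = β 0 and both final terms lie beyond the support.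
  regroup-sum : sum (suc C) (λ k → sgn k * (α (suc k) - β k)) ≡ - sum (suc C) (λ k → sgn k * (α k - β (suc k)))
  regroup-sum = trans (telescope (suc C)) (trans (cong₂ (λ a b → - sum (suc C) (λ k → sgn k * (α k - β (suc k))) + (α 0 - β 0) - sgn (suc C) * (a - b)) α-last β-last)
    (simplify (sum (suc C) (λ k → sgn k * (α k - β (suc k)))) (α 0) (sgn (suc C))))
    where
    simplify : ∀ s a g → - s + (a - a) - g * (0ℤ - 0ℤ) ≡ - s
    simplify = solve-∀
    telescope : ∀ K → sum K (λ k → sgn k * (α (suc k) - β k)) ≡ - sum K (λ k → sgn k * (α k - β (suc k))) + (α 0 - β 0) - sgn K * (α K - β K)
    telescope zero = base (α 0) (β 0)
      where
      base : ∀ a b → 0ℤ ≡ - 0ℤ + (a - b) - 1ℤ * (a - b)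
      base = solve-∀
    telescope (suc K) = trans (cong (_+ sgn K * (α (suc K) - β K)) (telescope K)) (step (sum K (λ k → sgn k * (α k - β (suc k)))) (α 0 - β 0) (sgn K) (α K) (β K) (α (suc K)) (β (suc K)))
      where
      step : ∀ s c g a b a′ b′ → - s + c - g * (a - b) + g * (a′ - b) ≡ - (s + g * (a - b′)) + c - - g * (a′ - b′)
      step = solve-∀

quadratic-array : (ℤ → ℤ) → (ℤ → ℤ) → (ℤ → ℤ) → Array
quadratic-array a b c m n = a n + m * b n + m * m * c n

odd-theta : (ℤ → ℤ) → ℤ → ℤ
odd-theta x n = sum (suc ℤ.∣ n ∣) (λ k → sgn k * (1ℤ + + k + + k) * x (n - + triangular k))

abstract

  -- Since the theta function vanishes at z = 1, J lowers the degree in m by one. The series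
  -- `odd-theta` is its derivative there up to sign, the paired terms being 2k + 1 apart in m.
  J-quadratic : ∀ a b c → J (quadratic-array a b c) ≗ quadratic-array (λ n → odd-theta b n - odd-theta c n) (λ n → odd-theta c n + odd-theta c n) (λ _ → 0ℤ)
  J-quadratic a b c m n = begin
    J (quadratic-array a b c) m n ≡⟨ sum-cong (suc ℤ.∣ n ∣) (λ k _ → trans (cong (λ x → sgn k * (quadratic-array a b c (m + + k) (n - + triangular k) - quadratic-array a b c (m - x) (n - + triangular k))) (ℤₚ.pos-+ 1 k))
        (expand (sgn k) m (+ k) (a (n - + triangular k)) (b (n - + triangular k)) (c (n - + triangular k)))) ⟩
    sum (suc ℤ.∣ n ∣) (λ k → tb k + (m + m - 1ℤ) * tc k) ≡⟨ sum-+ (suc ℤ.∣ n ∣) tb (λ k → (m + m - 1ℤ) * tc k) ⟩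
    odd-theta b n + sum (suc ℤ.∣ n ∣) (λ k → (m + m - 1ℤ) * tc k) ≡⟨ cong (_+_ (odd-theta b n)) (sum-* (suc ℤ.∣ n ∣) (m + m - 1ℤ) tc) ⟩
    odd-theta b n + (m + m - 1ℤ) * odd-theta c n ≡⟨ collect m (odd-theta b n) (odd-theta c n) ⟩
    quadratic-array (λ n → odd-theta b n - odd-theta c n) (λ n → odd-theta c n + odd-theta c n) (λ _ → 0ℤ) m n ∎
    where
    open ≡-Reasoning
    tb tc : ℕ → ℤ
    tb k = sgn k * (1ℤ + + k + + k) * b (n - + triangular k)
    tc k = sgn k * (1ℤ + + k + + k) * c (n - + triangular k)
    expand : ∀ s m k a b c → s * (a + (m + k) * b + (m + k) * (m + k) * c - (a + (m - (1ℤ + k)) * b + (m - (1ℤ + k)) * (m - (1ℤ + k)) * c))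
      ≡ s * (1ℤ + k + k) * b + (m + m - 1ℤ) * (s * (1ℤ + k + k) * c)
    expand = solve-∀
    collect : ∀ m b c → b + (m + m - 1ℤ) * c ≡ b - c + m * (c + c) + m * m * 0ℤ
    collect = solve-∀

odd-theta-0 : ∀ n → odd-theta (λ _ → 0ℤ) n ≡ 0ℤ
odd-theta-0 n = sum-0 (suc ℤ.∣ n ∣) (λ k _ → ℤₚ.*-zeroʳ (sgn k * (1ℤ + + k + + k)))

J³-quadratic : ∀ a b c m n → J (J (J (quadratic-array a b c))) m n ≡ 0ℤ
J³-quadratic a b c m n = begin
  J (J (J (quadratic-array a b c))) m n ≡⟨ J-cong (J-cong (J-quadratic a b c)) m n ⟩
  J (J (quadratic-array a₁ b₁ (λ _ → 0ℤ))) m n ≡⟨ J-cong (λ m n → trans (J-quadratic a₁ b₁ (λ _ → 0ℤ) m n) (simplify m n)) m n ⟩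
  J (quadratic-array (odd-theta b₁) (λ _ → 0ℤ) (λ _ → 0ℤ)) m n ≡⟨ J-quadratic (odd-theta b₁) (λ _ → 0ℤ) (λ _ → 0ℤ) m n ⟩
  odd-theta (λ _ → 0ℤ) n - odd-theta (λ _ → 0ℤ) n + m * (odd-theta (λ _ → 0ℤ) n + odd-theta (λ _ → 0ℤ) n) + m * m * 0ℤ ≡⟨ cong (λ x → x - x + m * (x + x) + m * m * 0ℤ) (odd-theta-0 n) ⟩
  0ℤ - 0ℤ + m * (0ℤ + 0ℤ) + m * m * 0ℤ ≡⟨ zeros m ⟩
  0ℤ ∎
  where
  open ≡-Reasoning
  a₁ b₁ : ℤ → ℤ
  a₁ n = odd-theta b n - odd-theta c n
  b₁ n = odd-theta c n + odd-theta c n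
  simplify : ∀ m n → odd-theta b₁ n - odd-theta (λ _ → 0ℤ) n + m * (odd-theta (λ _ → 0ℤ) n + odd-theta (λ _ → 0ℤ) n) + m * m * 0ℤ ≡ odd-theta b₁ n + m * 0ℤ + m * m * 0ℤ
  simplify m n = trans (cong (λ x → odd-theta b₁ n - x + m * (x + x) + m * m * 0ℤ) (odd-theta-0 n)) (tidy m (odd-theta b₁ n))
    where
    tidy : ∀ m b → b - 0ℤ + m * (0ℤ + 0ℤ) + m * m * 0ℤ ≡ b + m * 0ℤ + m * m * 0ℤ
    tidy = solve-∀
  zeros : ∀ m → 0ℤ - 0ℤ + m * (0ℤ + 0ℤ) + m * m * 0ℤ ≡ 0ℤ
  zeros = solve-∀

-- The weight m (m + 1) + 6 n is invariant under Dyson's adjoint and vanishes at its exceptional terms.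
weight : ℤ → ℤ → ℤ
weight m n = m * (m + 1ℤ) + + 6 * n

G : Array
G m n = weight m n * Qℤ m n

ι-cases : ∀ x → ι x ≡ 0ℤ ⊎ x ≡ 0ℤ
ι-cases (+ zero) = inj₂ refl
ι-cases (+ suc n) = inj₁ refl
ι-cases -[1+ n ] = inj₁ refl

κ-cases : ∀ x → κ x ≡ 0ℤ ⊎ x ≡ 0ℤ
κ-cases (+ zero) = inj₂ refl
κ-cases (+ suc n) = inj₁ refl
κ-cases -[1+ n ] = inj₁ refl

weighted-exception : ∀ w x y → (x ≡ 0ℤ → y ≡ 0ℤ → w ≡ 0ℤ) → w * (ι x * κ y) ≡ 0ℤ
weighted-exception w x y h with ι-cases x | κ-cases y
... | inj₁ e | _ = trans (cong (λ t → w * (t * κ y)) e) (ℤₚ.*-zeroʳ w)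
... | inj₂ _ | inj₁ e = trans (cong (λ t → w * (ι x * t)) e) (trans (cong (w *_) (ℤₚ.*-zeroʳ (ι x))) (ℤₚ.*-zeroʳ w))
... | inj₂ e | inj₂ f = cong (_* (ι x * κ y)) (h e f)

weighted-dyson : ∀ m n → S G m n + G (m - + 3) n ≡ quadratic-array (λ n → + 6 * (1ℤ + n) * Pℤ n) (λ n → - + 5 * Pℤ n) Pℤ m n
weighted-dyson m n = begin
  weight m (n - m + 1ℤ) * Qℤ m (n - m + 1ℤ) + weight (m - + 3) n * Qℤ (m - + 3) n ≡⟨ cong (λ x → x * Qℤ m (n - m + 1ℤ) + weight (m - + 3) n * Qℤ (m - + 3) n) (invariance m n) ⟩
  w * Qℤ m (n - m + 1ℤ) + w * Qℤ (m - + 3) n ≡⟨ sym (ℤₚ.*-distribˡ-+ w (Qℤ m (n - m + 1ℤ)) (Qℤ (m - + 3) n)) ⟩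
  w * (Qℤ m (n - m + 1ℤ) + Qℤ (m - + 3) n) ≡⟨ cong (w *_) (dyson m n) ⟩
  w * (Pℤ n + (ι m * κ (n - m + 1ℤ) - ι (+ 2 - m) * κ n)) ≡⟨ distribute w (Pℤ n) (ι m * κ (n - m + 1ℤ)) (ι (+ 2 - m) * κ n) ⟩
  w * Pℤ n + (w * (ι m * κ (n - m + 1ℤ)) - w * (ι (+ 2 - m) * κ n)) ≡⟨ cong₂ (λ x y → w * Pℤ n + (x - y)) (weighted-exception w m (n - m + 1ℤ) first) (weighted-exception w (+ 2 - m) n second) ⟩
  w * Pℤ n + (0ℤ - 0ℤ) ≡⟨ expand m n (Pℤ n) ⟩
  quadratic-array (λ n → + 6 * (1ℤ + n) * Pℤ n) (λ n → - + 5 * Pℤ n) Pℤ m n ∎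
  where
  open ≡-Reasoning
  w = weight (m - + 3) n
  invariance : ∀ m n → m * (m + 1ℤ) + + 6 * (n - m + 1ℤ) ≡ (m - + 3) * (m - + 3 + 1ℤ) + + 6 * n
  invariance = solve-∀
  distribute : ∀ w p x y → w * (p + (x - y)) ≡ w * p + (w * x - w * y)
  distribute = solve-∀
  expand : ∀ m n p → ((m - + 3) * (m - + 3 + 1ℤ) + + 6 * n) * p + (0ℤ - 0ℤ) ≡ + 6 * (1ℤ + n) * p + m * (- + 5 * p) + m * m * p
  expand = solve-∀
  first : m ≡ 0ℤ → n - m + 1ℤ ≡ 0ℤ → w ≡ 0ℤ
  first e f = trans (factor m n) (trans (cong₂ (λ x y → x * (x + 1ℤ) + + 6 * y) e f) refl)
    where
    factor : ∀ m n → (m - + 3) * (m - + 3 + 1ℤ) + + 6 * n ≡ m * (m + 1ℤ) + + 6 * (n - m + 1ℤ)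
    factor = solve-∀
  second : + 2 - m ≡ 0ℤ → n ≡ 0ℤ → w ≡ 0ℤ
  second e f = trans (factor m n) (cong₂ (λ x y → x * (1ℤ + x) + + 6 * y) e f)
    where
    factor : ∀ m n → (m - + 3) * (m - + 3 + 1ℤ) + + 6 * n ≡ (+ 2 - m) * (1ℤ + (+ 2 - m)) + + 6 * n
    factor = solve-∀

K : Array
K = J (J (J G))

G-vanishing : Vanishing G
G-vanishing m k = ℤₚ.*-zeroʳ (weight m -[1+ k ])

-- The shifted size may be positive although n is negative. Combinatorially, ranks of partitions of
-- N are at least 1 - N; formally, every other term of `weighted-dyson` vanishes there.
SG-vanishing : Vanishing (S G)
SG-vanishing m k = trans (isolate (S G m -[1+ k ]) (G (m - + 3) -[1+ k ])) (trans (cong₂ _-_ (weighted-dyson m -[1+ k ]) (G-vanishing (m - + 3) k)) (zeros m (+ 6 * (1ℤ + -[1+ k ]))))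
  where
  isolate : ∀ a b → a ≡ a + b - b
  isolate = solve-∀
  zeros : ∀ m c → c * 0ℤ + m * (- + 5 * 0ℤ) + m * m * 0ℤ - 0ℤ ≡ 0ℤ
  zeros = solve-∀

-- Quasi-periodicity read backwards: `S (J X)` is, up to sign and a translation in m, `J (S X)`.
SJ-vanishing : ∀ {X} → Vanishing X → Vanishing (S X) → Vanishing (S (J X))
SJ-vanishing {X} v vS m k = begin
  S (J X) m -[1+ k ] ≡⟨ cong (λ x → S (J X) x -[1+ k ]) (shift-index m) ⟩
  S (J X) (m + 1ℤ - 1ℤ) -[1+ k ] ≡⟨ sym (ℤₚ.neg-involutive (S (J X) (m + 1ℤ - 1ℤ) -[1+ k ])) ⟩
  - - S (J X) (m + 1ℤ - 1ℤ) -[1+ k ] ≡⟨ cong -_ (sym (J-S {X} v vS (m + 1ℤ) -[1+ k ])) ⟩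
  - J (S X) (m + 1ℤ) -[1+ k ] ≡⟨ cong -_ (J-vanishing {S X} vS (m + 1ℤ) k) ⟩
  0ℤ ∎
  where
  open ≡-Reasoning
  shift-index : ∀ m → m ≡ m + 1ℤ - 1ℤ
  shift-index = solve-∀

-- J³ kills the quadratic right side. Each passage of J through S contributes -1/z, and three of
-- these match the shift by 3 and the sign.
K-invariant : ∀ m n → K m n ≡ S K m n
K-invariant m n = begin
  K m n ≡⟨ cong (λ x → K x n) (up m) ⟩
  K (m + + 3 - + 3) n ≡⟨ isolate (J (J (J (S G))) (m + + 3) n) (K (m + + 3 - + 3) n) (trans (sym (total-J (m + + 3) n)) (J³-quadratic (λ n → + 6 * (1ℤ + n) * Pℤ n) (λ n → - + 5 * Pℤ n) Pℤ (m + + 3) n)) ⟩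
  - J (J (J (S G))) (m + + 3) n ≡⟨ cong -_ (J³S (m + + 3) n) ⟩
  - - S K (m + + 3 - 1ℤ - 1ℤ - 1ℤ) n ≡⟨ ℤₚ.neg-involutive _ ⟩
  S K (m + + 3 - 1ℤ - 1ℤ - 1ℤ) n ≡⟨ cong (λ x → S K x n) (sym (down m)) ⟩
  S K m n ∎
  where
  open ≡-Reasoning
  up : ∀ m → m ≡ m + + 3 - + 3
  up = solve-∀
  down : ∀ m → m ≡ m + + 3 - 1ℤ - 1ℤ - 1ℤ
  down = solve-∀
  isolate : ∀ a b → a + b ≡ 0ℤ → b ≡ - a
  isolate a b e = trans (rearrange a b) (trans (cong (_- a) e) (ℤₚ.+-identityˡ (- a)))
    where
    rearrange : ∀ a b → b ≡ a + b - a
    rearrange = solve-∀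
  JS₁ : ∀ m n → J (S G) m n ≡ - S (J G) (m - 1ℤ) n
  JS₁ = J-S {G} G-vanishing SG-vanishing
  v₁ = J-vanishing {G} G-vanishing
  vS₁ = SJ-vanishing {G} G-vanishing SG-vanishing
  JS₂ : ∀ m n → J (S (J G)) m n ≡ - S (J (J G)) (m - 1ℤ) n
  JS₂ = J-S {J G} v₁ vS₁
  JS₃ : ∀ m n → J (S (J (J G))) m n ≡ - S K (m - 1ℤ) n
  JS₃ = J-S {J (J G)} (J-vanishing {J G} v₁) (SJ-vanishing {J G} v₁ vS₁)
  J-neg-translate : ∀ X m n → J (λ m n → - X (m - 1ℤ) n) m n ≡ - J X (m - 1ℤ) n
  J-neg-translate X m n = trans (J-neg (λ m n → X (m - 1ℤ) n) m n) (cong -_ (J-translate 1ℤ X m n))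
  J²S : ∀ m n → J (J (S G)) m n ≡ S (J (J G)) (m - 1ℤ - 1ℤ) n
  J²S m n = trans (J-cong JS₁ m n) (trans (J-neg-translate (S (J G)) m n) (trans (cong -_ (JS₂ (m - 1ℤ) n)) (ℤₚ.neg-involutive _)))
  J³S : ∀ m n → J (J (J (S G))) m n ≡ - S K (m - 1ℤ - 1ℤ - 1ℤ) n
  J³S m n = trans (J-cong J²S m n) (trans (J-translate 1ℤ (λ m n → S (J (J G)) (m - 1ℤ) n) m n) (trans (J-translate 1ℤ (S (J (J G))) (m - 1ℤ) n) (JS₃ (m - 1ℤ - 1ℤ) n)))
  total-J : ∀ m n → J (J (J (quadratic-array (λ n → + 6 * (1ℤ + n) * Pℤ n) (λ n → - + 5 * Pℤ n) Pℤ))) m n ≡ J (J (J (S G))) m n + K (m - + 3) n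
  total-J m n = begin
    J (J (J (quadratic-array (λ n → + 6 * (1ℤ + n) * Pℤ n) (λ n → - + 5 * Pℤ n) Pℤ))) m n ≡⟨ J-cong (J-cong (J-cong (λ m n → sym (weighted-dyson m n)))) m n ⟩
    J (J (J (λ m n → S G m n + G (m - + 3) n))) m n ≡⟨ J-cong (J-cong (λ m n → trans (J-+ (S G) (λ m n → G (m - + 3) n) m n) (cong (_+_ (J (S G) m n)) (J-translate (+ 3) G m n)))) m n ⟩
    J (J (λ m n → J (S G) m n + J G (m - + 3) n)) m n ≡⟨ J-cong (λ m n → trans (J-+ (J (S G)) (λ m n → J G (m - + 3) n) m n) (cong (_+_ (J (J (S G)) m n)) (J-translate (+ 3) (J G) m n))) m n ⟩
    J (λ m n → J (J (S G)) m n + J (J G) (m - + 3) n) m n ≡⟨ trans (J-+ (J (J (S G))) (λ m n → J (J G) (m - + 3) n) m n) (cong (_+_ (J (J (J (S G))) m n)) (J-translate (+ 3) (J (J G)) m n)) ⟩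
    J (J (J (S G))) m n + K (m - + 3) n ∎

K-vanishing : Vanishing K
K-vanishing = J-vanishing {J (J G)} (J-vanishing {J G} (J-vanishing {G} G-vanishing))

-- The invariance changes n by 1 - m, so for m ≠ 1 every orbit reaches negative n: forwards when m ≥
-- 2, backwards when m ≤ 0.
K≡0 : ∀ m n → m ≢ 1ℤ → K m n ≡ 0ℤ
K≡0 (+ zero) n _ = descent (λ n → K 0ℤ n ≡ 0ℤ) (K-vanishing 0ℤ) (λ n ih → trans (K-back n) (ih 0)) n
  where
  K-back : ∀ n → K 0ℤ (+ n) ≡ K 0ℤ (+ n - 1ℤ)
  K-back n = sym (trans (K-invariant 0ℤ (+ n - 1ℤ)) (cong (K 0ℤ) (cancel (+ n))))
    where
    cancel : ∀ n → n - 1ℤ - 0ℤ + 1ℤ ≡ n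
    cancel = solve-∀
K≡0 (+ suc zero) n h = ⊥-elim (h refl)
K≡0 (+ suc (suc m)) n _ = descent (λ n → K (+ suc (suc m)) n ≡ 0ℤ) (K-vanishing _) (λ n ih → trans (K-invariant (+ suc (suc m)) (+ n)) (trans (cong (K (+ suc (suc m))) (trans (cong (λ x → + n - x + 1ℤ) (ℤₚ.pos-+ 1 (suc m))) (lower (+ n) (+ suc m)))) (ih m))) n
  where
  lower : ∀ n m → n - (1ℤ + m) + 1ℤ ≡ n - m
  lower = solve-∀
K≡0 -[1+ m ] n _ = descent (λ n → K -[1+ m ] n ≡ 0ℤ) (K-vanishing _) (λ n ih → trans (K-back n) (ih (suc m))) n
  where
  K-back : ∀ n → K -[1+ m ] (+ n) ≡ K -[1+ m ] (+ n - + suc (suc m))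
  K-back n = sym (trans (K-invariant -[1+ m ] (+ n - + suc (suc m))) (cong (K -[1+ m ]) (trans (cong (λ x → + n - x - -[1+ m ] + 1ℤ) (ℤₚ.pos-+ 1 (suc m))) (cancel (+ n) (+ suc m)))))
    where
    cancel : ∀ n m → n - (1ℤ + m) - - m + 1ℤ ≡ n
    cancel = solve-∀

-- Two-sided sums and the y-expansion of symmetric Laurent polynomials

two-sided : ℕ → (ℤ → ℤ) → ℤ
two-sided B f = f 0ℤ + sum B (λ k → f (+ suc k) + f -[1+ k ])

two-sided-cong : ∀ B {f g : ℤ → ℤ} → (∀ r → f r ≡ g r) → two-sided B f ≡ two-sided B g
two-sided-cong B e = cong₂ _+_ (e 0ℤ) (sum-cong B (λ k _ → cong₂ _+_ (e (+ suc k)) (e -[1+ k ])))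

two-sided-0 : ∀ B → two-sided B (λ _ → 0ℤ) ≡ 0ℤ
two-sided-0 B = trans (ℤₚ.+-identityˡ _) (sum-0 B (λ _ _ → refl))

two-sided-+ : ∀ B f g → two-sided B (λ r → f r + g r) ≡ two-sided B f + two-sided B g
two-sided-+ B f g = trans (cong (_+_ (f 0ℤ + g 0ℤ)) (trans (sum-cong B (λ k _ → interchange (f (+ suc k)) (g (+ suc k)) (f -[1+ k ]) (g -[1+ k ]))) (sum-+ B (λ k → f (+ suc k) + f -[1+ k ]) (λ k → g (+ suc k) + g -[1+ k ])))) (interchange (f 0ℤ) (g 0ℤ) _ _)
  where
  interchange : ∀ a b c d → a + b + (c + d) ≡ a + c + (b + d)
  interchange = solve-∀

two-sided-* : ∀ B c f → two-sided B (λ r → c * f r) ≡ c * two-sided B f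
two-sided-* B c f = trans (cong (_+_ (c * f 0ℤ)) (trans (sum-cong B (λ k _ → sym (ℤₚ.*-distribˡ-+ c (f (+ suc k)) (f -[1+ k ])))) (sum-* B c (λ k → f (+ suc k) + f -[1+ k ])))) (sym (ℤₚ.*-distribˡ-+ c (f 0ℤ) _))

two-sided-sum : ∀ B K (f : ℕ → ℤ → ℤ) → two-sided B (λ r → sum K (λ k → f k r)) ≡ sum K (λ k → two-sided B (f k))
two-sided-sum B zero f = two-sided-0 B
two-sided-sum B (suc K) f = trans (two-sided-+ B (λ r → sum K (λ k → f k r)) (f K)) (cong (_+ two-sided B (f K)) (two-sided-sum B K f))

Within : ℕ → (ℤ → ℤ) → Set
Within b f = ∀ r → b ℕ.< ℤ.∣ r ∣ → f r ≡ 0ℤ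

two-sided-truncate : ∀ {b B f} → b ℕ.≤ B → Within b f → two-sided B f ≡ two-sided b f
two-sided-truncate {b} {B} {f} b≤B w = cong (_+_ (f 0ℤ)) (sum-truncate (λ k → f (+ suc k) + f -[1+ k ]) b≤B (λ k b≤k → cong₂ _+_ (w (+ suc k) (s≤s b≤k)) (w -[1+ k ] (s≤s b≤k))))

two-sided-reflect : ∀ B f → two-sided B (λ r → f (- r)) ≡ two-sided B f
two-sided-reflect B f = cong (_+_ (f 0ℤ)) (sum-cong B (λ k _ → ℤₚ.+-comm (f -[1+ k ]) (f (+ suc k))))

two-sided-step : ∀ B g → two-sided B (λ r → g (r + 1ℤ)) + g (- + B) ≡ two-sided B g + g (+ suc B)
two-sided-step zero g = base (g 0ℤ) (g 1ℤ)
  where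
  base : ∀ a b → b + 0ℤ + a ≡ a + 0ℤ + b
  base = solve-∀
two-sided-step (suc B) g = begin
  g 1ℤ + (s + (g (+ suc B + 1ℤ) + g (-[1+ B ] + 1ℤ))) + g -[1+ B ] ≡⟨ cong₂ (λ x y → g 1ℤ + (s + (g x + g y)) + g -[1+ B ]) (trans (sym (ℤₚ.pos-+ (suc B) 1)) (cong +_ (ℕₚ.+-comm (suc B) 1))) (trans (cong (λ x → - x + 1ℤ) (ℤₚ.pos-+ 1 B)) (cancel (+ B))) ⟩
  g 1ℤ + (s + (g (+ suc (suc B)) + g (- + B))) + g -[1+ B ] ≡⟨ regroup (g 1ℤ) s (g (+ suc (suc B))) (g (- + B)) (g -[1+ B ]) ⟩
  g 1ℤ + s + g (- + B) + (g (+ suc (suc B)) + g -[1+ B ]) ≡⟨ cong (_+ (g (+ suc (suc B)) + g -[1+ B ])) (two-sided-step B g) ⟩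
  g 0ℤ + t + g (+ suc B) + (g (+ suc (suc B)) + g -[1+ B ]) ≡⟨ regroup′ (g 0ℤ) t (g (+ suc B)) (g (+ suc (suc B))) (g -[1+ B ]) ⟩
  g 0ℤ + (t + (g (+ suc B) + g -[1+ B ])) + g (+ suc (suc B)) ∎
  where
  open ≡-Reasoning
  s = sum B (λ k → g (+ suc k + 1ℤ) + g (-[1+ k ] + 1ℤ))
  t = sum B (λ k → g (+ suc k) + g -[1+ k ])
  cancel : ∀ b → - (1ℤ + b) + 1ℤ ≡ - b
  cancel = solve-∀
  regroup : ∀ a s x y z → a + (s + (x + y)) + z ≡ a + s + y + (x + z)
  regroup = solve-∀
  regroup′ : ∀ a t x y z → a + t + x + (y + z) ≡ a + (t + (x + z)) + y
  regroup′ = solve-∀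

∣-∣-triangle : ∀ r s → ℤ.∣ r ∣ ℕ.≤ ℤ.∣ r + + s ∣ ℕ.+ s
∣-∣-triangle r s = subst (λ x → ℤ.∣ x ∣ ℕ.≤ ℤ.∣ r + + s ∣ ℕ.+ s) (cancel r (+ s)) (ℤₚ.∣i-j∣≤∣i∣+∣j∣ (r + + s) (+ s))
  where
  cancel : ∀ r s → r + s - s ≡ r
  cancel = solve-∀

∣-∣-triangle⁻ : ∀ r s → ℤ.∣ r ∣ ℕ.≤ ℤ.∣ r - + s ∣ ℕ.+ s
∣-∣-triangle⁻ r s = subst (λ x → ℤ.∣ x ∣ ℕ.≤ ℤ.∣ r - + s ∣ ℕ.+ s) (cancel r (+ s)) (ℤₚ.∣i+j∣≤∣i∣+∣j∣ (r - + s) (+ s))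
  where
  cancel : ∀ r s → r - s + s ≡ r
  cancel = solve-∀

Within-far : ∀ {b f} → Within b f → ∀ r s → b ℕ.+ s ℕ.< ℤ.∣ r ∣ → f (r + + s) ≡ 0ℤ
Within-far {b} w r s h = w (r + + s) (ℕₚ.+-cancelʳ-< s b _ (ℕₚ.<-≤-trans h (∣-∣-triangle r s)))

Within-far⁻ : ∀ {b f} → Within b f → ∀ r s → b ℕ.+ s ℕ.< ℤ.∣ r ∣ → f (r - + s) ≡ 0ℤ
Within-far⁻ {b} w r s h = w (r - + s) (ℕₚ.+-cancelʳ-< s b _ (ℕₚ.<-≤-trans h (∣-∣-triangle⁻ r s)))

two-sided-shift : ∀ {b B g} → Within b g → ∀ s → b ℕ.+ s ℕ.≤ B → two-sided B (λ r → g (r + + s)) ≡ two-sided B g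
two-sided-shift {B = B} {g} w zero _ = two-sided-cong B (λ r → cong g (ℤₚ.+-identityʳ r))
two-sided-shift {b} {B} {g} w (suc s) h = begin
  two-sided B (λ r → g (r + + suc s)) ≡⟨ two-sided-cong B (λ r → cong g (trans (cong (_+_ r) (ℤₚ.pos-+ 1 s)) (sym (ℤₚ.+-assoc r 1ℤ (+ s))))) ⟩
  two-sided B (λ r → g′ (r + 1ℤ)) ≡⟨ isolate _ (g′ (- + B)) (two-sided B g′) (g′ (+ suc B)) (two-sided-step B g′) low high ⟩
  two-sided B g′ ≡⟨ two-sided-shift w s (ℕₚ.≤-trans (ℕₚ.+-monoʳ-≤ b (ℕₚ.n≤1+n s)) h) ⟩
  two-sided B g ∎
  where
  open ≡-Reasoning
  g′ : ℤ → ℤ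
  g′ r = g (r + + s)
  b+s<B : b ℕ.+ s ℕ.< B
  b+s<B = subst (ℕ._≤ B) (ℕₚ.+-suc b s) h
  low : g′ (- + B) ≡ 0ℤ
  low = Within-far {b} {g} w (- + B) s (subst (b ℕ.+ s ℕ.<_) (sym (ℤₚ.∣-i∣≡∣i∣ (+ B))) b+s<B)
  high : g′ (+ suc B) ≡ 0ℤ
  high = Within-far {b} {g} w (+ suc B) s (ℕₚ.m<n⇒m<1+n b+s<B)
  isolate : ∀ a x b y → a + x ≡ b + y → x ≡ 0ℤ → y ≡ 0ℤ → a ≡ b
  isolate a x b y e refl refl = trans (sym (ℤₚ.+-identityʳ a)) (trans e (ℤₚ.+-identityʳ b))

two-sided-shift⁻ : ∀ {b B g} → Within b g → ∀ s → b ℕ.+ s ℕ.≤ B → two-sided B (λ r → g (r - + s)) ≡ two-sided B g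
two-sided-shift⁻ {b} {B} {g} w s h = begin
  two-sided B (λ r → g (r - + s)) ≡⟨ sym (two-sided-reflect B (λ r → g (r - + s))) ⟩
  two-sided B (λ r → g (- r - + s)) ≡⟨ two-sided-cong B (λ r → cong g (sym (ℤₚ.neg-distrib-+ r (+ s)))) ⟩
  two-sided B (λ r → g (- (r + + s))) ≡⟨ two-sided-shift {b} {B} {λ r → g (- r)} (λ r b<r → w (- r) (subst (b ℕ.<_) (sym (ℤₚ.∣-i∣≡∣i∣ r)) b<r)) s h ⟩
  two-sided B (λ r → g (- r)) ≡⟨ two-sided-reflect B g ⟩
  two-sided B g ∎
  where open ≡-Reasoning

-- Window sums and multiplication by the symmetric theta series

window : ℕ → (ℤ → ℤ) → ℤ → ℤ
window k f m = f m + sum k (λ i → f (m + + suc i) + f (m - + suc i))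

Within-window : ∀ {b f} → Within b f → ∀ k → Within (b ℕ.+ k) (window k f)
Within-window {b} {f} w k r h = cong₂ _+_ (w r (ℕₚ.≤-<-trans (ℕₚ.m≤m+n b k) h)) (sum-0 k (λ i i<k →
  cong₂ _+_ (Within-far {b} {f} w r (suc i) (ℕₚ.≤-<-trans (ℕₚ.+-monoʳ-≤ b i<k) h)) (Within-far⁻ {b} {f} w r (suc i) (ℕₚ.≤-<-trans (ℕₚ.+-monoʳ-≤ b i<k) h))))

-- A window is symmetric about its centre, hence self-adjoint under summation. The inequality on B
-- keeps all translated supports inside the range.
window-adjoint : ∀ {b B f} (w : ℤ → ℤ) k → Within b f → b ℕ.+ k ℕ.≤ B → two-sided B (λ r → w r * window k f r) ≡ two-sided B (λ r → window k w r * f r)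
window-adjoint {b} {B} {f} w k within h = begin
  two-sided B (λ r → w r * window k f r) ≡⟨ two-sided-cong B (λ r → trans (ℤₚ.*-distribˡ-+ (w r) (f r) _) (cong (_+_ (w r * f r)) (sym (sum-* k (w r) (λ i → f (r + + suc i) + f (r - + suc i)))))) ⟩
  two-sided B (λ r → w r * f r + sum k (λ i → w r * (f (r + + suc i) + f (r - + suc i)))) ≡⟨ trans (two-sided-+ B (λ r → w r * f r) (λ r → sum k (λ i → w r * (f (r + + suc i) + f (r - + suc i))))) (cong (_+_ (two-sided B (λ r → w r * f r))) (two-sided-sum B k (λ i r → w r * (f (r + + suc i) + f (r - + suc i))))) ⟩
  two-sided B (λ r → w r * f r) + sum k (λ i → two-sided B (λ r → w r * (f (r + + suc i) + f (r - + suc i)))) ≡⟨ cong (_+_ (two-sided B (λ r → w r * f r))) (sum-cong k (λ i i<k → pair (suc i) (ℕₚ.≤-trans (ℕₚ.+-monoʳ-≤ b i<k) h))) ⟩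
  two-sided B (λ r → w r * f r) + sum k (λ i → two-sided B (λ r → (w (r + + suc i) + w (r - + suc i)) * f r)) ≡⟨ sym (trans (two-sided-+ B (λ r → w r * f r) (λ r → sum k (λ i → (w (r + + suc i) + w (r - + suc i)) * f r))) (cong (_+_ (two-sided B (λ r → w r * f r))) (two-sided-sum B k (λ i r → (w (r + + suc i) + w (r - + suc i)) * f r)))) ⟩
  two-sided B (λ r → w r * f r + sum k (λ i → (w (r + + suc i) + w (r - + suc i)) * f r)) ≡⟨ two-sided-cong B (λ r → trans (cong (_+_ (w r * f r)) (trans (sum-cong k (λ i _ → ℤₚ.*-comm (w (r + + suc i) + w (r - + suc i)) (f r))) (trans (sum-* k (f r) (λ i → w (r + + suc i) + w (r - + suc i))) (ℤₚ.*-comm (f r) _)))) (sym (ℤₚ.*-distribʳ-+ (f r) (w r) (sum k (λ i → w (r + + suc i) + w (r - + suc i)))))) ⟩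
  two-sided B (λ r → window k w r * f r) ∎
  where
  open ≡-Reasoning
  plus-minus : ∀ r s → r + s - s ≡ r
  plus-minus = solve-∀
  minus-plus : ∀ r s → r - s + s ≡ r
  minus-plus = solve-∀
  pair : ∀ s → b ℕ.+ s ℕ.≤ B → two-sided B (λ r → w r * (f (r + + s) + f (r - + s))) ≡ two-sided B (λ r → (w (r + + s) + w (r - + s)) * f r)
  pair s b+s≤B = begin
    two-sided B (λ r → w r * (f (r + + s) + f (r - + s)))
      ≡⟨ trans (two-sided-cong B (λ r → ℤₚ.*-distribˡ-+ (w r) (f (r + + s)) (f (r - + s)))) (two-sided-+ B (λ r → w r * f (r + + s)) (λ r → w r * f (r - + s))) ⟩
    two-sided B (λ r → w r * f (r + + s)) + two-sided B (λ r → w r * f (r - + s))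
      ≡⟨ cong₂ _+_ (trans (two-sided-cong B (λ r → cong (λ x → w x * f (r + + s)) (sym (plus-minus r (+ s))))) (two-sided-shift {b} {B} {λ r → w (r - + s) * f r} (λ r b<r → trans (cong (w (r - + s) *_) (within r b<r)) (ℤₚ.*-zeroʳ (w (r - + s)))) s b+s≤B))
                   (trans (two-sided-cong B (λ r → cong (λ x → w x * f (r - + s)) (sym (minus-plus r (+ s))))) (two-sided-shift⁻ {b} {B} {λ r → w (r + + s) * f r} (λ r b<r → trans (cong (w (r + + s) *_) (within r b<r)) (ℤₚ.*-zeroʳ (w (r + + s)))) s b+s≤B)) ⟩
    two-sided B (λ r → w (r - + s) * f r) + two-sided B (λ r → w (r + + s) * f r)
      ≡⟨ trans (ℤₚ.+-comm (two-sided B (λ r → w (r - + s) * f r)) _) (trans (sym (two-sided-+ B (λ r → w (r + + s) * f r) (λ r → w (r - + s) * f r))) (two-sided-cong B (λ r → sym (ℤₚ.*-distribʳ-+ (f r) (w (r + + s)) (w (r - + s)))))) ⟩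
    two-sided B (λ r → (w (r + + s) + w (r - + s)) * f r) ∎

-- Multiplication by y + 2 = z + z⁻¹.
U : Series → Series
U x l = + 2 * x l + shift 1 x l

U-∙ : ∀ x y l → (U x ∙ y) l ≡ U (x ∙ y) l
U-∙ x y l = trans (∙-distribʳ-⊕ y (+ 2 · x) (shift 1 x) l) (cong₂ _+_ (·-∙ (+ 2) x y l) (shift-∙ l))
  where
  shift-∙ : ∀ l → (shift 1 x ∙ y) l ≡ shift 1 (x ∙ y) l
  shift-∙ zero = refl
  shift-∙ (suc l) = ℤₚ.+-identityˡ _

U-⊕ : ∀ x y l → U (x ⊕ y) l ≡ U x l + U y l
U-⊕ x y zero = regroup (x 0) (y 0)
  where
  regroup : ∀ a b → + 2 * (a + b) + 0ℤ ≡ + 2 * a + 0ℤ + (+ 2 * b + 0ℤ)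
  regroup = solve-∀
U-⊕ x y (suc l) = regroup (x (suc l)) (y (suc l)) (x l) (y l)
  where
  regroup : ∀ a b c d → + 2 * (a + b) + (c + d) ≡ + 2 * a + c + (+ 2 * b + d)
  regroup = solve-∀

U-cong : ∀ {x y : Series} → (∀ l → x l ≡ y l) → ∀ l → U x l ≡ U y l
U-cong e l = cong₂ _+_ (cong (+ 2 *_) (e l)) (shift-cong 1 e l)

choose-< : ∀ n k → n ℕ.< k → choose n k ≡ 0ℤ
choose-< zero (suc k) _ = refl
choose-< (suc n) (suc k) (s≤s n<k) = cong₂ _+_ (choose-< n k n<k) (choose-< n (suc k) (ℕₚ.m<n⇒m<1+n n<k))

χ-zero : ∀ l → χ 0 l ≡ 𝟙 l
χ-zero zero = refl
χ-zero (suc l) = cong₂ (λ a b → a + + 2 * b) (choose-< (suc l) (suc l ℕ.+ suc l) below) (choose-< (suc l) (suc (suc l ℕ.+ suc l)) (ℕₚ.m<n⇒m<1+n below))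
  where
  below : suc l ℕ.< suc l ℕ.+ suc l
  below = ℕₚ.m<m+n (suc l) (s≤s z≤n)

χ-step : ∀ k l → χ (suc (suc k)) l + χ k l ≡ U (χ (suc k)) l
χ-step k zero = trans (χ-recurrence₀ k) (sym (ℤₚ.+-identityʳ _))
χ-step k (suc l) = χ-recurrence k l

χ-one : ∀ l → χ 1 l ≡ U (χ 0) l + χ 0 l
χ-one zero = refl
χ-one (suc zero) = refl
χ-one (suc (suc l)) = trans
  (cong₂ (λ a b → a + + 2 * b) (choose-< (1 ℕ.+ l′) (l′ ℕ.+ l′) below) (choose-< (1 ℕ.+ l′) (suc (l′ ℕ.+ l′)) (ℕₚ.m<n⇒m<1+n below)))
  (sym (cong₂ (λ a b → + 2 * a + b + a) (χ-zero l′) (χ-zero (suc l))))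
  where
  l′ = suc (suc l)
  below : 1 ℕ.+ l′ ℕ.< l′ ℕ.+ l′
  below = subst (ℕ._≤ l′ ℕ.+ l′) (ℕₚ.+-comm l′ 2) (ℕₚ.+-monoʳ-≤ l′ (s≤s (s≤s z≤n)))

-- The expansion of zʳ + z⁻ʳ in powers of y = z + z⁻¹ - 2.
v : ℤ → Series
v (+ zero) = const (+ 2)
v (+ suc m) l = χ (suc m) l - χ m l
v -[1+ m ] l = χ (suc m) l - χ m l

v-even : ∀ r l → v (- r) l ≡ v r l
v-even (+ zero) l = refl
v-even (+ suc m) l = refl
v-even -[1+ m ] l = refl

v-step : ∀ r l → v (r + 1ℤ) l + v (r - 1ℤ) l ≡ U (v r) l
v-step-pos : ∀ m l → v (+ suc m + 1ℤ) l + v (+ suc m - 1ℤ) l ≡ U (v (+ suc m)) l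

v-sub : ∀ m l → U (v (+ suc m)) l ≡ U (χ (suc m)) l - U (χ m) l
v-sub m zero = regroup (χ (suc m) 0) (χ m 0)
  where
  regroup : ∀ a b → + 2 * (a - b) + 0ℤ ≡ + 2 * a + 0ℤ - (+ 2 * b + 0ℤ)
  regroup = solve-∀
v-sub m (suc l) = regroup (χ (suc m) (suc l)) (χ m (suc l)) (χ (suc m) l) (χ m l)
  where
  regroup : ∀ a b c d → + 2 * (a - b) + (c - d) ≡ + 2 * a + c - (+ 2 * b + d)
  regroup = solve-∀

v-step-pos m l = trans (cong₂ (λ x y → v x l + v y l) (trans (sym (ℤₚ.pos-+ (suc m) 1)) (cong +_ (ℕₚ.+-comm (suc m) 1))) (trans (suc-cancel m 0) (ℤₚ.+-identityʳ (+ m))))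
  (trans (core m) (sym (v-sub m l)))
  where
  core : ∀ m → (χ (suc (suc m)) l - χ (suc m) l) + v (+ m) l ≡ U (χ (suc m)) l - U (χ m) l
  core zero = trans (cong₂ (λ a b → (χ 2 l - a) + b) (χ-one l) (trans (twice l) (cong (+ 2 *_) (sym (χ-zero l))))) (trans (regroup (χ 2 l) (U (χ 0) l) (χ 0 l)) (cong (_- U (χ 0) l) (χ-step 0 l)))
    where
    twice : ∀ l → const (+ 2) l ≡ + 2 * 𝟙 l
    twice zero = refl
    twice (suc l) = refl
    regroup : ∀ a u c → a - (u + c) + + 2 * c ≡ a + c - u
    regroup = solve-∀
  core (suc m) = trans (regroup (χ (suc (suc (suc m))) l) (χ (suc (suc m)) l) (χ (suc m) l) (χ m l)) (cong₂ _-_ (χ-step (suc m) l) (χ-step m l))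
    where
    regroup : ∀ a b c d → a - b + (c - d) ≡ a + c - (b + d)
    regroup = solve-∀

v-step (+ zero) l = trans (cong (λ x → x + x) one) (double l)
  where
  one : χ 1 l - χ 0 l ≡ U 𝟙 l
  one = trans (cong (_- χ 0 l) (χ-one l)) (trans (cancel (U (χ 0) l) (χ 0 l)) (U-cong χ-zero l))
    where
    cancel : ∀ a b → a + b - b ≡ a
    cancel = solve-∀
  double : ∀ l → U 𝟙 l + U 𝟙 l ≡ U (const (+ 2)) l
  double l = trans (sym (U-⊕ 𝟙 𝟙 l)) (U-cong {𝟙 ⊕ 𝟙} {const (+ 2)} (λ { zero → refl ; (suc l) → refl }) l)
v-step (+ suc m) l = v-step-pos m l
v-step -[1+ m ] l = begin
  v (-[1+ m ] + 1ℤ) l + v (-[1+ m ] - 1ℤ) l ≡⟨ cong₂ (λ x y → v x l + v y l) (reflect (+ suc m)) (reflect′ (+ suc m)) ⟩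
  v (- (+ suc m - 1ℤ)) l + v (- (+ suc m + 1ℤ)) l ≡⟨ cong₂ _+_ (v-even (+ suc m - 1ℤ) l) (v-even (+ suc m + 1ℤ) l) ⟩
  v (+ suc m - 1ℤ) l + v (+ suc m + 1ℤ) l ≡⟨ ℤₚ.+-comm (v (+ suc m - 1ℤ) l) _ ⟩
  v (+ suc m + 1ℤ) l + v (+ suc m - 1ℤ) l ≡⟨ v-step-pos m l ⟩
  U (v (+ suc m)) l ∎
  where
  open ≡-Reasoning
  reflect : ∀ m → - m + 1ℤ ≡ - (m - 1ℤ)
  reflect = solve-∀
  reflect′ : ∀ m → - m - 1ℤ ≡ - (m + 1ℤ)
  reflect′ = solve-∀

-- The product of zⁱ + z⁻ⁱ and zʳ + z⁻ʳ, expanded in y.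
v-pair : ∀ i r l → v (r + + i) l + v (r - + i) l ≡ (v (+ i) ∙ v r) l
v-pair zero r l = trans (cong₂ (λ x y → v x l + v y l) (ℤₚ.+-identityʳ r) (ℤₚ.+-identityʳ r)) (trans (double (v r l)) (sym (const-∙ (+ 2) (v r) l)))
  where
  double : ∀ a → a + a ≡ + 2 * a
  double = solve-∀
v-pair (suc zero) r l = trans (v-step r l) (sym (trans (∙-congˡ-≡ (v r) one l) (trans (U-∙ 𝟙 (v r) l) (U-cong (λ l → trans (const-∙ 1ℤ (v r) l) (ℤₚ.*-identityˡ (v r l))) l))))
  where
  one : ∀ l → χ 1 l - χ 0 l ≡ U 𝟙 l
  one l = trans (cong (_- χ 0 l) (χ-one l)) (trans (cancel (U (χ 0) l) (χ 0 l)) (U-cong χ-zero l))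
    where
    cancel : ∀ a b → a + b - b ≡ a
    cancel = solve-∀
v-pair (suc (suc i)) r l = begin
  v (r + + suc (suc i)) l + v (r - + suc (suc i)) l ≡⟨ expand (v (r + + suc (suc i)) l) (v (r + + i) l) (v (r - + i) l) (v (r - + suc (suc i)) l) ⟩
  (v (r + + suc (suc i)) l + v (r + + i) l) + (v (r - + i) l + v (r - + suc (suc i)) l) - (v (r + + i) l + v (r - + i) l)
    ≡⟨ cong₂ (λ x y → x + y - (v (r + + i) l + v (r - + i) l)) upper lower ⟩
  U (v (r + + suc i)) l + U (v (r - + suc i)) l - (v (r + + i) l + v (r - + i) l) ≡⟨ cong₂ _-_ (trans (sym (U-⊕ (v (r + + suc i)) (v (r - + suc i)) l)) (trans (U-cong (v-pair (suc i) r) l) (sym (U-∙ (v (+ suc i)) (v r) l)))) (v-pair i r l) ⟩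
  (U (v (+ suc i)) ∙ v r) l - (v (+ i) ∙ v r) l ≡⟨ cong (_- (v (+ i) ∙ v r) l) (trans (∙-congˡ-≡ (v r) (λ l → sym (three l)) l) (∙-distribʳ-⊕ (v r) (v (+ suc (suc i))) (v (+ i)) l)) ⟩
  (v (+ suc (suc i)) ∙ v r) l + (v (+ i) ∙ v r) l - (v (+ i) ∙ v r) l ≡⟨ cancel _ _ ⟩
  (v (+ suc (suc i)) ∙ v r) l ∎
  where
  open ≡-Reasoning
  expand : ∀ a b c d → a + d ≡ (a + b) + (c + d) - (b + c)
  expand = solve-∀
  cancel : ∀ a b → a + b - b ≡ a
  cancel = solve-∀
  three : ∀ l → v (+ suc (suc i)) l + v (+ i) l ≡ U (v (+ suc i)) l
  three l = trans (cong₂ (λ x y → v x l + v y l) (trans (cong +_ (sym (ℕₚ.+-comm (suc i) 1))) (ℤₚ.pos-+ (suc i) 1)) (sym (trans (suc-cancel i 0) (ℤₚ.+-identityʳ (+ i))))) (v-step (+ suc i) l)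
  i+1 : + suc i ≡ 1ℤ + + i
  i+1 = ℤₚ.pos-+ 1 i
  i+2 : + suc (suc i) ≡ 1ℤ + (1ℤ + + i)
  i+2 = trans (ℤₚ.pos-+ 1 (suc i)) (cong (_+_ 1ℤ) i+1)
  upper : v (r + + suc (suc i)) l + v (r + + i) l ≡ U (v (r + + suc i)) l
  upper = trans (cong₂ (λ x y → v x l + v y l) (trans (cong (_+_ r) i+2) (trans (up r (+ i)) (cong (λ x → r + x + 1ℤ) (sym i+1)))) (trans (down r (+ i)) (cong (λ x → r + x - 1ℤ) (sym i+1)))) (v-step (r + + suc i) l)
    where
    up : ∀ r i → r + (1ℤ + (1ℤ + i)) ≡ r + (1ℤ + i) + 1ℤ
    up = solve-∀
    down : ∀ r i → r + i ≡ r + (1ℤ + i) - 1ℤ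
    down = solve-∀
  lower : v (r - + i) l + v (r - + suc (suc i)) l ≡ U (v (r - + suc i)) l
  lower = trans (cong₂ (λ x y → v x l + v y l) (trans (up r (+ i)) (cong (λ x → r - x + 1ℤ) (sym i+1))) (trans (cong (_-_ r) i+2) (trans (down r (+ i)) (cong (λ x → r - x - 1ℤ) (sym i+1))))) (v-step (r - + suc i) l)
    where
    up : ∀ r i → r - i ≡ r - (1ℤ + i) + 1ℤ
    up = solve-∀
    down : ∀ r i → r - (1ℤ + (1ℤ + i)) ≡ r - (1ℤ + i) - 1ℤ
    down = solve-∀

window-v : ∀ k r l → window k (λ r → v r l) r ≡ (χ k ∙ v r) l
window-v zero r l = trans (ℤₚ.+-identityʳ (v r l)) (sym (trans (∙-congˡ-≡ (v r) χ-zero l) (trans (const-∙ 1ℤ (v r) l) (ℤₚ.*-identityˡ (v r l)))))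
window-v (suc k) r l = begin
  v r l + (sum k pairs + pairs k) ≡⟨ sym (ℤₚ.+-assoc (v r l) (sum k pairs) (pairs k)) ⟩
  window k (λ r → v r l) r + pairs k ≡⟨ cong₂ _+_ (window-v k r l) (v-pair (suc k) r l) ⟩
  (χ k ∙ v r) l + (v (+ suc k) ∙ v r) l ≡⟨ sym (∙-distribʳ-⊕ (v r) (χ k) (v (+ suc k)) l) ⟩
  ((χ k ⊕ v (+ suc k)) ∙ v r) l ≡⟨ ∙-congˡ-≡ (v r) (λ l → cancel (χ k l) (χ (suc k) l)) l ⟩
  (χ (suc k) ∙ v r) l ∎
  where
  open ≡-Reasoning
  pairs : ℕ → ℤ
  pairs i = v (r + + suc i) l + v (r - + suc i) l
  cancel : ∀ a b → a + (b - a) ≡ b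
  cancel = solve-∀

infixl 7 _⋆_

-- Product of power series in y with coefficients in power series in q.
_⋆_ : (ℕ → Series) → (ℕ → Series) → ℕ → Series
(A ⋆ B) zero = A 0 ∙ B 0
(A ⋆ B) (suc l) = A 0 ∙ B (suc l) ⊕ ((A ∘ suc) ⋆ B) l

-- The margin of one beyond n is for the recentred array `R`, which combines rank counts at three
-- neighbouring indices.
Narrow : Array → Set
Narrow X = ∀ r n → suc n ℕ.< ℤ.∣ r ∣ → X r (+ n) ≡ 0ℤ

abstract

  -- Multiplication by j(z)/(1 - z), the sum of (-1)ᵏ q^{k(k+1)/2} (z⁻ᵏ + ... + zᵏ). Unlike j it is
  -- symmetric in z and z⁻¹, hence a series in y.
  theta : Array → Array
  theta X m n = sum (suc ℤ.∣ n ∣) (λ k → sgn k * window k (λ r → X r (n - + triangular k)) m)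

  theta-def : ∀ X m n → theta X m n ≡ sum (suc ℤ.∣ n ∣) (λ k → sgn k * window k (λ r → X r (n - + triangular k)) m)
  theta-def X m n = refl

  theta-cong : ∀ {X Y} → X ≗ Y → theta X ≗ theta Y
  theta-cong e m n = sum-cong (suc ℤ.∣ n ∣) (λ k _ → cong (sgn k *_) (cong₂ _+_ (e _ _) (sum-cong k (λ i _ → cong₂ _+_ (e _ _) (e _ _)))))

  theta-sub : ∀ X Y → theta (λ m n → X m n - Y m n) ≗ (λ m n → theta X m n - theta Y m n)
  theta-sub X Y m n = begin
    sum B (λ k → sgn k * window k (λ r → X r (n - + triangular k) - Y r (n - + triangular k)) m)
      ≡⟨ sum-cong B (λ k _ → trans (cong (sgn k *_) (window-sub k (λ r → X r (n - + triangular k)) (λ r → Y r (n - + triangular k)))) (distribute (sgn k) (window k (λ r → X r (n - + triangular k)) m) (window k (λ r → Y r (n - + triangular k)) m))) ⟩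
    sum B (λ k → sgn k * window k (λ r → X r (n - + triangular k)) m + - 1ℤ * (sgn k * window k (λ r → Y r (n - + triangular k)) m))
      ≡⟨ trans (sum-+ B (λ k → sgn k * window k (λ r → X r (n - + triangular k)) m) (λ k → - 1ℤ * (sgn k * window k (λ r → Y r (n - + triangular k)) m))) (cong (_+_ (theta X m n)) (trans (sum-* B (- 1ℤ) (λ k → sgn k * window k (λ r → Y r (n - + triangular k)) m)) (ℤₚ.-1*i≡-i (theta Y m n)))) ⟩
    theta X m n - theta Y m n ∎
    where
    open ≡-Reasoning
    B : ℕ
    B = suc ℤ.∣ n ∣
    distribute : ∀ s a b → s * (a - b) ≡ s * a + - 1ℤ * (s * b)
    distribute = solve-∀
    window-sub : ∀ k (f g : ℤ → ℤ) → window k (λ r → f r - g r) m ≡ window k f m - window k g m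
    window-sub k f g = trans (cong (_+_ (f m - g m)) (trans (sum-cong k (λ i _ → split (f (m + + suc i)) (g (m + + suc i)) (f (m - + suc i)) (g (m - + suc i)))) (trans (sum-+ k (λ i → f (m + + suc i) + f (m - + suc i)) (λ i → - 1ℤ * (g (m + + suc i) + g (m - + suc i)))) (cong (_+_ (sum k (λ i → f (m + + suc i) + f (m - + suc i)))) (sum-* k (- 1ℤ) (λ i → g (m + + suc i) + g (m - + suc i))))))) (collect (f m) (g m) (sum k (λ i → f (m + + suc i) + f (m - + suc i))) (sum k (λ i → g (m + + suc i) + g (m - + suc i))))
      where
      split : ∀ a b c d → a - b + (c - d) ≡ a + c + - 1ℤ * (b + d)
      split = solve-∀
      collect : ∀ a b s t → a - b + (s + - 1ℤ * t) ≡ a + s - (b + t)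
      collect = solve-∀

  theta-translate : ∀ c X → theta (λ m n → X (c + m) n) ≗ (λ m n → theta X (c + m) n)
  theta-translate c X m n = sum-cong (suc ℤ.∣ n ∣) (λ k _ → cong (λ x → sgn k * (X (c + m) (n - + triangular k) + x)) (sum-cong k (λ i _ →
    cong₂ (λ a b → X a (n - + triangular k) + X b (n - + triangular k)) (sym (ℤₚ.+-assoc c m (+ suc i))) (sym (ℤₚ.+-assoc c m (- + suc i))))))

  theta-vanishing : ∀ {X} → Vanishing X → Vanishing (theta X)
  theta-vanishing {X} w m k = sum-0 (suc (suc k)) (λ i _ → trans (cong (sgn i *_) (cong₂ _+_ (zero-at m i) (sum-0 i (λ s _ → cong₂ _+_ (zero-at (m + + suc s) i) (zero-at (m - + suc s) i))))) (ℤₚ.*-zeroʳ (sgn i)))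
    where
    zero-at : ∀ r i → X r (-[1+ k ] - + triangular i) ≡ 0ℤ
    zero-at r i = Vanishing-at {X} w r (proj₂ (negative-sub k (triangular i)))

-- The k-th summand of theta only sees the support of X at n - k(k+1)/2 ≤ n - k.
slice : ∀ {X} → Vanishing X → Narrow X → ∀ n k → k ℕ.≤ n → ∃ λ b → Within b (λ r → X r (+ n - + triangular k)) × b ℕ.+ k ℕ.≤ suc n
slice {X} w narrow n k k≤n with triangular k ℕ.≤? n
... | yes t≤n = suc (n ℕ.∸ triangular k) , (λ r b<r → trans (cong (X r) (sub-≤ t≤n)) (narrow r (n ℕ.∸ triangular k) b<r)) ,
  s≤s (subst (n ℕ.∸ triangular k ℕ.+ k ℕ.≤_) (ℕₚ.m∸n+n≡m t≤n) (ℕₚ.+-monoʳ-≤ (n ℕ.∸ triangular k) (quadratic-≥ 0 0 1 k)))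
... | no t≰n = 0 , (λ r _ → Vanishing-at {X} w r (proj₂ (sub-< (ℕₚ.≰⇒> t≰n)))) , ℕₚ.m≤n⇒m≤1+n k≤n

theta-narrow : ∀ {X} → Vanishing X → Narrow X → Narrow (theta X)
theta-narrow {X} w narrow r n h = trans (theta-def X r (+ n)) (sum-0 (suc n) summand)
  where
  summand : ∀ k → k ℕ.< suc n → sgn k * window k (λ r → X r (+ n - + triangular k)) r ≡ 0ℤ
  summand k (s≤s k≤n) with slice {X} w narrow n k k≤n
  ... | b , within , b+k≤n = trans (cong (sgn k *_) (Within-window within k r (ℕₚ.≤-<-trans b+k≤n h))) (ℤₚ.*-zeroʳ (sgn k))

-- The coefficient of yˡ in X(z) + X(z⁻¹), where X(z) is the generating function of the array in z.
L : Array → ℕ → Series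
L X l n = two-sided (suc n) (λ r → v r l * X r (+ n))

L-ext : ∀ {X} → Vanishing X → Narrow X → ∀ l n k → two-sided (suc n) (λ r → v r l * X r (+ n - + triangular k)) ≡ ext (L X l) (+ n - + triangular k)
L-ext {X} w narrow l n k with triangular k ℕ.≤? n
... | yes t≤n = trans (two-sided-cong (suc n) (λ r → cong (λ x → v r l * X r x) (sub-≤ t≤n)))
  (trans (two-sided-truncate {suc (n ℕ.∸ triangular k)} {suc n} {λ r → v r l * X r (+ (n ℕ.∸ triangular k))} (s≤s (ℕₚ.m∸n≤m n (triangular k))) (λ r b<r → trans (cong (v r l *_) (narrow r _ b<r)) (ℤₚ.*-zeroʳ (v r l)))) (cong (ext (L X l)) (sym (sub-≤ t≤n))))
... | no t≰n = trans (two-sided-cong (suc n) (λ r → trans (cong (v r l *_) (Vanishing-at {X} w r e)) (ℤₚ.*-zeroʳ (v r l)))) (trans (two-sided-0 (suc n)) (sym (ext-negative (L X l) e)))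
  where e = proj₂ (sub-< (ℕₚ.≰⇒> t≰n))

theta-series : (ℕ → ℤ) → Series
theta-series c = lacunary triangular (λ k → sgn k * c k)

theta-series-∙ : ∀ {X} → Vanishing X → Narrow X → ∀ (c : ℕ → ℤ) l n →
  sum (suc n) (λ k → sgn k * two-sided (suc n) (λ r → c k * v r l * X r (+ n - + triangular k))) ≡ (theta-series c ∙ L X l) n
theta-series-∙ {X} w narrow c l n = sym (trans (lacunary-∙ triangular (λ k → sgn k * c k) (quadratic-≥ 0 0 1) (L X l) n) (sum-cong (suc n) (λ k _ → begin
  sgn k * c k * ext (L X l) (+ n - + triangular k) ≡⟨ cong (sgn k * c k *_) (sym (L-ext {X} w narrow l n k)) ⟩
  sgn k * c k * two-sided (suc n) (λ r → v r l * X r (+ n - + triangular k)) ≡⟨ ℤₚ.*-assoc (sgn k) (c k) _ ⟩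
  sgn k * (c k * two-sided (suc n) (λ r → v r l * X r (+ n - + triangular k))) ≡⟨ cong (sgn k *_) (sym (two-sided-* (suc n) (c k) (λ r → v r l * X r (+ n - + triangular k)))) ⟩
  sgn k * two-sided (suc n) (λ r → c k * (v r l * X r (+ n - + triangular k))) ≡⟨ cong (sgn k *_) (two-sided-cong (suc n) (λ r → sym (ℤₚ.*-assoc (c k) (v r l) (X r (+ n - + triangular k))))) ⟩
  sgn k * two-sided (suc n) (λ r → c k * v r l * X r (+ n - + triangular k)) ∎)))
  where open ≡-Reasoning

theta-product : ∀ {X} → Vanishing X → Narrow X → ∀ (c : ℕ → Series) l n →
  sum (suc n) (λ k → sgn k * two-sided (suc n) (λ r → (c k ∙ v r) l * X r (+ n - + triangular k))) ≡ ((λ a → theta-series (λ k → c k a)) ⋆ L X) l n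
theta-product {X} w narrow c zero n = theta-series-∙ {X} w narrow (λ k → c k 0) 0 n
theta-product {X} w narrow c (suc l) n = begin
  sum (suc n) (λ k → sgn k * two-sided (suc n) (λ r → (c k 0 * v r (suc l) + (tail (c k) ∙ v r) l) * f k r))
    ≡⟨ sum-cong (suc n) (λ k _ → trans (cong (sgn k *_) (trans (two-sided-cong (suc n) (λ r → ℤₚ.*-distribʳ-+ (f k r) (c k 0 * v r (suc l)) ((tail (c k) ∙ v r) l))) (two-sided-+ (suc n) (λ r → c k 0 * v r (suc l) * f k r) (λ r → (tail (c k) ∙ v r) l * f k r)))) (ℤₚ.*-distribˡ-+ (sgn k) _ _)) ⟩
  sum (suc n) (λ k → sgn k * two-sided (suc n) (λ r → c k 0 * v r (suc l) * f k r) + sgn k * two-sided (suc n) (λ r → (tail (c k) ∙ v r) l * f k r))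
    ≡⟨ sum-+ (suc n) (λ k → sgn k * two-sided (suc n) (λ r → c k 0 * v r (suc l) * f k r)) (λ k → sgn k * two-sided (suc n) (λ r → (tail (c k) ∙ v r) l * f k r)) ⟩
  sum (suc n) (λ k → sgn k * two-sided (suc n) (λ r → c k 0 * v r (suc l) * f k r)) + sum (suc n) (λ k → sgn k * two-sided (suc n) (λ r → (tail (c k) ∙ v r) l * f k r))
    ≡⟨ cong₂ _+_ (theta-series-∙ {X} w narrow (λ k → c k 0) (suc l) n) (theta-product {X} w narrow (tail ∘ c) l n) ⟩
  ((λ a → theta-series (λ k → c k a)) ⋆ L X) (suc l) n ∎
  where
  open ≡-Reasoning
  f : ℕ → ℤ → ℤ
  f k r = X r (+ n - + triangular k)

-- Moving each window onto the weights turns it into multiplication by χ(k, ·), and summing over k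
-- assembles the theta series.
L-theta : ∀ {X} → Vanishing X → Narrow X → ∀ l n → L (theta X) l n ≡ (Θ ⋆ L X) l n
L-theta {X} w narrow l n = begin
  two-sided (suc n) (λ r → v r l * theta X r (+ n)) ≡⟨ two-sided-cong (suc n) (λ r → trans (cong (v r l *_) (theta-def X r (+ n))) (trans (sym (sum-* (suc n) (v r l) (λ k → sgn k * window k (f k) r))) (sum-cong (suc n) (λ k _ → swap (v r l) (sgn k) (window k (f k) r))))) ⟩
  two-sided (suc n) (λ r → sum (suc n) (λ k → sgn k * (v r l * window k (f k) r))) ≡⟨ two-sided-sum (suc n) (suc n) (λ k r → sgn k * (v r l * window k (f k) r)) ⟩
  sum (suc n) (λ k → two-sided (suc n) (λ r → sgn k * (v r l * window k (f k) r))) ≡⟨ sum-cong (suc n) (λ k k<n → trans (two-sided-* (suc n) (sgn k) (λ r → v r l * window k (f k) r)) (cong (sgn k *_) (summand k k<n))) ⟩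
  sum (suc n) (λ k → sgn k * two-sided (suc n) (λ r → (χ k ∙ v r) l * f k r)) ≡⟨ theta-product {X} w narrow χ l n ⟩
  (Θ ⋆ L X) l n ∎
  where
  open ≡-Reasoning
  f : ℕ → ℤ → ℤ
  f k r = X r (+ n - + triangular k)
  swap : ∀ a b c → a * (b * c) ≡ b * (a * c)
  swap = solve-∀
  summand : ∀ k → k ℕ.< suc n → two-sided (suc n) (λ r → v r l * window k (f k) r) ≡ two-sided (suc n) (λ r → (χ k ∙ v r) l * f k r)
  summand k (s≤s k≤n) with slice {X} w narrow n k k≤n
  ... | b , within , b+k≤n = trans (window-adjoint {b} {suc n} {f k} (λ r → v r l) k within b+k≤n) (two-sided-cong (suc n) (λ r → cong (_* f k r) (window-v k r l)))

D : Array → Array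
D X m n = X m n - X (m - 1ℤ) n

window-D : ∀ k (f : ℤ → ℤ) m → window k (λ r → f r - f (r - 1ℤ)) m ≡ f (m + + k) - f (m - + suc k)
window-D zero f m = trans (ℤₚ.+-identityʳ _) (cong (λ x → f x - f (m - 1ℤ)) (sym (ℤₚ.+-identityʳ m)))
window-D (suc k) f m = begin
  f m - f (m - 1ℤ) + (sum k g + g k) ≡⟨ sym (ℤₚ.+-assoc (f m - f (m - 1ℤ)) (sum k g) (g k)) ⟩
  window k (λ r → f r - f (r - 1ℤ)) m + g k ≡⟨ cong (_+ g k) (window-D k f m) ⟩
  f (m + + k) - f (m - + suc k) + (f (m + + suc k) - f (m + + suc k - 1ℤ) + (f (m - + suc k) - f (m - + suc k - 1ℤ)))
    ≡⟨ cong₂ (λ x y → f (m + + k) - f (m - + suc k) + (f (m + + suc k) - f x + (f (m - + suc k) - f y))) (trans (cong (λ x → m + x - 1ℤ) (ℤₚ.pos-+ 1 k)) (lower m (+ k))) (trans (lower′ m (+ suc k)) (cong (_-_ m) (sym (ℤₚ.pos-+ 1 (suc k))))) ⟩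
  f (m + + k) - f (m - + suc k) + (f (m + + suc k) - f (m + + k) + (f (m - + suc k) - f (m - + suc (suc k)))) ≡⟨ telescope (f (m + + k)) (f (m - + suc k)) (f (m + + suc k)) (f (m - + suc (suc k))) ⟩
  f (m + + suc k) - f (m - + suc (suc k)) ∎
  where
  open ≡-Reasoning
  g : ℕ → ℤ
  g i = f (m + + suc i) - f (m + + suc i - 1ℤ) + (f (m - + suc i) - f (m - + suc i - 1ℤ))
  lower : ∀ m k → m + (1ℤ + k) - 1ℤ ≡ m + k
  lower = solve-∀
  lower′ : ∀ m k → m - k - 1ℤ ≡ m - (1ℤ + k)
  lower′ = solve-∀
  telescope : ∀ a b c d → a - b + (c - a + (b - d)) ≡ c - d
  telescope = solve-∀

J-theta : ∀ X → J X ≗ theta (D X)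
J-theta X m n = trans (J-def X m n) (trans (sum-cong (suc ℤ.∣ n ∣) (λ k _ → cong (sgn k *_) (sym (window-D k (λ r → X r (n - + triangular k)) m)))) (sym (theta-def (D X) m n)))

theta-D : ∀ X → D (theta X) ≗ theta (D X)
theta-D X m n = sym (trans (theta-sub X (λ m n → X (m - 1ℤ) n) m n) (cong (_-_ (theta X m n)) (trans (theta-cong (λ m n → cong (λ x → X x n) (ℤₚ.+-comm m (- 1ℤ))) m n) (trans (theta-translate (- 1ℤ) X m n) (cong (λ x → theta X x n) (ℤₚ.+-comm (- 1ℤ) m))))))

D-cong : ∀ {X Y} → X ≗ Y → D X ≗ D Y
D-cong e m n = cong₂ _-_ (e m n) (e (m - 1ℤ) n)

-- Each J splits as theta times the factor 1 - z; the three differences commute with theta and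
-- collect on G.
K-theta : K ≗ theta (theta (theta (D (D (D G)))))
K-theta m n = begin
  J (J (J G)) m n ≡⟨ J-theta (J (J G)) m n ⟩
  theta (D (J (J G))) m n ≡⟨ theta-cong (D-cong (J-theta (J G))) m n ⟩
  theta (D (theta (D (J G)))) m n ≡⟨ theta-cong (theta-D (D (J G))) m n ⟩
  theta (theta (D (D (J G)))) m n ≡⟨ theta-cong (theta-cong (D-cong (D-cong (J-theta G)))) m n ⟩
  theta (theta (D (D (theta (D G))))) m n ≡⟨ theta-cong (theta-cong (λ m n → trans (D-cong (theta-D (D G)) m n) (theta-D (D (D G)) m n))) m n ⟩
  theta (theta (theta (D (D (D G))))) m n ∎
  where open ≡-Reasoning

-- Rank counts and moments

∣-∣-sub : ∀ {i l n} → i ℕ.< n → l ℕ.< n → ℤ.∣ + i - + l ∣ ℕ.≤ n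
∣-∣-sub {i} {l} {n} i<n l<n = ℕₚ.≤-trans (subst (λ x → ℤ.∣ x ∣ ℕ.≤ i ℕ.⊔ l) (sym (ℤₚ.m-n≡m⊖n i l)) (ℤₚ.∣m⊝n∣≤m⊔n i l)) (ℕₚ.⊔-lub (ℕₚ.<⇒≤ i<n) (ℕₚ.<⇒≤ l<n))

W-cong : ∀ f g n → (∀ ρ → ℤ.∣ ρ ∣ ℕ.≤ n → f ρ ≡ g ρ) → W f n ≡ W g n
W-cong f g n e = trans (W-formula f n n n ℕₚ.≤-refl ℕₚ.≤-refl) (trans (cong₂ _+_ (cong (_* 𝟙 n) (e 0ℤ z≤n))
  (sum-cong n (λ i i<n → sum-cong n (λ l l<n → cong (_* shift (suc i) (exactly (suc i) l) n) (e (+ i - + l) (∣-∣-sub i<n l<n)))))) (sym (W-formula g n n n ℕₚ.≤-refl ℕₚ.≤-refl)))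

W-+ : ∀ f g n → W (λ ρ → f ρ + g ρ) n ≡ W f n + W g n
W-+ f g n = total-+ (f ∘ rank) (g ∘ rank) (partitions n)

W-* : ∀ c f n → W (λ ρ → c * f ρ) n ≡ c * W f n
W-* c f n = total-* c (f ∘ rank) (partitions n)

count : ℤ → Series
count m = W (λ ρ → ι (m - ρ))

count-Q : ∀ m n → Q m n - Q (m - 1ℤ) n ≡ count m n
count-Q m n = sym (trans (W-cong _ _ n (λ ρ _ → trans (cong (λ x → nonneg (m - ρ) - nonneg x) (commute m ρ)) (cong (_+_ (nonneg (m - ρ))) (sym (ℤₚ.-1*i≡-i (nonneg (m - 1ℤ - ρ)))))))
  (trans (W-+ (λ ρ → nonneg (m - ρ)) (λ ρ → - 1ℤ * nonneg (m - 1ℤ - ρ)) n) (cong (_+_ (Q m n)) (trans (W-* (- 1ℤ) (λ ρ → nonneg (m - 1ℤ - ρ)) n) (ℤₚ.-1*i≡-i (Q (m - 1ℤ) n))))))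
  where
  commute : ∀ m ρ → m - ρ - 1ℤ ≡ m - 1ℤ - ρ
  commute = solve-∀

ι-off : ∀ r ρ → r ≢ ρ → ι (r - ρ) ≡ 0ℤ
ι-off r ρ h with ι-cases (r - ρ)
... | inj₁ e = e
... | inj₂ e = ⊥-elim (h (ℤₚ.i-j≡0⇒i≡j r ρ e))

count-within : ∀ n → Within n (λ m → count m n)
count-within n m n<m = trans (W-cong (λ ρ → ι (m - ρ)) (λ _ → 0ℤ) n (λ ρ ρ≤n → ι-off m ρ λ { refl → ℕₚ.<⇒≱ n<m ρ≤n })) (zeros (partitions n))
  where
  zeros : ∀ xs → total {List ℕ} (λ _ → 0ℤ) xs ≡ 0ℤ
  zeros [] = refl
  zeros (x ∷ xs) = trans (ℤₚ.+-identityˡ _) (zeros xs)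

sum-single : ∀ B (g : ℕ → ℤ) k → k ℕ.< B → (∀ i → i ≢ k → g i ≡ 0ℤ) → sum B g ≡ g k
sum-single (suc B) g k k<B e with k ℕ.≟ B
... | yes refl = trans (cong (_+ g B) (sum-0 B (λ i i<B → e i (ℕₚ.<⇒≢ i<B)))) (ℤₚ.+-identityˡ (g B))
... | no k≢B = trans (cong₂ _+_ (sum-single B g k (ℕₚ.≤∧≢⇒< (ℕₚ.≤-pred k<B) k≢B) e) (e B (k≢B ∘ sym))) (ℤₚ.+-identityʳ (g k))

two-sided-single : ∀ B (f : ℤ → ℤ) ρ → ℤ.∣ ρ ∣ ℕ.≤ B → (∀ r → r ≢ ρ → f r ≡ 0ℤ) → two-sided B f ≡ f ρ
two-sided-single B f (+ zero) _ e = trans (cong (_+_ (f 0ℤ)) (sum-0 B (λ k _ → cong₂ _+_ (e (+ suc k) λ ()) (e -[1+ k ] λ ())))) (ℤₚ.+-identityʳ (f 0ℤ))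
two-sided-single B f (+ suc k) k<B e = trans (cong₂ _+_ (e 0ℤ λ ()) (trans (sum-single B (λ i → f (+ suc i) + f -[1+ i ]) k k<B (λ i i≢k → cong₂ _+_ (e (+ suc i) λ { refl → i≢k refl }) (e -[1+ i ] λ ()))) (trans (cong (_+_ (f (+ suc k))) (e -[1+ k ] λ ())) (ℤₚ.+-identityʳ (f (+ suc k)))))) (ℤₚ.+-identityˡ (f (+ suc k)))
two-sided-single B f -[1+ k ] k<B e = trans (cong₂ _+_ (e 0ℤ λ ()) (trans (sum-single B (λ i → f (+ suc i) + f -[1+ i ]) k k<B (λ i i≢k → cong₂ _+_ (e (+ suc i) λ ()) (e -[1+ i ] λ { refl → i≢k refl }))) (trans (cong (_+ f -[1+ k ]) (e (+ suc k) λ ())) (ℤₚ.+-identityˡ (f -[1+ k ]))))) (ℤₚ.+-identityˡ (f -[1+ k ]))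

ι-diagonal : ∀ ρ → ι (ρ - ρ) ≡ 1ℤ
ι-diagonal ρ = cong ι (ℤₚ.+-inverseʳ ρ)

two-sided-count : ∀ B (w : ℤ → ℤ) n → n ℕ.≤ B → two-sided B (λ r → w r * count r n) ≡ W w n
two-sided-count B w n n≤B = begin
  two-sided B (λ r → w r * count r n) ≡⟨ two-sided-cong B (λ r → sym (W-* (w r) (λ ρ → ι (r - ρ)) n)) ⟩
  two-sided B (λ r → total (λ p → w r * ι (r - rank p)) (partitions n)) ≡⟨ exchange (partitions n) ⟩
  W (λ ρ → two-sided B (λ r → w r * ι (r - ρ))) n ≡⟨ W-cong _ _ n (λ ρ ρ≤n → trans (two-sided-single B (λ r → w r * ι (r - ρ)) ρ (ℕₚ.≤-trans ρ≤n n≤B) (λ r r≢ρ → trans (cong (w r *_) (ι-off r ρ r≢ρ)) (ℤₚ.*-zeroʳ (w r)))) (trans (cong (w ρ *_) (ι-diagonal ρ)) (ℤₚ.*-identityʳ (w ρ)))) ⟩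
  W w n ∎
  where
  open ≡-Reasoning
  exchange : ∀ xs → two-sided B (λ r → total (λ p → w r * ι (r - rank p)) xs) ≡ total (λ p → two-sided B (λ r → w r * ι (r - rank p))) xs
  exchange [] = two-sided-0 B
  exchange (p ∷ xs) = trans (two-sided-+ B (λ r → w r * ι (r - rank p)) (λ r → total (λ p → w r * ι (r - rank p)) xs)) (cong (_+_ (two-sided B (λ r → w r * ι (r - rank p)))) (exchange xs))

count-symmetric : ∀ m n → count (- m) n ≡ count m n
count-symmetric m n = begin
  count (- m) n ≡⟨ sym (count-Q (- m) n) ⟩
  Q (- m) n - Q (- m - 1ℤ) n ≡⟨ cong₂ (λ x y → Q x n - Q y n) (first m) (second m) ⟩
  Q (- 1ℤ - (m - 1ℤ)) n - Q (- 1ℤ - m) n ≡⟨ combine (Q (m - 1ℤ) n) (Q (- 1ℤ - (m - 1ℤ)) n) (Q m n) (Q (- 1ℤ - m) n) (P n) (defect≡0 (m - 1ℤ) (+ n)) (defect≡0 m (+ n)) ⟩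
  Q m n - Q (m - 1ℤ) n ≡⟨ count-Q m n ⟩
  count m n ∎
  where
  open ≡-Reasoning
  first : ∀ m → - m ≡ - 1ℤ - (m - 1ℤ)
  first = solve-∀
  second : ∀ m → - m - 1ℤ ≡ - 1ℤ - m
  second = solve-∀
  combine : ∀ a b c d p → a + b - p ≡ 0ℤ → c + d - p ≡ 0ℤ → b - d ≡ c - a
  combine a b c d p e f = trans (split a b c d p) (trans (cong₂ (λ x y → x - y + (c - a)) e f) (ℤₚ.+-identityˡ _))
    where
    split : ∀ a b c d p → b - d ≡ (a + b - p) - (c + d - p) + (c - a)
    split = solve-∀

W-reflect : ∀ w n → W (λ ρ → w (- ρ)) n ≡ W w n
W-reflect w n = begin
  W (λ ρ → w (- ρ)) n ≡⟨ sym (two-sided-count n (λ ρ → w (- ρ)) n ℕₚ.≤-refl) ⟩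
  two-sided n (λ r → w (- r) * count r n) ≡⟨ two-sided-cong n (λ r → cong (w (- r) *_) (sym (count-symmetric r n))) ⟩
  two-sided n (λ r → w (- r) * count (- r) n) ≡⟨ two-sided-reflect n (λ r → w r * count r n) ⟩
  two-sided n (λ r → w r * count r n) ≡⟨ two-sided-count n w n ℕₚ.≤-refl ⟩
  W w n ∎
  where open ≡-Reasoning

-- The third difference of G only involves rank counts; it is recentred so that its theta transform sits at 0.
R : Array
R r n = D (D (D G)) (1ℤ + r) n

countℤ : Array
countℤ r n = Qℤ r n - Qℤ (r - 1ℤ) n

-- The weight is quadratic in m, so its third difference is zero. The coefficients of the four
-- values of Q therefore add up to zero, and only differences of consecutive values are left.
R-count : ∀ r n → R r n ≡ weight (r + 1ℤ) n * countℤ (r + 1ℤ) n + (+ 2 - + 2 * (r * r) - + 12 * n) * countℤ r n + weight (- (r - 1ℤ)) n * countℤ (r - 1ℤ) n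
R-count r n = trans (cong (λ x → D (D (D G)) x n) (ℤₚ.+-comm 1ℤ r)) (trans (expand (Qℤ (r + 1ℤ) n) (Qℤ (r + 1ℤ - 1ℤ) n) (Qℤ (r + 1ℤ - 1ℤ - 1ℤ) n) (Qℤ (r + 1ℤ - 1ℤ - 1ℤ - 1ℤ) n) r n)
  (cong (λ x → weight (r + 1ℤ) n * (Qℤ (r + 1ℤ) n - Qℤ (r + 1ℤ - 1ℤ) n) + (+ 2 - + 2 * (r * r) - + 12 * n) * (Qℤ x n - Qℤ (x - 1ℤ) n) + weight (- (r - 1ℤ)) n * (Qℤ (x - 1ℤ) n - Qℤ (x - 1ℤ - 1ℤ) n)) (cancel r)))
  where
  cancel : ∀ r → r + 1ℤ - 1ℤ ≡ r
  cancel = solve-∀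
  expand : ∀ a b c d r n →
    (((r + 1ℤ) * (r + 1ℤ + 1ℤ) + + 6 * n) * a - ((r + 1ℤ - 1ℤ) * (r + 1ℤ - 1ℤ + 1ℤ) + + 6 * n) * b
      - (((r + 1ℤ - 1ℤ) * (r + 1ℤ - 1ℤ + 1ℤ) + + 6 * n) * b - ((r + 1ℤ - 1ℤ - 1ℤ) * (r + 1ℤ - 1ℤ - 1ℤ + 1ℤ) + + 6 * n) * c))
    - ((((r + 1ℤ - 1ℤ) * (r + 1ℤ - 1ℤ + 1ℤ) + + 6 * n) * b - ((r + 1ℤ - 1ℤ - 1ℤ) * (r + 1ℤ - 1ℤ - 1ℤ + 1ℤ) + + 6 * n) * c)
      - (((r + 1ℤ - 1ℤ - 1ℤ) * (r + 1ℤ - 1ℤ - 1ℤ + 1ℤ) + + 6 * n) * c - ((r + 1ℤ - 1ℤ - 1ℤ - 1ℤ) * (r + 1ℤ - 1ℤ - 1ℤ - 1ℤ + 1ℤ) + + 6 * n) * d))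
    ≡ ((r + 1ℤ) * (r + 1ℤ + 1ℤ) + + 6 * n) * (a - b) + (+ 2 - + 2 * (r * r) - + 12 * n) * (b - c) + (- (r - 1ℤ) * (- (r - 1ℤ) + 1ℤ) + + 6 * n) * (c - d)
  expand = solve-∀

R-vanishing : Vanishing R
R-vanishing r k = trans (R-count r -[1+ k ]) (zeros (weight (r + 1ℤ) -[1+ k ]) (+ 2 - + 2 * (r * r) - + 12 * -[1+ k ]) (weight (- (r - 1ℤ)) -[1+ k ]))
  where
  zeros : ∀ a b c → a * 0ℤ + b * 0ℤ + c * 0ℤ ≡ 0ℤ
  zeros = solve-∀

countℤ-within : ∀ n → Within n (λ r → countℤ r (+ n))
countℤ-within n r h = trans (count-Q r n) (count-within n r h)

R-narrow : Narrow R
R-narrow r n h = trans (R-count r (+ n)) (trans (cong₃ (Within-far {n} {λ r → countℤ r (+ n)} (countℤ-within n) r 1 h′) (countℤ-within n r (ℕₚ.<-trans (ℕₚ.n<1+n n) h)) (Within-far⁻ {n} {λ r → countℤ r (+ n)} (countℤ-within n) r 1 h′))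
  (zeros (weight (r + 1ℤ) (+ n)) (+ 2 - + 2 * (r * r) - + 12 * + n) (weight (- (r - 1ℤ)) (+ n))))
  where
  h′ : n ℕ.+ 1 ℕ.< ℤ.∣ r ∣
  h′ = subst (ℕ._< ℤ.∣ r ∣) (ℕₚ.+-comm 1 n) h
  cong₃ : ∀ {a b c} → a ≡ 0ℤ → b ≡ 0ℤ → c ≡ 0ℤ → weight (r + 1ℤ) (+ n) * a + (+ 2 - + 2 * (r * r) - + 12 * + n) * b + weight (- (r - 1ℤ)) (+ n) * c ≡ weight (r + 1ℤ) (+ n) * 0ℤ + (+ 2 - + 2 * (r * r) - + 12 * + n) * 0ℤ + weight (- (r - 1ℤ)) (+ n) * 0ℤ
  cong₃ refl refl refl = refl
  zeros : ∀ a b c → a * 0ℤ + b * 0ℤ + c * 0ℤ ≡ 0ℤ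
  zeros = solve-∀

-- The total weight that a partition of rank r receives after the three neighbouring terms of
-- `R-count` are shifted back to r.
ω : ℕ → ℤ → ℤ → ℤ
ω l n r = v (r - 1ℤ) l * weight r n + v r l * (+ 2 - + 2 * (r * r) - + 12 * n) + v (r + 1ℤ) l * weight (- r) n

L-R : ∀ l n → L R l n ≡ W (ω l (+ n)) n
L-R l n = begin
  two-sided B (λ r → v r l * R r (+ n)) ≡⟨ two-sided-cong B (λ r → trans (cong (v r l *_) (R-count r (+ n))) (distribute (v r l) (weight (r + 1ℤ) (+ n)) (countℤ (r + 1ℤ) (+ n)) (middle r) (countℤ r (+ n)) (weight (- (r - 1ℤ)) (+ n)) (countℤ (r - 1ℤ) (+ n)))) ⟩
  two-sided B (λ r → v r l * weight (r + 1ℤ) (+ n) * countℤ (r + 1ℤ) (+ n) + v r l * middle r * countℤ r (+ n) + v r l * weight (- (r - 1ℤ)) (+ n) * countℤ (r - 1ℤ) (+ n))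
    ≡⟨ trans (two-sided-+ B (λ r → v r l * weight (r + 1ℤ) (+ n) * countℤ (r + 1ℤ) (+ n) + v r l * middle r * countℤ r (+ n)) (λ r → v r l * weight (- (r - 1ℤ)) (+ n) * countℤ (r - 1ℤ) (+ n)))
         (cong₂ _+_ (trans (two-sided-+ B (λ r → v r l * weight (r + 1ℤ) (+ n) * countℤ (r + 1ℤ) (+ n)) (λ r → v r l * middle r * countℤ r (+ n))) (cong (_+ two-sided B (λ r → v r l * middle r * countℤ r (+ n))) up)) down) ⟩
  two-sided B (λ r → v (r - 1ℤ) l * weight r (+ n) * countℤ r (+ n)) + two-sided B (λ r → v r l * middle r * countℤ r (+ n)) + two-sided B (λ r → v (r + 1ℤ) l * weight (- r) (+ n) * countℤ r (+ n))
    ≡⟨ sym (trans (two-sided-+ B (λ r → v (r - 1ℤ) l * weight r (+ n) * countℤ r (+ n) + v r l * middle r * countℤ r (+ n)) (λ r → v (r + 1ℤ) l * weight (- r) (+ n) * countℤ r (+ n)))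
         (cong (_+ two-sided B (λ r → v (r + 1ℤ) l * weight (- r) (+ n) * countℤ r (+ n))) (two-sided-+ B (λ r → v (r - 1ℤ) l * weight r (+ n) * countℤ r (+ n)) (λ r → v r l * middle r * countℤ r (+ n))))) ⟩
  two-sided B (λ r → v (r - 1ℤ) l * weight r (+ n) * countℤ r (+ n) + v r l * middle r * countℤ r (+ n) + v (r + 1ℤ) l * weight (- r) (+ n) * countℤ r (+ n))
    ≡⟨ two-sided-cong B (λ r → trans (collect (v (r - 1ℤ) l * weight r (+ n)) (v r l * middle r) (v (r + 1ℤ) l * weight (- r) (+ n)) (countℤ r (+ n))) (cong (ω l (+ n) r *_) (count-Q r n))) ⟩
  two-sided B (λ r → ω l (+ n) r * count r n) ≡⟨ two-sided-count B (ω l (+ n)) n (ℕₚ.n≤1+n n) ⟩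
  W (ω l (+ n)) n ∎
  where
  open ≡-Reasoning
  B : ℕ
  B = suc n
  middle : ℤ → ℤ
  middle r = + 2 - + 2 * (r * r) - + 12 * + n
  distribute : ∀ v a x b y c z → v * (a * x + b * y + c * z) ≡ v * a * x + v * b * y + v * c * z
  distribute = solve-∀
  collect : ∀ a b c x → a * x + b * x + c * x ≡ (a + b + c) * x
  collect = solve-∀
  n+1≤B : n ℕ.+ 1 ℕ.≤ B
  n+1≤B = ℕₚ.≤-reflexive (ℕₚ.+-comm n 1)
  plus-minus : ∀ r → r + 1ℤ - 1ℤ ≡ r
  plus-minus = solve-∀
  minus-plus : ∀ r → r - 1ℤ + 1ℤ ≡ r
  minus-plus = solve-∀
  up : two-sided B (λ r → v r l * weight (r + 1ℤ) (+ n) * countℤ (r + 1ℤ) (+ n)) ≡ two-sided B (λ r → v (r - 1ℤ) l * weight r (+ n) * countℤ r (+ n))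
  up = trans (two-sided-cong B (λ r → cong (λ x → v x l * weight (r + 1ℤ) (+ n) * countℤ (r + 1ℤ) (+ n)) (sym (plus-minus r))))
    (two-sided-shift {n} {B} {λ r → v (r - 1ℤ) l * weight r (+ n) * countℤ r (+ n)} (λ r h → trans (cong (v (r - 1ℤ) l * weight r (+ n) *_) (countℤ-within n r h)) (ℤₚ.*-zeroʳ (v (r - 1ℤ) l * weight r (+ n)))) 1 n+1≤B)
  down : two-sided B (λ r → v r l * weight (- (r - 1ℤ)) (+ n) * countℤ (r - 1ℤ) (+ n)) ≡ two-sided B (λ r → v (r + 1ℤ) l * weight (- r) (+ n) * countℤ r (+ n))
  down = trans (two-sided-cong B (λ r → cong (λ x → v x l * weight (- (r - 1ℤ)) (+ n) * countℤ (r - 1ℤ) (+ n)) (sym (minus-plus r))))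
    (two-sided-shift⁻ {n} {B} {λ r → v (r + 1ℤ) l * weight (- r) (+ n) * countℤ r (+ n)} (λ r h → trans (cong (v (r + 1ℤ) l * weight (- r) (+ n) *_) (countℤ-within n r h)) (ℤₚ.*-zeroʳ (v (r + 1ℤ) l * weight (- r) (+ n)))) 1 n+1≤B)

K-recentred : ∀ r n → theta (theta (theta R)) r n ≡ K (1ℤ + r) n
K-recentred r n = begin
  theta (theta (theta R)) r n ≡⟨ theta-cong (theta-cong (theta-translate 1ℤ (D (D (D G))))) r n ⟩
  theta (theta (λ r n → theta (D (D (D G))) (1ℤ + r) n)) r n ≡⟨ theta-cong (theta-translate 1ℤ (theta (D (D (D G))))) r n ⟩
  theta (λ r n → theta (theta (D (D (D G)))) (1ℤ + r) n) r n ≡⟨ theta-translate 1ℤ (theta (theta (D (D (D G))))) r n ⟩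
  theta (theta (theta (D (D (D G))))) (1ℤ + r) n ≡⟨ sym (K-theta (1ℤ + r) n) ⟩
  K (1ℤ + r) n ∎
  where open ≡-Reasoning

⋆-congʳ : ∀ A {B C : ℕ → Series} → (∀ l n → B l n ≡ C l n) → ∀ l n → (A ⋆ B) l n ≡ (A ⋆ C) l n
⋆-congʳ A {B} {C} e zero n = trans (∙-comm (A 0) (B 0) n) (trans (∙-congˡ-≡ (A 0) (e 0) n) (∙-comm (C 0) (A 0) n))
⋆-congʳ A {B} {C} e (suc l) n = cong₂ _+_ (trans (∙-comm (A 0) (B (suc l)) n) (trans (∙-congˡ-≡ (A 0) (e (suc l)) n) (∙-comm (C (suc l)) (A 0) n))) (⋆-congʳ (A ∘ suc) e l n)

-- The rank-crank identity of Atkin and Garvan, one power of y at a time.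
Θ³⋆L-R : ∀ l n → (Θ ⋆ (Θ ⋆ (Θ ⋆ L R))) (suc l) n ≡ 0ℤ
Θ³⋆L-R l n = begin
  (Θ ⋆ (Θ ⋆ (Θ ⋆ L R))) (suc l) n ≡⟨ ⋆-congʳ Θ (⋆-congʳ Θ (λ l n → sym (L-theta {R} R-vanishing R-narrow l n))) (suc l) n ⟩
  (Θ ⋆ (Θ ⋆ L (theta R))) (suc l) n ≡⟨ ⋆-congʳ Θ (λ l n → sym (L-theta {theta R} v₁ n₁ l n)) (suc l) n ⟩
  (Θ ⋆ L (theta (theta R))) (suc l) n ≡⟨ sym (L-theta {theta (theta R)} (theta-vanishing {theta R} v₁) (theta-narrow {theta R} v₁ n₁) (suc l) n) ⟩
  L (theta (theta (theta R))) (suc l) n ≡⟨ two-sided-cong (suc n) (λ r → cong (v r (suc l) *_) (K-recentred r (+ n))) ⟩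
  -- Only r = 0 survives, and `v 0` is the constant 2, without positive powers of y.
  two-sided (suc n) (λ r → v r (suc l) * K (1ℤ + r) (+ n)) ≡⟨ two-sided-single (suc n) (λ r → v r (suc l) * K (1ℤ + r) (+ n)) 0ℤ z≤n (λ r r≢0 → trans (cong (v r (suc l) *_) (K≡0 (1ℤ + r) (+ n) (λ e → r≢0 (trans (cancel r) (cong (_- 1ℤ) e))))) (ℤₚ.*-zeroʳ (v r (suc l)))) ⟩
  0ℤ ∎
  where
  open ≡-Reasoning
  v₁ = theta-vanishing {R} R-vanishing
  n₁ = theta-narrow {R} R-vanishing R-narrow
  cancel : ∀ r → r ≡ 1ℤ + r - 1ℤ
  cancel = solve-∀

-- The coefficients of y, y², y³, y⁴ in zʳ + z⁻ʳ

v-positive : ∀ m l → + ((l ℕ.+ l) !) * ((1ℤ + + l + + l) * v (+ suc m) l) ≡ (1ℤ + (1ℤ + + m) + (1ℤ + + m)) * falling (1ℤ + + m + + l) (l ℕ.+ l) - (1ℤ + + m + + m) * falling (+ m + + l) (l ℕ.+ l)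
v-positive m l = trans (distribute (+ ((l ℕ.+ l) !)) (1ℤ + + l + + l) (χ (suc m) l) (χ m l)) (cong₂ _-_ (trans (χ-falling (suc m) l) (cong (λ x → (1ℤ + x + x) * falling (x + + l) (l ℕ.+ l)) (ℤₚ.pos-+ 1 m))) (χ-falling m l))
  where
  distribute : ∀ a b x y → a * (b * (x - y)) ≡ a * (b * x) - a * (b * y)
  distribute = solve-∀

v-polynomial : ∀ c l (p : ℤ → ℤ) → (∀ m → c * v (+ suc m) (suc l) ≡ p (1ℤ + + m)) → p 0ℤ ≡ 0ℤ → (∀ x → p (- x) ≡ p x) → ∀ r → c * v r (suc l) ≡ p r
v-polynomial c l p pos zeroth even (+ zero) = trans (ℤₚ.*-zeroʳ c) (sym zeroth)
v-polynomial c l p pos zeroth even (+ suc m) = trans (pos m) (cong p (sym (ℤₚ.pos-+ 1 m)))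
v-polynomial c l p pos zeroth even -[1+ m ] = trans (pos m) (trans (cong p (sym (ℤₚ.pos-+ 1 m))) (sym (even (+ suc m))))

v₀ : ∀ r → v r 0 ≡ + 2
v₀ (+ zero) = refl
v₀ (+ suc m) = difference m
  where
  difference : ∀ m → χ (suc m) 0 - χ m 0 ≡ + 2
  difference m = trans (cong₂ _-_ (trans (χ₀ (suc m)) (cong (λ x → 1ℤ + x + x) (ℤₚ.pos-+ 1 m))) (χ₀ m)) (cancel (+ m))
    where
    cancel : ∀ m → 1ℤ + (1ℤ + m) + (1ℤ + m) - (1ℤ + m + m) ≡ + 2
    cancel = solve-∀
v₀ -[1+ m ] = v₀ (+ suc m)

p₁ : ℤ → ℤ
p₁ x = x * x

v₁ : ∀ r → + 1 * v r 1 ≡ p₁ r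
v₁ = v-polynomial (+ 1) 0 p₁ positive refl even
  where
  even : ∀ x → (- x) * (- x) ≡ x * x
  even = solve-∀
  left : ∀ a → + 6 * (+ 1 * a) ≡ + 2 * ((1ℤ + 1ℤ + 1ℤ) * a)
  left = solve-∀
  right : ∀ m → (1ℤ + (1ℤ + m) + (1ℤ + m)) * (1ℤ * (1ℤ + m + 1ℤ - 0ℤ) * (1ℤ + m + 1ℤ - 1ℤ)) - (1ℤ + m + m) * (1ℤ * (m + 1ℤ - 0ℤ) * (m + 1ℤ - 1ℤ)) ≡ + 6 * ((1ℤ + m) * (1ℤ + m))
  right = solve-∀
  positive : ∀ m → + 1 * v (+ suc m) 1 ≡ p₁ (1ℤ + + m)
  positive m = ℤₚ.*-cancelˡ-≡ (+ 6) _ _ (trans (left (v (+ suc m) 1)) (trans (v-positive m 1) (right (+ m))))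

p₂ : ℤ → ℤ
p₂ x = x * x * (x * x - + 1)

v₂ : ∀ r → + 12 * v r 2 ≡ p₂ r
v₂ = v-polynomial (+ 12) 1 p₂ positive refl even
  where
  even : ∀ x → (- x) * (- x) * ((- x) * (- x) - + 1) ≡ x * x * (x * x - + 1)
  even = solve-∀
  left : ∀ a → + 10 * (+ 12 * a) ≡ + 24 * ((1ℤ + + 2 + + 2) * a)
  left = solve-∀
  right : ∀ m → (1ℤ + (1ℤ + m) + (1ℤ + m)) * (1ℤ * (1ℤ + m + + 2 - 0ℤ) * (1ℤ + m + + 2 - 1ℤ) * (1ℤ + m + + 2 - + 2) * (1ℤ + m + + 2 - + 3)) - (1ℤ + m + m) * (1ℤ * (m + + 2 - 0ℤ) * (m + + 2 - 1ℤ) * (m + + 2 - + 2) * (m + + 2 - + 3)) ≡ + 10 * ((1ℤ + m) * (1ℤ + m) * ((1ℤ + m) * (1ℤ + m) - + 1))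
  right = solve-∀
  positive : ∀ m → + 12 * v (+ suc m) 2 ≡ p₂ (1ℤ + + m)
  positive m = ℤₚ.*-cancelˡ-≡ (+ 10) _ _ (trans (left (v (+ suc m) 2)) (trans (v-positive m 2) (right (+ m))))

p₃ : ℤ → ℤ
p₃ x = x * x * (x * x - + 1) * (x * x - + 4)

v₃ : ∀ r → + 360 * v r 3 ≡ p₃ r
v₃ = v-polynomial (+ 360) 2 p₃ positive refl even
  where
  even : ∀ x → (- x) * (- x) * ((- x) * (- x) - + 1) * ((- x) * (- x) - + 4) ≡ x * x * (x * x - + 1) * (x * x - + 4)
  even = solve-∀
  left : ∀ a → + 14 * (+ 360 * a) ≡ + 720 * ((1ℤ + + 3 + + 3) * a)
  left = solve-∀
  right : ∀ m → (1ℤ + (1ℤ + m) + (1ℤ + m)) * (1ℤ * (1ℤ + m + + 3 - 0ℤ) * (1ℤ + m + + 3 - 1ℤ) * (1ℤ + m + + 3 - + 2) * (1ℤ + m + + 3 - + 3) * (1ℤ + m + + 3 - + 4) * (1ℤ + m + + 3 - + 5)) - (1ℤ + m + m) * (1ℤ * (m + + 3 - 0ℤ) * (m + + 3 - 1ℤ) * (m + + 3 - + 2) * (m + + 3 - + 3) * (m + + 3 - + 4) * (m + + 3 - + 5)) ≡ + 14 * ((1ℤ + m) * (1ℤ + m) * ((1ℤ + m) * (1ℤ + m) - + 1) * ((1ℤ + m) * (1ℤ + m) - + 4))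
  right = solve-∀
  positive : ∀ m → + 360 * v (+ suc m) 3 ≡ p₃ (1ℤ + + m)
  positive m = ℤₚ.*-cancelˡ-≡ (+ 14) _ _ (trans (left (v (+ suc m) 3)) (trans (v-positive m 3) (right (+ m))))

p₄ : ℤ → ℤ
p₄ x = x * x * (x * x - + 1) * (x * x - + 4) * (x * x - + 9)

v₄ : ∀ r → + 20160 * v r 4 ≡ p₄ r
v₄ = v-polynomial (+ 20160) 3 p₄ positive refl even
  where
  even : ∀ x → (- x) * (- x) * ((- x) * (- x) - + 1) * ((- x) * (- x) - + 4) * ((- x) * (- x) - + 9) ≡ x * x * (x * x - + 1) * (x * x - + 4) * (x * x - + 9)
  even = solve-∀
  left : ∀ a → + 18 * (+ 20160 * a) ≡ + 40320 * ((1ℤ + + 4 + + 4) * a)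
  left = solve-∀
  right : ∀ m → (1ℤ + (1ℤ + m) + (1ℤ + m)) * (1ℤ * (1ℤ + m + + 4 - 0ℤ) * (1ℤ + m + + 4 - 1ℤ) * (1ℤ + m + + 4 - + 2) * (1ℤ + m + + 4 - + 3) * (1ℤ + m + + 4 - + 4) * (1ℤ + m + + 4 - + 5) * (1ℤ + m + + 4 - + 6) * (1ℤ + m + + 4 - + 7)) - (1ℤ + m + m) * (1ℤ * (m + + 4 - 0ℤ) * (m + + 4 - 1ℤ) * (m + + 4 - + 2) * (m + + 4 - + 3) * (m + + 4 - + 4) * (m + + 4 - + 5) * (m + + 4 - + 6) * (m + + 4 - + 7)) ≡ + 18 * ((1ℤ + m) * (1ℤ + m) * ((1ℤ + m) * (1ℤ + m) - + 1) * ((1ℤ + m) * (1ℤ + m) - + 4) * ((1ℤ + m) * (1ℤ + m) - + 9))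
  right = solve-∀
  positive : ∀ m → + 20160 * v (+ suc m) 4 ≡ p₄ (1ℤ + + m)
  positive m = ℤₚ.*-cancelˡ-≡ (+ 18) _ _ (trans (left (v (+ suc m) 4)) (trans (v-positive m 4) (right (+ m))))

moment : ℕ → Series
moment l = W (λ r → v r l)

ω₀ : ∀ n r → ω 0 n r ≡ + 4
ω₀ n r = trans (cong₃ (v₀ (r - 1ℤ)) (v₀ r) (v₀ (r + 1ℤ))) (identity r n)
  where
  cong₃ : ∀ {a a′ b b′ c c′} → a ≡ a′ → b ≡ b′ → c ≡ c′ → a * weight r n + b * (+ 2 - + 2 * (r * r) - + 12 * n) + c * weight (- r) n ≡ a′ * weight r n + b′ * (+ 2 - + 2 * (r * r) - + 12 * n) + c′ * weight (- r) n
  cong₃ refl refl refl = refl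
  identity : ∀ r n → + 2 * (r * (r + 1ℤ) + + 6 * n) + + 2 * (+ 2 - + 2 * (r * r) - + 12 * n) + + 2 * (- r * (- r + 1ℤ) + + 6 * n) ≡ + 4
  identity = solve-∀

ω-scaled : ∀ c l (p : ℤ → ℤ) → (∀ r → c * v r l ≡ p r) → ∀ n r → c * ω l n r ≡ p (r - 1ℤ) * weight r n + p r * (+ 2 - + 2 * (r * r) - + 12 * n) + p (r + 1ℤ) * weight (- r) n
ω-scaled c l p h n r = trans (distribute c (v (r - 1ℤ) l) (weight r n) (v r l) (+ 2 - + 2 * (r * r) - + 12 * n) (v (r + 1ℤ) l) (weight (- r) n)) (cong₃ (h (r - 1ℤ)) (h r) (h (r + 1ℤ)))
  where
  distribute : ∀ c x a y b z d → c * (x * a + y * b + z * d) ≡ c * x * a + c * y * b + c * z * d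
  distribute = solve-∀
  cong₃ : ∀ {a a′ b b′ d d′} → a ≡ a′ → b ≡ b′ → d ≡ d′ → a * weight r n + b * (+ 2 - + 2 * (r * r) - + 12 * n) + d * weight (- r) n ≡ a′ * weight r n + b′ * (+ 2 - + 2 * (r * r) - + 12 * n) + d′ * weight (- r) n
  cong₃ refl refl refl = refl

ω₁ : ∀ n r → ω 1 n r ≡ + 12 * n
ω₁ n r = trans (sym (ℤₚ.*-identityˡ (ω 1 n r))) (trans (ω-scaled (+ 1) 1 p₁ v₁ n r) (identity r n))
  where
  identity : ∀ r n → (r - 1ℤ) * (r - 1ℤ) * (r * (r + 1ℤ) + + 6 * n) + r * r * (+ 2 - + 2 * (r * r) - + 12 * n) + (r + 1ℤ) * (r + 1ℤ) * (- r * (- r + 1ℤ) + + 6 * n) ≡ + 12 * n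
  identity = solve-∀

-- The leading coefficient 20 is divisible by 5, so modulo 5 the coefficient of y³ only sees
-- `moment 2`, the one belonging to η₄.
ω₃ : ∀ n r → ω 3 n r ≡ + 20 * v r 3 + (+ 6 * n + + 2) * v r 2
ω₃ n r = ℤₚ.*-cancelˡ-≡ (+ 360) _ _ (trans (ω-scaled (+ 360) 3 p₃ v₃ n r) (trans (identity r n) (trans (cong₂ (λ a b → + 20 * a + (+ 6 * n + + 2) * (+ 30 * b)) (sym (v₃ r)) (sym (v₂ r))) (regroup n (v r 3) (v r 2)))))
  where
  identity : ∀ r n → (r - 1ℤ) * (r - 1ℤ) * ((r - 1ℤ) * (r - 1ℤ) - + 1) * ((r - 1ℤ) * (r - 1ℤ) - + 4) * (r * (r + 1ℤ) + + 6 * n) + r * r * (r * r - + 1) * (r * r - + 4) * (+ 2 - + 2 * (r * r) - + 12 * n) + (r + 1ℤ) * (r + 1ℤ) * ((r + 1ℤ) * (r + 1ℤ) - + 1) * ((r + 1ℤ) * (r + 1ℤ) - + 4) * (- r * (- r + 1ℤ) + + 6 * n) ≡ + 20 * (r * r * (r * r - + 1) * (r * r - + 4)) + (+ 6 * n + + 2) * (+ 30 * (r * r * (r * r - + 1)))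
  identity = solve-∀
  regroup : ∀ n a b → + 20 * (+ 360 * a) + (+ 6 * n + + 2) * (+ 30 * (+ 12 * b)) ≡ + 360 * (+ 20 * a + (+ 6 * n + + 2) * b)
  regroup = solve-∀

-- Likewise 42 is divisible by 7, leaving `moment 3`, the one belonging to η₆.
ω₄ : ∀ n r → ω 4 n r ≡ + 42 * v r 4 + (+ 6 * n + + 6) * v r 3
ω₄ n r = ℤₚ.*-cancelˡ-≡ (+ 20160) _ _ (trans (ω-scaled (+ 20160) 4 p₄ v₄ n r) (trans (identity r n) (trans (cong₂ (λ a b → + 42 * a + (+ 6 * n + + 6) * (+ 56 * b)) (sym (v₄ r)) (sym (v₃ r))) (regroup n (v r 4) (v r 3)))))
  where
  identity : ∀ r n → (r - 1ℤ) * (r - 1ℤ) * ((r - 1ℤ) * (r - 1ℤ) - + 1) * ((r - 1ℤ) * (r - 1ℤ) - + 4) * ((r - 1ℤ) * (r - 1ℤ) - + 9) * (r * (r + 1ℤ) + + 6 * n) + r * r * (r * r - + 1) * (r * r - + 4) * (r * r - + 9) * (+ 2 - + 2 * (r * r) - + 12 * n) + (r + 1ℤ) * (r + 1ℤ) * ((r + 1ℤ) * (r + 1ℤ) - + 1) * ((r + 1ℤ) * (r + 1ℤ) - + 4) * ((r + 1ℤ) * (r + 1ℤ) - + 9) * (- r * (- r + 1ℤ) + + 6 * n) ≡ + 42 * (r * r * (r * r - + 1) * (r * r - + 4) * (r * r - + 9)) + (+ 6 * n + + 6) * (+ 56 * (r * r * (r * r - + 1) * (r * r - + 4)))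
  identity = solve-∀
  regroup : ∀ n a b → + 42 * (+ 20160 * a) + (+ 6 * n + + 6) * (+ 56 * (+ 360 * b)) ≡ + 20160 * (+ 42 * a + (+ 6 * n + + 6) * b)
  regroup = solve-∀

L-R₀ : ∀ n → L R 0 n ≡ + 4 * P n
L-R₀ n = trans (L-R 0 n) (trans (W-cong _ _ n (λ r _ → ω₀ (+ n) r)) (W-* (+ 4) (λ _ → 1ℤ) n))

L-R₁ : ∀ n → L R 1 n ≡ + 12 * δ P n
L-R₁ n = trans (L-R 1 n) (trans (W-cong _ _ n (λ r _ → trans (ω₁ (+ n) r) (sym (ℤₚ.*-identityʳ (+ 12 * + n))))) (trans (W-* (+ 12 * + n) (λ _ → 1ℤ) n) (ℤₚ.*-assoc (+ 12) (+ n) (P n))))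

L-R₃ : ∀ n → L R 3 n ≡ + 20 * moment 3 n + (+ 6 * + n + + 2) * moment 2 n
L-R₃ n = trans (L-R 3 n) (trans (W-cong _ _ n (λ r _ → ω₃ (+ n) r)) (trans (W-+ (λ r → + 20 * v r 3) (λ r → (+ 6 * + n + + 2) * v r 2) n) (cong₂ _+_ (W-* (+ 20) (λ r → v r 3) n) (W-* (+ 6 * + n + + 2) (λ r → v r 2) n))))

L-R₄ : ∀ n → L R 4 n ≡ + 42 * moment 4 n + (+ 6 * + n + + 6) * moment 3 n
L-R₄ n = trans (L-R 4 n) (trans (W-cong _ _ n (λ r _ → ω₄ (+ n) r)) (trans (W-+ (λ r → + 42 * v r 4) (λ r → (+ 6 * + n + + 6) * v r 3) n) (cong₂ _+_ (W-* (+ 42) (λ r → v r 4) n) (W-* (+ 6 * + n + + 6) (λ r → v r 3) n))))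

-- Jacobi's identity and division by the cube of theta

unit-cancel : ∀ x y → x 0 ≡ 1ℤ → (∀ n → (x ∙ y) n ≡ 0ℤ) → ∀ n → y n ≡ 0ℤ
unit-cancel x y x₀ e n = go n n ℕₚ.≤-refl
  where
  step : ∀ n → (x ∙ y) n ≡ 0ℤ → (∀ i → i ℕ.< n → y i ≡ 0ℤ) → y n ≡ 0ℤ
  step zero e _ = trans (sym (trans (cong (_* y 0) x₀) (ℤₚ.*-identityˡ (y 0)))) e
  step (suc n) e lower = trans (sym (trans (cong₂ _+_ (trans (cong (_* y (suc n)) x₀) (ℤₚ.*-identityˡ (y (suc n))))
    (trans (∙-comm (tail x) y n) (trans (∙-cong-≤ {y} {λ _ → 0ℤ} (tail x) n (λ i i≤n → lower i (s≤s i≤n))) (𝟘-∙ (tail x) n)))) (ℤₚ.+-identityʳ (y (suc n))))) e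
  go : ∀ n i → i ℕ.≤ n → y i ≡ 0ℤ
  go zero zero _ = step 0 (e 0) (λ i ())
  go (suc n) i i≤n with i ℕ.≟ suc n
  ... | yes refl = step (suc n) (e (suc n)) (λ j j<n → go n j (ℕₚ.≤-pred j<n))
  ... | no i≢n = go n i (ℕₚ.≤-pred (ℕₚ.≤∧≢⇒< i≤n i≢n))

module Jacobi where

  open Mod 0ℤ
  open Solver
  open import Relation.Binary.Reasoning.Setoid setoid

  ≈⇒≡ : ∀ {x y} → x ≈ y → ∀ n → x n ≡ y n
  ≈⇒≡ {x} {y} e n with at e n
  ... | by q eq = trans eq (trans (cong (_+_ (y n)) (ℤₚ.*-zeroʳ q)) (ℤₚ.+-identityʳ (y n)))

  leibniz : ∀ x y → δ (x ∙ y) ≈ δ x ∙ y ⊕ x ∙ δ y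
  leibniz x y = ≈-reflexive (δ-∙ x y)

  first-coefficient : ∀ a₀ a₁ d b₀ b₁ P P′ → const (+ 3) ∙ a₁ ≈ d → b₀ ≈ const (+ 4) ∙ P → b₁ ≈ const (+ 12) ∙ P′ →
    a₀ ∙ (a₀ ∙ (a₀ ∙ b₁ ⊕ a₁ ∙ b₀) ⊕ a₁ ∙ (a₀ ∙ b₀)) ⊕ a₁ ∙ (a₀ ∙ (a₀ ∙ b₀)) ≈ a₀ ∙ (a₀ ∙ (const (+ 4) ∙ (const (+ 3) ∙ (a₀ ∙ P′) ⊕ d ∙ P)))
  first-coefficient a₀ a₁ d b₀ b₁ P P′ ea e₀ e₁ = begin
    a₀ ∙ (a₀ ∙ (a₀ ∙ b₁ ⊕ a₁ ∙ b₀) ⊕ a₁ ∙ (a₀ ∙ b₀)) ⊕ a₁ ∙ (a₀ ∙ (a₀ ∙ b₀))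
      ≈⟨ solve 4 (λ a₀ a₁ b₀ b₁ → a₀ :* (a₀ :* (a₀ :* b₁ :+ a₁ :* b₀) :+ a₁ :* (a₀ :* b₀)) :+ a₁ :* (a₀ :* (a₀ :* b₀)) := a₀ :* (a₀ :* (a₀ :* b₁ :+ con (+ 3) :* a₁ :* b₀))) ≈-refl a₀ a₁ b₀ b₁ ⟩
    a₀ ∙ (a₀ ∙ (a₀ ∙ b₁ ⊕ const (+ 3) ∙ a₁ ∙ b₀)) ≈⟨ ∙-cong (≈-refl {a₀}) (∙-cong (≈-refl {a₀}) (⊕-cong (∙-cong (≈-refl {a₀}) e₁) (∙-cong ea e₀))) ⟩
    a₀ ∙ (a₀ ∙ (a₀ ∙ (const (+ 12) ∙ P′) ⊕ d ∙ (const (+ 4) ∙ P)))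
      ≈⟨ solve 4 (λ a₀ d P P′ → a₀ :* (a₀ :* (a₀ :* (con (+ 12) :* P′) :+ d :* (con (+ 4) :* P))) := a₀ :* (a₀ :* (con (+ 4) :* (con (+ 3) :* (a₀ :* P′) :+ d :* P)))) ≈-refl a₀ d P P′ ⟩
    a₀ ∙ (a₀ ∙ (const (+ 4) ∙ (const (+ 3) ∙ (a₀ ∙ P′) ⊕ d ∙ P))) ∎

  δ-P³Θ₀ : ∀ P F → δ (P ∙ P ∙ P ∙ F) ≈ P ∙ P ∙ (const (+ 3) ∙ (F ∙ δ P) ⊕ δ F ∙ P)
  δ-P³Θ₀ P F = begin
    δ (P ∙ P ∙ P ∙ F) ≈⟨ leibniz (P ∙ P ∙ P) F ⟩
    δ (P ∙ P ∙ P) ∙ F ⊕ P ∙ P ∙ P ∙ δ F ≈⟨ ⊕-cong (∙-cong (≈-trans (leibniz (P ∙ P) P) (⊕-cong (∙-cong (leibniz P P) (≈-refl {P})) (≈-refl {P ∙ P ∙ δ P}))) (≈-refl {F})) (≈-refl {P ∙ P ∙ P ∙ δ F}) ⟩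
    ((δ P ∙ P ⊕ P ∙ δ P) ∙ P ⊕ P ∙ P ∙ δ P) ∙ F ⊕ P ∙ P ∙ P ∙ δ F
      ≈⟨ solve 4 (λ P p F f → ((p :* P :+ P :* p) :* P :+ P :* P :* p) :* F :+ P :* P :* P :* f := P :* P :* (con (+ 3) :* (F :* p) :+ f :* P)) ≈-refl P (δ P) F (δ F) ⟩
    P ∙ P ∙ (const (+ 3) ∙ (F ∙ δ P) ⊕ δ F ∙ P) ∎

  -- The coefficient of y in the rank-crank identity is 4 Θ₀² times this expression, and Θ₀ has
  -- constant term 1. Multiplied by P² it is the derivative of P³ Θ₀.
  logarithmic : ∀ n → (const (+ 3) ∙ (Θ 0 ∙ δ P) ⊕ δ (Θ 0) ∙ P) n ≡ 0ℤ
  logarithmic n = ℤₚ.*-cancelˡ-≡ (+ 4) _ _ (trans (sym (const-∙ (+ 4) z n)) (trans (unit-cancel (Θ 0) (const (+ 4) ∙ z) refl (unit-cancel (Θ 0) (Θ 0 ∙ (const (+ 4) ∙ z)) refl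
    (λ n → trans (sym (≈⇒≡ (first-coefficient (Θ 0) (Θ 1) (δ (Θ 0)) (L R 0) (L R 1) P (δ P) (≈-reflexive (λ n → trans (const-∙ (+ 3) (Θ 1) n) (Θ₁-δ n)))
      (≈-reflexive (λ n → trans (L-R₀ n) (sym (const-∙ (+ 4) P n)))) (≈-reflexive (λ n → trans (L-R₁ n) (sym (const-∙ (+ 12) (δ P) n))))) n)) (Θ³⋆L-R 0 n))) n) (sym (ℤₚ.*-zeroʳ (+ 4)))))
    where z = const (+ 3) ∙ (Θ 0 ∙ δ P) ⊕ δ (Θ 0) ∙ P

  jacobi : ∀ n → (P ∙ P ∙ P ∙ Θ 0) n ≡ 𝟙 n
  jacobi zero = refl
  jacobi (suc n) = ℤₚ.*-cancelˡ-≡ (+ suc n) _ _ (trans (≈⇒≡ (δ-P³Θ₀ P (Θ 0)) (suc n)) (trans (∙-comm (P ∙ P) z (suc n)) (trans (∙-congˡ-≡ {z} {λ _ → 0ℤ} (P ∙ P) logarithmic (suc n)) (trans (𝟘-∙ (P ∙ P) (suc n)) (sym (ℤₚ.*-zeroʳ (+ suc n)))))))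
    where z = const (+ 3) ∙ (Θ 0 ∙ δ P) ⊕ δ (Θ 0) ∙ P

-- Division by the cube of a power series in y

module Division (p : ℤ) where

  open Mod p
  open Solver
  open import Relation.Binary.Reasoning.Setoid setoid

  -- Coefficients are measured against a fixed series, so three successive divisions by a only
  -- transform the ratios.
  record Ratios (x : ℕ → Series) (x₀ r₁ r₂ r₃ r₄ : Series) : Set where
    constructor ratios
    field
      ratio₁ : x 1 ≈ r₁ ∙ x₀
      ratio₂ : x 2 ≈ r₂ ∙ x₀
      ratio₃ : x 3 ≈ r₃ ∙ x₀
      ratio₄ : x 4 ≈ r₄ ∙ x₀

  open Ratios public

  module _ (a : ℕ → Series) (c : Series) (ca : c ∙ a 0 ≈ 𝟙) where

    s : ℕ → Series
    s l = c ∙ a l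

    quotient₁ : Series → Series
    quotient₁ r₁ = r₁ ⊕ ⊖ s 1

    quotient₂ : Series → Series → Series
    quotient₂ r₁ r₂ = r₂ ⊕ ⊖ (s 1 ∙ quotient₁ r₁) ⊕ ⊖ s 2

    quotient₃ : Series → Series → Series → Series
    quotient₃ r₁ r₂ r₃ = r₃ ⊕ ⊖ (s 1 ∙ quotient₂ r₁ r₂) ⊕ ⊖ (s 2 ∙ quotient₁ r₁) ⊕ ⊖ s 3

    quotient₄ : Series → Series → Series → Series → Series
    quotient₄ r₁ r₂ r₃ r₄ = r₄ ⊕ ⊖ (s 1 ∙ quotient₃ r₁ r₂ r₃) ⊕ ⊖ (s 2 ∙ quotient₂ r₁ r₂) ⊕ ⊖ (s 3 ∙ quotient₁ r₁) ⊕ ⊖ s 4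

    normalise : ∀ x → x ≈ c ∙ (a 0 ∙ x)
    normalise x = ≈-sym (≈-trans (solve 3 (λ c a x → c :* (a :* x) := c :* a :* x) ≈-refl c (a 0) x) (≈-trans (∙-cong ca (≈-refl {x})) (∙-identityˡ x)))

    divide : ∀ {x r₁ r₂ r₃ r₄} → Ratios (λ l → c ∙ (a ⋆ x) l) (x 0) r₁ r₂ r₃ r₄ →
      Ratios x (x 0) (quotient₁ r₁) (quotient₂ r₁ r₂) (quotient₃ r₁ r₂ r₃) (quotient₄ r₁ r₂ r₃ r₄)
    divide {x} {r₁} {r₂} {r₃} {r₄} (ratios e₁ e₂ e₃ e₄) = ratios x₁ x₂ x₃ x₄
      where
      x₁ : x 1 ≈ quotient₁ r₁ ∙ x 0
      x₁ = begin
        x 1 ≈⟨ normalise (x 1) ⟩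
        c ∙ (a 0 ∙ x 1) ≈⟨ solve 4 (λ c u a₁ x₀ → c :* u := c :* (u :+ a₁ :* x₀) :+ :- (c :* a₁ :* x₀)) ≈-refl c (a 0 ∙ x 1) (a 1) (x 0) ⟩
        c ∙ (a ⋆ x) 1 ⊕ ⊖ (s 1 ∙ x 0) ≈⟨ ⊕-cong e₁ (≈-refl {⊖ (s 1 ∙ x 0)}) ⟩
        r₁ ∙ x 0 ⊕ ⊖ (s 1 ∙ x 0) ≈⟨ solve 3 (λ r s x → r :* x :+ :- (s :* x) := (r :+ :- s) :* x) ≈-refl r₁ (s 1) (x 0) ⟩
        quotient₁ r₁ ∙ x 0 ∎
      x₂ : x 2 ≈ quotient₂ r₁ r₂ ∙ x 0
      x₂ = begin
        x 2 ≈⟨ normalise (x 2) ⟩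
        c ∙ (a 0 ∙ x 2) ≈⟨ solve 6 (λ c u a₁ a₂ x₀ x₁ → c :* u := c :* (u :+ (a₁ :* x₁ :+ a₂ :* x₀)) :+ :- (c :* a₁ :* x₁) :+ :- (c :* a₂ :* x₀)) ≈-refl c (a 0 ∙ x 2) (a 1) (a 2) (x 0) (x 1) ⟩
        c ∙ (a ⋆ x) 2 ⊕ ⊖ (s 1 ∙ x 1) ⊕ ⊖ (s 2 ∙ x 0) ≈⟨ ⊕-cong (⊕-cong e₂ (⊖-cong (∙-cong (≈-refl {s 1}) x₁))) (≈-refl {⊖ (s 2 ∙ x 0)}) ⟩
        r₂ ∙ x 0 ⊕ ⊖ (s 1 ∙ (quotient₁ r₁ ∙ x 0)) ⊕ ⊖ (s 2 ∙ x 0) ≈⟨ solve 5 (λ r s₁ q₁ s₂ x → r :* x :+ :- (s₁ :* (q₁ :* x)) :+ :- (s₂ :* x) := (r :+ :- (s₁ :* q₁) :+ :- s₂) :* x) ≈-refl r₂ (s 1) (quotient₁ r₁) (s 2) (x 0) ⟩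
        quotient₂ r₁ r₂ ∙ x 0 ∎
      x₃ : x 3 ≈ quotient₃ r₁ r₂ r₃ ∙ x 0
      x₃ = begin
        x 3 ≈⟨ normalise (x 3) ⟩
        c ∙ (a 0 ∙ x 3) ≈⟨ solve 8 (λ c u a₁ a₂ a₃ x₀ x₁ x₂ → c :* u := c :* (u :+ (a₁ :* x₂ :+ (a₂ :* x₁ :+ a₃ :* x₀))) :+ :- (c :* a₁ :* x₂) :+ :- (c :* a₂ :* x₁) :+ :- (c :* a₃ :* x₀)) ≈-refl c (a 0 ∙ x 3) (a 1) (a 2) (a 3) (x 0) (x 1) (x 2) ⟩
        c ∙ (a ⋆ x) 3 ⊕ ⊖ (s 1 ∙ x 2) ⊕ ⊖ (s 2 ∙ x 1) ⊕ ⊖ (s 3 ∙ x 0) ≈⟨ ⊕-cong (⊕-cong (⊕-cong e₃ (⊖-cong (∙-cong (≈-refl {s 1}) x₂))) (⊖-cong (∙-cong (≈-refl {s 2}) x₁))) (≈-refl {⊖ (s 3 ∙ x 0)}) ⟩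
        r₃ ∙ x 0 ⊕ ⊖ (s 1 ∙ (quotient₂ r₁ r₂ ∙ x 0)) ⊕ ⊖ (s 2 ∙ (quotient₁ r₁ ∙ x 0)) ⊕ ⊖ (s 3 ∙ x 0)
          ≈⟨ solve 7 (λ r s₁ q₂ s₂ q₁ s₃ x → r :* x :+ :- (s₁ :* (q₂ :* x)) :+ :- (s₂ :* (q₁ :* x)) :+ :- (s₃ :* x) := (r :+ :- (s₁ :* q₂) :+ :- (s₂ :* q₁) :+ :- s₃) :* x) ≈-refl r₃ (s 1) (quotient₂ r₁ r₂) (s 2) (quotient₁ r₁) (s 3) (x 0) ⟩
        quotient₃ r₁ r₂ r₃ ∙ x 0 ∎
      x₄ : x 4 ≈ quotient₄ r₁ r₂ r₃ r₄ ∙ x 0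
      x₄ = begin
        x 4 ≈⟨ normalise (x 4) ⟩
        c ∙ (a 0 ∙ x 4) ≈⟨ solve 6 (λ c u p₁ p₂ p₃ p₄ → c :* u := c :* (u :+ (p₁ :+ (p₂ :+ (p₃ :+ p₄)))) :+ :- (c :* p₁) :+ :- (c :* p₂) :+ :- (c :* p₃) :+ :- (c :* p₄)) ≈-refl c (a 0 ∙ x 4) (a 1 ∙ x 3) (a 2 ∙ x 2) (a 3 ∙ x 1) (a 4 ∙ x 0) ⟩
        c ∙ (a ⋆ x) 4 ⊕ ⊖ (c ∙ (a 1 ∙ x 3)) ⊕ ⊖ (c ∙ (a 2 ∙ x 2)) ⊕ ⊖ (c ∙ (a 3 ∙ x 1)) ⊕ ⊖ (c ∙ (a 4 ∙ x 0))
          ≈⟨ ⊕-cong (⊕-cong (⊕-cong (⊕-cong e₄ (⊖-cong (product 1 3 x₃))) (⊖-cong (product 2 2 x₂))) (⊖-cong (product 3 1 x₁))) (⊖-cong (solve 3 (λ c a x → c :* (a :* x) := c :* a :* x) ≈-refl c (a 4) (x 0))) ⟩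
        r₄ ∙ x 0 ⊕ ⊖ (s 1 ∙ quotient₃ r₁ r₂ r₃ ∙ x 0) ⊕ ⊖ (s 2 ∙ quotient₂ r₁ r₂ ∙ x 0) ⊕ ⊖ (s 3 ∙ quotient₁ r₁ ∙ x 0) ⊕ ⊖ (s 4 ∙ x 0)
          ≈⟨ solve 6 (λ r p₁ p₂ p₃ p₄ x → r :* x :+ :- (p₁ :* x) :+ :- (p₂ :* x) :+ :- (p₃ :* x) :+ :- (p₄ :* x) := (r :+ :- p₁ :+ :- p₂ :+ :- p₃ :+ :- p₄) :* x) ≈-refl r₄ (s 1 ∙ quotient₃ r₁ r₂ r₃) (s 2 ∙ quotient₂ r₁ r₂) (s 3 ∙ quotient₁ r₁) (s 4) (x 0) ⟩
        quotient₄ r₁ r₂ r₃ r₄ ∙ x 0 ∎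
        where
        product : ∀ i l {q} → x l ≈ q ∙ x 0 → c ∙ (a i ∙ x l) ≈ s i ∙ q ∙ x 0
        product i l {q} e = ≈-trans (∙-cong (≈-refl {c}) (∙-cong (≈-refl {a i}) e)) (solve 4 (λ c a q x → c :* (a :* (q :* x)) := c :* a :* q :* x) ≈-refl c (a i) q (x 0))

    lift : ∀ {x r₁ r₂ r₃ r₄} → Ratios (a ⋆ x) ((a ⋆ x) 0) r₁ r₂ r₃ r₄ → Ratios (λ l → c ∙ (a ⋆ x) l) (x 0) r₁ r₂ r₃ r₄
    lift {x} (ratios e₁ e₂ e₃ e₄) = ratios (component e₁) (component e₂) (component e₃) (component e₄)
      where
      component : ∀ {y r} → y ≈ r ∙ (a 0 ∙ x 0) → c ∙ y ≈ r ∙ x 0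
      component {y} {r} e = begin
        c ∙ y ≈⟨ ∙-cong (≈-refl {c}) e ⟩
        c ∙ (r ∙ (a 0 ∙ x 0)) ≈⟨ solve 4 (λ c r a x → c :* (r :* (a :* x)) := r :* (c :* (a :* x))) ≈-refl c r (a 0) (x 0) ⟩
        r ∙ (c ∙ (a 0 ∙ x 0)) ≈⟨ ∙-cong (≈-refl {r}) (≈-sym (normalise (x 0))) ⟩
        r ∙ x 0 ∎

    -- The hypothesis says that b is b 0 times the inverse cube of 1 + s₁ y + s₂ y² + .... The
    -- constants come from (1 + x)⁻³ = 1 - 3x + 6x² - 10x³ + 15x⁴ - ..., with 12 = 6·2 and -30 =
    -- -10·3.
    cube-root : ∀ b → (∀ l → (a ⋆ (a ⋆ (a ⋆ b))) (suc l) ≈ 𝟘) →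
      (b 3 ≈ (const (- + 3) ∙ s 3 ⊕ const (+ 12) ∙ (s 1 ∙ s 2) ⊕ const (- + 10) ∙ (s 1 ∙ s 1 ∙ s 1)) ∙ b 0) ×
      (b 4 ≈ (const (- + 3) ∙ s 4 ⊕ const (+ 12) ∙ (s 1 ∙ s 3) ⊕ const (+ 6) ∙ (s 2 ∙ s 2) ⊕ const (- + 30) ∙ (s 1 ∙ s 1 ∙ s 2) ⊕ const (+ 15) ∙ (s 1 ∙ s 1 ∙ (s 1 ∙ s 1))) ∙ b 0)
    cube-root b h = ≈-trans (ratio₃ third) (∙-cong (solve 3 (λ s₁ s₂ s₃ → :q₃ s₁ s₂ s₃ (:q₁ s₁ (:q₁ s₁ (con 0ℤ))) (:q₂ s₁ s₂ (:q₁ s₁ (con 0ℤ)) (:q₂ s₁ s₂ (con 0ℤ) (con 0ℤ))) (:q₃ s₁ s₂ s₃ (:q₁ s₁ (con 0ℤ)) (:q₂ s₁ s₂ (con 0ℤ) (con 0ℤ)) (:q₃ s₁ s₂ s₃ (con 0ℤ) (con 0ℤ) (con 0ℤ)))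
        := con (- + 3) :* s₃ :+ con (+ 12) :* (s₁ :* s₂) :+ con (- + 10) :* (s₁ :* s₁ :* s₁)) ≈-refl (s 1) (s 2) (s 3)) (≈-refl {b 0}))
      , ≈-trans (ratio₄ third) (∙-cong (solve 4 (λ s₁ s₂ s₃ s₄ → :q₄ s₁ s₂ s₃ s₄ (:q₁ s₁ (:q₁ s₁ (con 0ℤ))) (:q₂ s₁ s₂ (:q₁ s₁ (con 0ℤ)) (:q₂ s₁ s₂ (con 0ℤ) (con 0ℤ))) (:q₃ s₁ s₂ s₃ (:q₁ s₁ (con 0ℤ)) (:q₂ s₁ s₂ (con 0ℤ) (con 0ℤ)) (:q₃ s₁ s₂ s₃ (con 0ℤ) (con 0ℤ) (con 0ℤ)))
          (:q₄ s₁ s₂ s₃ s₄ (:q₁ s₁ (con 0ℤ)) (:q₂ s₁ s₂ (con 0ℤ) (con 0ℤ)) (:q₃ s₁ s₂ s₃ (con 0ℤ) (con 0ℤ) (con 0ℤ)) (:q₄ s₁ s₂ s₃ s₄ (con 0ℤ) (con 0ℤ) (con 0ℤ) (con 0ℤ)))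
        := con (- + 3) :* s₄ :+ con (+ 12) :* (s₁ :* s₃) :+ con (+ 6) :* (s₂ :* s₂) :+ con (- + 30) :* (s₁ :* s₁ :* s₂) :+ con (+ 15) :* (s₁ :* s₁ :* (s₁ :* s₁))) ≈-refl (s 1) (s 2) (s 3) (s 4)) (≈-refl {b 0}))
      where
      -- Before the first division all ratios are zero, since the triple product has no positive
      -- powers of y.
      initial : ∀ l → c ∙ (a ⋆ (a ⋆ (a ⋆ b))) (suc l) ≈ 𝟘 ∙ (a ⋆ (a ⋆ b)) 0
      initial l = ≈-trans (∙-cong (≈-refl {c}) (h l)) (solve 2 (λ c x → c :* con 0ℤ := con 0ℤ :* x) ≈-refl c ((a ⋆ (a ⋆ b)) 0))
      third = divide {b} (lift {b} (divide {a ⋆ b} (lift {a ⋆ b} (divide {a ⋆ (a ⋆ b)} (ratios (initial 0) (initial 1) (initial 2) (initial 3))))))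
      :q₁ : ∀ {m} (s₁ r₁ : Polynomial m) → Polynomial m
      :q₁ s₁ r₁ = r₁ :+ :- s₁
      :q₂ : ∀ {m} (s₁ s₂ r₁ r₂ : Polynomial m) → Polynomial m
      :q₂ s₁ s₂ r₁ r₂ = r₂ :+ :- (s₁ :* :q₁ s₁ r₁) :+ :- s₂
      :q₃ : ∀ {m} (s₁ s₂ s₃ r₁ r₂ r₃ : Polynomial m) → Polynomial m
      :q₃ s₁ s₂ s₃ r₁ r₂ r₃ = r₃ :+ :- (s₁ :* :q₂ s₁ s₂ r₁ r₂) :+ :- (s₂ :* :q₁ s₁ r₁) :+ :- s₃
      :q₄ : ∀ {m} (s₁ s₂ s₃ s₄ r₁ r₂ r₃ r₄ : Polynomial m) → Polynomial m
      :q₄ s₁ s₂ s₃ s₄ r₁ r₂ r₃ r₄ = r₄ :+ :- (s₁ :* :q₃ s₁ s₂ s₃ r₁ r₂ r₃) :+ :- (s₂ :* :q₂ s₁ s₂ r₁ r₂) :+ :- (s₃ :* :q₁ s₁ r₁) :+ :- s₄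

-- Symmetrized rank moments

falling-shift : ∀ x k → falling (x + 1ℤ) (suc k) ≡ (x + 1ℤ) * falling x k
falling-shift x zero = identity x
  where
  identity : ∀ x → 1ℤ * (x + 1ℤ - 0ℤ) ≡ (x + 1ℤ) * 1ℤ
  identity = solve-∀
falling-shift x (suc k) = trans (cong₂ (λ a b → a * (x + 1ℤ - b)) (falling-shift x k) (ℤₚ.pos-+ 1 k)) (regroup x (+ k) (falling x k))
  where
  regroup : ∀ x k f → (x + 1ℤ) * f * (x + 1ℤ - (1ℤ + k)) ≡ (x + 1ℤ) * (f * (x - k))
  regroup = solve-∀

falling-pascal : ∀ x k → falling (x + 1ℤ) (suc k) ≡ falling x (suc k) + + suc k * falling x k
falling-pascal x k = trans (falling-shift x k) (trans (regroup x (+ k) (falling x k)) (cong (λ c → falling x k * (x - + k) + c * falling x k) (sym (ℤₚ.pos-+ 1 k))))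
  where
  regroup : ∀ x k f → (x + 1ℤ) * f ≡ f * (x - k) + (1ℤ + k) * f
  regroup = solve-∀

falling-zero : ∀ k → falling 0ℤ (suc k) ≡ 0ℤ
falling-zero zero = refl
falling-zero (suc k) = cong (_* (0ℤ - + suc k)) (falling-zero k)

-- Pascal's rule makes consecutive values congruent modulo (k + 1)!, so divisibility spreads from x
-- = 0 in both directions and covers negative x. It makes the division in `binomℤ` exact.
falling-divisible : ∀ k x → + (k !) ∣ falling x k
falling-divisible zero x = divides 1ℤ refl
falling-divisible (suc k) x = ≋0⇒∣ (everywhere x)
  where
  open Mod (+ (suc k !))
  increment : ∀ x → + suc k * falling x k ≋ 0ℤ
  increment x with falling-divisible k x
  ... | divides q e = by q (trans (cong (+ suc k *_) e) (trans (regroup (+ suc k) q (+ (k !))) (trans (cong (q *_) (sym (ℤₚ.pos-* (suc k) (k !)))) (sym (ℤₚ.+-identityˡ (q * + (suc k !)))))))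
    where
    regroup : ∀ a b c → a * (b * c) ≡ b * (a * c)
    regroup = solve-∀
  up : ∀ x → falling x (suc k) ≋ 0ℤ → falling (x + 1ℤ) (suc k) ≋ 0ℤ
  up x e = ≋-trans (≋-reflexive (falling-pascal x k)) (≋-+ e (increment x))
  down : ∀ x → falling (x + 1ℤ) (suc k) ≋ 0ℤ → falling x (suc k) ≋ 0ℤ
  down x e = ≋-trans (≋-reflexive (trans (isolate (falling x (suc k)) (+ suc k * falling x k)) (cong (_- + suc k * falling x k) (sym (falling-pascal x k))))) (≋-+ e (≋-neg (increment x)))
    where
    isolate : ∀ a b → a ≡ a + b - b
    isolate = solve-∀
  everywhere : ∀ x → falling x (suc k) ≋ 0ℤ
  everywhere (+ zero) = ≋-reflexive (falling-zero k)
  everywhere (+ suc n) = subst (λ y → falling y (suc k) ≋ 0ℤ) (trans (sym (ℤₚ.pos-+ n 1)) (cong +_ (ℕₚ.+-comm n 1))) (up (+ n) (everywhere (+ n)))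
  everywhere -[1+ zero ] = down -[1+ zero ] (≋-reflexive (falling-zero k))
  everywhere -[1+ suc n ] = down -[1+ suc n ] (everywhere -[1+ n ])

%ℕ≡0 : ∀ a n .{{_ : ℕ.NonZero n}} → + n ℤᵤ.∣ a → a ℤ.%ℕ n ≡ 0
%ℕ≡0 (+ m) n h = ℕ∣.n∣m⇒m%n≡0 m n h
%ℕ≡0 -[1+ m ] n h with suc m % n | ℕ∣.n∣m⇒m%n≡0 (suc m) n h
... | zero | refl = refl

binomℤ-falling : ∀ x k → + (k !) * binomℤ x k ≡ falling x k
binomℤ-falling x k = sym (trans (a≡a%ℕn+[a/ℕn]*n (falling x k) (k !) {{k !≢0}}) (trans (cong (λ r → + r + binomℤ x k * + (k !)) (%ℕ≡0 (falling x k) (k !) {{k !≢0}} (∣⇒∣ᵤ (falling-divisible k x)))) (trans (ℤₚ.+-identityˡ _) (ℤₚ.*-comm (binomℤ x k) (+ (k !))))))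

count-N : ∀ m n → + N m n ≡ count m n
count-N m n = trans (length-total (filterᵇ (λ p → ⌊ rank p ℤ.≟ m ⌋) (partitions n))) (trans (total-filterᵇ (λ _ → 1ℤ) (λ p → ⌊ rank p ℤ.≟ m ⌋) (partitions n)) (total-cong indicator (partitions n)))
  where
  length-total : ∀ (xs : List (List ℕ)) → + length xs ≡ total (λ _ → 1ℤ) xs
  length-total [] = refl
  length-total (x ∷ xs) = trans (ℤₚ.pos-+ 1 (length xs)) (cong (_+_ 1ℤ) (length-total xs))
  indicator : ∀ p → (if ⌊ rank p ℤ.≟ m ⌋ then 1ℤ else 0ℤ) ≡ ι (m - rank p)
  indicator p with rank p ℤ.≟ m
  ... | yes refl = sym (ι-diagonal (rank p))
  ... | no h = sym (ι-off m (rank p) (h ∘ sym))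

sum-negative : ∀ b (f : ℤ → ℤ) → sum b (λ i → f (+ i - + b)) ≡ sum b (λ k → f -[1+ k ])
sum-negative zero f = refl
sum-negative (suc b) f = trans (sum-first b (λ i → f (+ i - + suc b))) (trans (cong (_+_ (f -[1+ b ])) (trans (sum-cong b (λ i _ → cong f (suc-cancel i b))) (sum-negative b f))) (ℤₚ.+-comm (f -[1+ b ]) _))

total-rangeℤ : ∀ b (f : ℤ → ℤ) → total f (rangeℤ b) ≡ two-sided b f
total-rangeℤ b f = begin
  total f (map (λ i → + i - + b) (upTo (suc (b ℕ.+ b)))) ≡⟨ total-map f (λ i → + i - + b) (upTo (suc (b ℕ.+ b))) ⟩
  total (λ i → f (+ i - + b)) (upTo (suc (b ℕ.+ b))) ≡⟨ total-applyUpTo (λ i → f (+ i - + b)) (λ i → i) (suc (b ℕ.+ b)) ⟩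
  sum (suc (b ℕ.+ b)) (λ i → f (+ i - + b)) ≡⟨ cong (λ n → sum n (λ i → f (+ i - + b))) (sym (ℕₚ.+-suc b b)) ⟩
  sum (b ℕ.+ suc b) (λ i → f (+ i - + b)) ≡⟨ sum-split b (suc b) (λ i → f (+ i - + b)) ⟩
  sum b (λ i → f (+ i - + b)) + sum (suc b) (λ i → f (+ (b ℕ.+ i) - + b)) ≡⟨ cong₂ _+_ (sum-negative b f) (sum-cong (suc b) (λ i _ → cong f (trans (cong (_- + b) (ℤₚ.pos-+ b i)) (cancel (+ b) (+ i))))) ⟩
  sum b (λ k → f -[1+ k ]) + sum (suc b) (λ i → f (+ i)) ≡⟨ cong (_+_ (sum b (λ k → f -[1+ k ]))) (sum-first b (λ i → f (+ i))) ⟩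
  sum b (λ k → f -[1+ k ]) + (f 0ℤ + sum b (λ k → f (+ suc k))) ≡⟨ regroup (sum b (λ k → f -[1+ k ])) (f 0ℤ) (sum b (λ k → f (+ suc k))) ⟩
  f 0ℤ + (sum b (λ k → f (+ suc k)) + sum b (λ k → f -[1+ k ])) ≡⟨ cong (_+_ (f 0ℤ)) (sym (sum-+ b (λ k → f (+ suc k)) (λ k → f -[1+ k ]))) ⟩
  two-sided b f ∎
  where
  open ≡-Reasoning
  cancel : ∀ b i → b + i - b ≡ i
  cancel = solve-∀
  regroup : ∀ a b c → a + (b + c) ≡ b + (c + a)
  regroup = solve-∀

η-W : ∀ k n → η k n ≡ W (λ r → binomℤ (r + + ((k ℕ.∸ 1) ℕ./ 2)) k) n
η-W k n = trans (foldr-total (rangeℤ n)) (trans (total-rangeℤ n (λ m → b m * + N m n)) (trans (two-sided-cong n (λ m → cong (b m *_) (count-N m n))) (two-sided-count n b n ℕₚ.≤-refl)))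
  where
  b : ℤ → ℤ
  b r = binomℤ (r + + ((k ℕ.∸ 1) ℕ./ 2)) k
  foldr-total : ∀ xs → foldr _+_ (+ 0) (map (λ m → b m * + N m n) xs) ≡ total (λ m → b m * + N m n) xs
  foldr-total [] = refl
  foldr-total (x ∷ xs) = cong (_+_ (b x * + N x n)) (foldr-total xs)

-- Averaging with the reflected weight turns the binomial coefficient into a coefficient of zʳ + z⁻ʳ.
η-moment : ∀ k l → (∀ r → falling (r + + ((k ℕ.∸ 1) ℕ./ 2)) k + falling (- r + + ((k ℕ.∸ 1) ℕ./ 2)) k ≡ + (k !) * v r l) → .{{_ : ℕ.NonZero (k !)}} → ∀ n → + 2 * η k n ≡ moment l n
η-moment k l h n = ℤₚ.*-cancelˡ-≡ (+ (k !)) _ _ (begin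
  + (k !) * (+ 2 * η k n) ≡⟨ double (+ (k !)) (η k n) ⟩
  + (k !) * η k n + + (k !) * η k n ≡⟨ cong (λ x → x + x) scaled ⟩
  W f n + W f n ≡⟨ cong (_+_ (W f n)) (sym (W-reflect f n)) ⟩
  W f n + W (λ r → f (- r)) n ≡⟨ sym (W-+ f (λ r → f (- r)) n) ⟩
  W (λ r → f r + f (- r)) n ≡⟨ W-cong _ _ n (λ r _ → h r) ⟩
  W (λ r → + (k !) * v r l) n ≡⟨ W-* (+ (k !)) (λ r → v r l) n ⟩
  + (k !) * moment l n ∎)
  where
  open ≡-Reasoning
  f : ℤ → ℤ
  f r = falling (r + + ((k ℕ.∸ 1) ℕ./ 2)) k
  double : ∀ a b → a * (+ 2 * b) ≡ a * b + a * b
  double = solve-∀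
  scaled : + (k !) * η k n ≡ W f n
  scaled = trans (cong (+ (k !) *_) (η-W k n)) (trans (sym (W-* (+ (k !)) (λ r → binomℤ (r + + ((k ℕ.∸ 1) ℕ./ 2)) k) n)) (W-cong _ _ n (λ r _ → binomℤ-falling (r + + ((k ℕ.∸ 1) ℕ./ 2)) k)))

η₄-moment : ∀ n → + 2 * η 4 n ≡ moment 2 n
η₄-moment = η-moment 4 2 (λ r → trans (identity r) (trans (cong (+ 2 *_) (sym (v₂ r))) (sym (ℤₚ.*-assoc (+ 2) (+ 12) (v r 2)))))
  where
  identity : ∀ r → 1ℤ * (r + 1ℤ - 0ℤ) * (r + 1ℤ - 1ℤ) * (r + 1ℤ - + 2) * (r + 1ℤ - + 3) + 1ℤ * (- r + 1ℤ - 0ℤ) * (- r + 1ℤ - 1ℤ) * (- r + 1ℤ - + 2) * (- r + 1ℤ - + 3) ≡ + 2 * (r * r * (r * r - 1ℤ))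
  identity = solve-∀

η₆-moment : ∀ n → + 2 * η 6 n ≡ moment 3 n
η₆-moment = η-moment 6 3 (λ r → trans (identity r) (trans (cong (+ 2 *_) (sym (v₃ r))) (sym (ℤₚ.*-assoc (+ 2) (+ 360) (v r 3)))))
  where
  identity : ∀ r → 1ℤ * (r + + 2 - 0ℤ) * (r + + 2 - 1ℤ) * (r + + 2 - + 2) * (r + + 2 - + 3) * (r + + 2 - + 4) * (r + + 2 - + 5)
    + 1ℤ * (- r + + 2 - 0ℤ) * (- r + + 2 - 1ℤ) * (- r + + 2 - + 2) * (- r + + 2 - + 3) * (- r + + 2 - + 4) * (- r + + 2 - + 5) ≡ + 2 * (r * r * (r * r - 1ℤ) * (r * r - + 4))
  identity = solve-∀

-- The congruences for the fourth and sixth moments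

L-R-cubed : ∀ p l → Mod._≈_ p ((Θ ⋆ (Θ ⋆ (Θ ⋆ L R))) (suc l)) 𝟘
L-R-cubed p l = Mod.≈-reflexive p (λ n → trans (Θ³⋆L-R l n) (sym (𝟘≡0 n)))

module FourthMoment where

  open ThetaSupport 5
  open CharSolver 4 refl
  open Five P

  L-R₃≈ : L R 3 ≈ const (+ 2) ∙ B₃
  L-R₃≈ = ≈-trans (proj₁ (Division.cube-root (+ 5) Θ (P ∙ P ∙ P) (≈-reflexive Jacobi.jacobi) (L R) (L-R-cubed (+ 5))))
    (≈-trans (∙-cong (≈-refl {q}) (≈-reflexive (λ n → trans (L-R₀ n) (sym (const-∙ (+ 4) P n)))))
    (solve 2 (λ q P → q :* (con (+ 4) :* P) := con (+ 2) :* (con (+ 2) :* (P :* q))) ≈-refl q P))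
    where
    s : ℕ → Series
    s l = P ∙ P ∙ P ∙ Θ l
    q : Series
    q = const (- + 3) ∙ s 3 ⊕ const (+ 12) ∙ (s 1 ∙ s 2) ⊕ const (- + 10) ∙ (s 1 ∙ s 1 ∙ s 1)

  moment₂≋0 : ∀ n → n % 25 ≡ 24 → moment 2 n ≋ 0ℤ
  moment₂≋0 n h = ≋-trans moment≋L (≋-trans (at L-R₃≈ n) (≋-trans (≋-reflexive (const-∙ (+ 2) B₃ n)) (≋0-*ʳ (+ 2) (B₃≋0 (≈-reflexive P∙Euler) (≈-reflexive Jacobi.jacobi) n h))))
    where
    n≋24 : + n ≋ + 24
    n≋24 = ≋-trans (≋-% {25} (ℕ∣.divides 5 refl) n) (≋-reflexive (cong +_ h))
    -- At the residue 24 the factor is 6·24 + 2 = 146 = 1 + 29·5, so `moment 2` is isolated with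
    -- coefficient 1.
    coefficient : + 6 * + n + + 2 ≋ 1ℤ
    coefficient = ≋-trans (≋-+ (≋-* (≋-refl {+ 6}) n≋24) (≋-refl {+ 2})) (by (+ 29) refl)
    moment≋L : moment 2 n ≋ L R 3 n
    moment≋L = ≋-sym (≋-trans (≋-reflexive (L-R₃ n)) (≋-trans (≋-+ (≋0-*ˡ (moment 3 n) (by (+ 4) refl)) (≋-* coefficient (≋-refl {moment 2 n}))) (≋-reflexive (trans (ℤₚ.+-identityˡ _) (ℤₚ.*-identityˡ (moment 2 n))))))

  5∣η₄ : ∀ n → n % 25 ≡ 24 → + 5 ∣ η 4 n
  5∣η₄ n h = ≋0⇒∣ (≋-trans halve (≋0-*ʳ (+ 3) (≋-trans (≋-reflexive (η₄-moment n)) (moment₂≋0 n h))))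
    where
    halve : η 4 n ≋ + 3 * (+ 2 * η 4 n)
    halve = by (- η 4 n) (identity (η 4 n))
      where
      identity : ∀ x → x ≡ + 3 * (+ 2 * x) + - x * + 5
      identity = solve-∀

module SixthMoment where

  open ThetaSupport 7
  open CharSolver 6 refl
  open Seven P
  open FourthCoefficient P (≈-reflexive P∙Euler) (≈-reflexive Jacobi.jacobi) using (B₄≋0)

  L-R₄≈ : L R 4 ≈ const (+ 2) ∙ B₄
  L-R₄≈ = ≈-trans (proj₂ (Division.cube-root (+ 7) Θ (P ∙ P ∙ P) (≈-reflexive Jacobi.jacobi) (L R) (L-R-cubed (+ 7))))
    (≈-trans (∙-cong (≈-refl {q}) (≈-reflexive (λ n → trans (L-R₀ n) (sym (const-∙ (+ 4) P n)))))
    (solve 2 (λ q P → q :* (con (+ 4) :* P) := con (+ 2) :* (con (+ 2) :* (P :* q))) ≈-refl q P))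
    where
    s : ℕ → Series
    s l = P ∙ P ∙ P ∙ Θ l
    q : Series
    q = const (- + 3) ∙ s 4 ⊕ const (+ 12) ∙ (s 1 ∙ s 3) ⊕ const (+ 6) ∙ (s 2 ∙ s 2) ⊕ const (- + 30) ∙ (s 1 ∙ s 1 ∙ s 2) ⊕ const (+ 15) ∙ (s 1 ∙ s 1 ∙ (s 1 ∙ s 1))

  moment₃≋0 : ∀ n → n % 49 ≡ 47 → moment 3 n ≋ 0ℤ
  -- The two numerical arguments evaluate Y at 0 and 1; its linear coefficient is the integer -27 =
  -- 1 - 4·7.
  moment₃≋0 n h = ≋-trans moment≋L (≋-trans (at L-R₄≈ n) (≋-trans (≋-reflexive (const-∙ (+ 2) B₄ n)) (≋0-*ʳ (+ 2) (B₄≋0 (≋-reflexive refl) (by (- + 4) refl) n h))))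
    where
    n≋47 : + n ≋ + 47
    n≋47 = ≋-trans (≋-% {49} (ℕ∣.divides 7 refl) n) (≋-reflexive (cong +_ h))
    -- At the residue 47 the factor is 6·47 + 6 = 288 = 1 + 41·7.
    coefficient : + 6 * + n + + 6 ≋ 1ℤ
    coefficient = ≋-trans (≋-+ (≋-* (≋-refl {+ 6}) n≋47) (≋-refl {+ 6})) (by (+ 41) refl)
    moment≋L : moment 3 n ≋ L R 4 n
    moment≋L = ≋-sym (≋-trans (≋-reflexive (L-R₄ n)) (≋-trans (≋-+ (≋0-*ˡ (moment 4 n) (by (+ 6) refl)) (≋-* coefficient (≋-refl {moment 3 n}))) (≋-reflexive (trans (ℤₚ.+-identityˡ _) (ℤₚ.*-identityˡ (moment 3 n))))))

  7∣η₆ : ∀ n → n % 49 ≡ 47 → + 7 ∣ η 6 n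
  7∣η₆ n h = ≋0⇒∣ (≋-trans halve (≋0-*ʳ (+ 4) (≋-trans (≋-reflexive (η₆-moment n)) (moment₃≋0 n h))))
    where
    halve : η 6 n ≋ + 4 * (+ 2 * η 6 n)
    halve = by (- η 6 n) (identity (η 6 n))
      where
      identity : ∀ x → x ≡ + 4 * (+ 2 * x) + - x * + 7
      identity = solve-∀

theorem1p1 : (n : ℕ) → (+ 5 ℤᵤ.∣ η 4 (25 ℕ.* n ℕ.+ 24)) × (+ 7 ℤᵤ.∣ η 6 (49 ℕ.* n ℕ.+ 47))
theorem1p1 n = ∣⇒∣ᵤ (FourthMoment.5∣η₄ (25 ℕ.* n ℕ.+ 24) (residue 25 24 refl)) , ∣⇒∣ᵤ (SixthMoment.7∣η₆ (49 ℕ.* n ℕ.+ 47) (residue 49 47 refl))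
  where
  residue : ∀ m r .{{_ : ℕ.NonZero m}} → r % m ≡ r → (m ℕ.* n ℕ.+ r) % m ≡ r
  residue m r h = trans (cong (_% m) (trans (ℕₚ.+-comm (m ℕ.* n) r) (cong (r ℕ.+_) (ℕₚ.*-comm m n)))) (trans ([m+kn]%n≡m%n r n m) h)
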